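{- Let $p$ be an odd prime, $n\ge 2$ an integer, $F$ the finite field of order $p^n$ and $L$ its quadratic extension (of order $p^{2n}$). Let $k\ge 2$ be an integer with $k<\frac{p}{2}+1$, and suppose $s=1+k(p^n-1)$ is an invertible Niho exponent over $L$. Let $d_1=\gcd(k,p^n+1)$ and $d_2=\gcd(k-1,p^n+1)$. If $d_1+d_2\ge 5$, then the Weil spectrum $\{W_{L,s}(a): a\in L^\times\}$ has at least five elements. Moreover, four of these values are $0$, $-p^n$, $2\alpha p^n$ and $(2\beta+1)p^n$ for some integers $\alpha,\beta\ge 1$.
   Context: $\mu(x)=e^{2\pi i\,\mathrm{Tr}_{L/\mathbb{F}_p}(x)/p}$ is the canonical additive character of $L$, and $W_{L,s}(a)=\sum_{x\in L}\mu(x^s-ax)$ for $a\in L$. The exponent $s$ is invertible over $L$ if $\gcd(s,p^{2n}-1)=1$. A Niho exponent over $L$ is an integer $s$ not congruent to a power of $p$ modulo $p^{2n}-1$ with $s\equiv p^j\pmod{p^n-1}$ for some $j\ge0$. -}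

module Defs where

open import Level using (0ℓ)
open import Data.Nat as ℕ using (ℕ; zero; suc; _∸_)
open import Data.Integer as ℤ using (ℤ; +_; -[1+_])
open import Data.Integer.Divisibility as ℤD using ()
open import Data.Fin using (Fin; _≟_)
open import Data.Maybe using (Maybe; just; nothing; maybe)
open import Data.List using (List; []; _∷_; allFin; length)
open import Data.List.Membership.Propositional using (_∈_)
open import Data.List.Relation.Unary.Unique.Propositional using (Unique)
open import Data.Product using (∃; _×_)
open import Relation.Binary.PropositionalEquality using (_≡_; _≢_)
open import Relation.Binary.Definitions using (DecidableEquality)
open import Relation.Nullary using (yes; no)
open import Algebra.Structures using (IsCommutativeRing)

record FiniteField : Set₁ where
  infixl 6 _+_
  infixl 7 _*_
  field
    Carrier  : Set
    _≟F_     : DecidableEquality Carrier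
    _+_ _*_  : Carrier → Carrier → Carrier
    -_       : Carrier → Carrier
    0# 1#    : Carrier
    isCommutativeRing : IsCommutativeRing _≡_ _+_ _*_ -_ 0# 1#
    0≢1      : 0# ≢ 1#
    inverse  : ∀ x → x ≢ 0# → ∃ λ y → x * y ≡ 1#
    elements : List Carrier
    complete : ∀ x → x ∈ elements
    unique   : Unique elements

  order : ℕ
  order = length elements

  _-_ : Carrier → Carrier → Carrier
  x - y = x + (- y)

  _^_ : Carrier → ℕ → Carrier
  x ^ zero  = 1#
  x ^ suc m = x * (x ^ m)

  ι : ℕ → Carrier
  ι zero    = 0#
  ι (suc c) = 1# + ι c

-- The ring ℤ[ζ_p] of cyclotomic integers (ζ_p = e^{2πi/p}), modelled as
-- the group ring ℤ[C_p] = ℤ[x]/(x^p - 1), i.e. coefficient functions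
-- Fin p → ℤ (coefficient of ζ^i), modulo the kernel of x ↦ ζ_p, which for
-- p prime is ℤ·(1 + x + … + x^{p-1}): two elements are equal in ℤ[ζ_p]
-- iff their coefficient difference is a constant vector.

Cyc : ℕ → Set
Cyc p = Fin p → ℤ

_≈Cyc_ : ∀ {p} → Cyc p → Cyc p → Set
u ≈Cyc v = ∃ λ (c : ℤ) → ∀ i → u i ℤ.- v i ≡ c

0Cyc : ∀ {p} → Cyc p
0Cyc i = + 0

_+Cyc_ : ∀ {p} → Cyc p → Cyc p → Cyc p
(u +Cyc v) i = u i ℤ.+ v i

ζ^ : ∀ {p} → Fin p → Cyc p
ζ^ c i with c ≟ i
... | yes _ = + 1
... | no  _ = + 0

embℤ : ∀ {p} → ℤ → Cyc p
embℤ m Fin.zero    = m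
embℤ m (Fin.suc i) = + 0

sumCyc : ∀ {p} {A : Set} → (A → Cyc p) → List A → Cyc p
sumCyc f []       = 0Cyc
sumCyc f (x ∷ xs) = f x +Cyc sumCyc f xs

module _ (L : FiniteField) (p m : ℕ) where
  open FiniteField L

  sumL : ℕ → (ℕ → Carrier) → Carrier
  sumL zero    f = 0#
  sumL (suc r) f = f r + sumL r f

  Tr : Carrier → Carrier
  Tr x = sumL m (λ i → x ^ (p ℕ.^ i))

  -- the element c of F_p = {0,…,p-1} with Tr x = c·1 (nothing if there is
  -- none; in a field of characteristic p the trace always lies in F_p, so
  -- the "nothing" branch never occurs)
  findFp : Carrier → List (Fin p) → Maybe (Fin p)
  findFp y []       = nothing
  findFp y (c ∷ cs) with y ≟F ι (Data.Fin.toℕ c)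
  ... | yes _ = just c
  ... | no  _ = findFp y cs

  TrFp : Carrier → Maybe (Fin p)
  TrFp x = findFp (Tr x) (allFin p)

  μ : Carrier → Cyc p
  μ y = maybe ζ^ 0Cyc (TrFp y)

  W : ℕ → Carrier → Cyc p
  W s a = sumCyc (λ x → μ ((x ^ s) - (a * x))) elements

_≡_[mod_] : ℕ → ℕ → ℕ → Set
a ≡ b [mod m ] = (+ m) ℤD.∣ ((+ a) ℤ.- (+ b))

IsNiho : ℕ → ℕ → ℕ → Set
IsNiho p n s =
  (¬ (∃ λ j → s ≡ p ℕ.^ j [mod (p ℕ.^ (2 ℕ.* n) ∸ 1) ]))
  × (∃ λ j → s ≡ p ℕ.^ j [mod (p ℕ.^ n ∸ 1) ])
  where open import Relation.Nullary using (¬_)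

{-# OPTIONS --safe #-}

-- Sorting the x ∈ L* by their class modulo F*, i.e. by u = x^{q-1} ∈ U = {u : u^{q+1} = 1} with q = p^n, gives Niho's
-- formula W(a) = (N(a) - 1) q, where N(a) is the number of u ∈ U with a + ā u = u^k + u^{1-k} (ā = a^q). For fixed u this is
-- the equation of an affine line in L ≅ F². So N(a) counts the lines through a in a family of q + 1 lines, no two of them
-- parallel, and therefore ∑ N = ∑ N(N-1) = q(q+1).
--
-- For v ∈ U the equation factors as (u^k - v)(u^{k-1} - v̄) = 0, so that N(1) = d₁ + d₂ - 1 =: B, and N(v) = d₁ + d₂ for
-- every v ≠ 1 that is a d₁d₂-th power in U. As d₁ + d₂ is odd, these are the two positive values named in the theorem.
--
-- The lines of u, ur, ut are concurrent for exactly one u, unless those of r and t both pass through the point 1, so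
-- ∑ N(N-1)(N-2) ≤ q(q-1) + q(B-1)(B-2). With the first two moments this makes ∑ N(N-1)(N-B) negative, hence 2 ≤ N(a) < B
-- for some a, which is the fifth value. The values N = 0 and N = 1 also come from the first two moments.

module Submission where

open import Defs
open import Level using (0ℓ)
open import Algebra.Bundles using (CommutativeRing)
import Algebra.Solver.Ring as RingSolver
open import Algebra.Solver.Ring.AlmostCommutativeRing using (fromCommutativeRing; _-Raw-AlmostCommutative⟶_)
open import Data.Empty using (⊥; ⊥-elim)
open import Data.Fin as Fin using (Fin; #_; toℕ; fromℕ; inject₁; fromℕ<)
open import Data.Fin.Patterns using (0F; 1F; 2F; 3F; 4F)
open import Data.Fin.Properties using (toℕ-fromℕ; toℕ-inject₁; toℕ<n; toℕ-fromℕ<; toℕ-injective)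
open import Data.Integer as ℤ using (ℤ; +_; -_; -[1+_])
import Data.Integer.Properties as ℤ
import Data.Integer.Tactic.RingSolver as ℤ-RingSolver
open import Data.List using (List; []; _∷_; length; map; foldr; allFin)
open import Data.List.Membership.Propositional using (_∈_; lose)
open import Data.List.Membership.Propositional.Properties using (∈-map⁺; ∈-allFin)
open import Data.List.Membership.Propositional.Properties.WithK using (unique∧set⇒bag)
open import Data.List.Relation.Binary.BagAndSetEquality using (∼bag⇒↭)
open import Data.List.Relation.Binary.Permutation.Propositional using (_↭_; ↭⇒↭ₛ)
open import Data.List.Relation.Binary.Permutation.Propositional.Properties using () renaming (map⁺ to ↭-map⁺)
open import Data.List.Relation.Binary.Permutation.Setoid.Properties using (foldr-commMonoid)
open import Data.List.Relation.Unary.All as All using (All; []; _∷_)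
open import Data.List.Relation.Unary.AllPairs using ([]; _∷_)
open import Data.List.Relation.Unary.Any as Any using (here; there)
open import Data.List.Relation.Unary.Unique.Propositional using (Unique)
open import Data.List.Relation.Unary.Unique.Propositional.Properties using (map⁺)
open import Data.Maybe as Maybe using (Maybe; just; maybe)
open import Data.Nat using (ℕ; zero; suc; _+_; _*_; _∸_; _^_; _≤_; _<_; _%_; _/_; _!; _≤?_; _<?_; z≤n; s≤s; s≤s⁻¹; _≤′_; ≤′-refl; ≤′-step; NonZero; >-nonZero; nonTrivial⇒n>1)
open import Data.Nat.Combinatorics using (_C_; nCk≡n!/k![n-k]!; k![n∸k]!∣n!; nCn≡1)
open import Data.Nat.Coprimality using (coprime-Bézout; prime⇒coprime)
open import Data.Nat.DivMod using (m/n*n≡m; m≡m%n+[m/n]*n)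
open import Data.Nat.Divisibility using (_∣_; divides; _∤_; ∣⇒≤; m∣m*n; n∣m*n; ∣m⇒∣m*n; ∣m+n∣m⇒∣n; ∣1⇒≡1; ∣-trans)
open import Data.Nat.GCD using (gcd; gcd[m,n]∣m; gcd[m,n]∣n; gcd-GCD; gcd[m,n]≢0; gcd-greatest; module Bézout)
open import Data.Nat.Primality using (Prime; euclidsLemma; prime⇒nonZero; prime⇒nonTrivial)
open import Data.Nat.Properties
open import Data.Nat.Tactic.RingSolver using (solve-∀)
open import Data.Product using (∃; _×_; _,_; proj₁; proj₂)
open import Data.Sum using (_⊎_; inj₁; inj₂; [_,_]′)
open import Function using (_∘_; id; mk⇔)
open import Relation.Binary.Definitions using (DecidableEquality; tri<; tri≈; tri>)
open import Relation.Binary.PropositionalEquality hiding (J)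
open import Relation.Nullary using (¬_; Dec; yes; no)
open import Relation.Nullary.Decidable using (_×-dec_; _⊎-dec_; ¬?; dec⇒maybe)

-- The sums are evaluated without complex numbers. The coefficient of ζ^i in W(a) counts the x with
-- Tr(x^s - ax) = i, and W(a) is the integer m exactly when all coefficients at i ≠ 0 agree and the
-- one at 0 exceeds them by m. Niho's formula is thus a statement about differences of counts, and
-- it is kept free of subtraction because counts are natural numbers. The bound on k enters through
-- 2k - 1 ≤ p. It gives d₁ + d₂ ≤ p ≤ q, hence B ≤ q, and with n ≥ 2 also d₁d₂ ≤ p² ≤ q, so that
-- some element of U has a d₁d₂-th power other than 1. Invertibility of s enters through gcd(2k - 1,
-- q + 1) = 1: lines with given ratios are concurrent only if u^{2k-1} takes a prescribed value, and
-- this power map is injective on U. The bounds for the cubic moment add up to q(q - 1 - (B - 2)(q +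
-- 2 - B)). For 4 ≤ B ≤ q the product (B - 2)(q + 2 - B) is at least 2(q - 2), which exceeds q - 1.

𝟙 : {P : Set} → Dec P → ℕ
𝟙 (yes _) = 1
𝟙 (no  _) = 0

𝟙-yes : {P : Set} (d : Dec P) → P → 𝟙 d ≡ 1
𝟙-yes (yes _) _ = refl
𝟙-yes (no ¬p) p = ⊥-elim (¬p p)

𝟙-no : {P : Set} (d : Dec P) → ¬ P → 𝟙 d ≡ 0
𝟙-no (yes p) ¬p = ⊥-elim (¬p p)
𝟙-no (no _)  _  = refl

𝟙-mono : {P Q : Set} (d : Dec P) (e : Dec Q) → (P → Q) → 𝟙 d ≤ 𝟙 e
𝟙-mono (no _)  e f = z≤n
𝟙-mono (yes p) e f = ≤-reflexive (sym (𝟙-yes e (f p)))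

𝟙-cong : {P Q : Set} (d : Dec P) (e : Dec Q) → (P → Q) → (Q → P) → 𝟙 d ≡ 𝟙 e
𝟙-cong d e f g = ≤-antisym (𝟙-mono d e f) (𝟙-mono e d g)

𝟙-× : {P Q : Set} (d : Dec P) (e : Dec Q) → 𝟙 (d ×-dec e) ≡ 𝟙 d * 𝟙 e
𝟙-× (no _)  e       = refl
𝟙-× (yes _) (no _)  = refl
𝟙-× (yes _) (yes _) = refl

𝟙-¬ : {P : Set} (d : Dec P) → 𝟙 d + 𝟙 (¬? d) ≡ 1
𝟙-¬ (no _)  = refl
𝟙-¬ (yes _) = refl

𝟙-⊎ : {P Q : Set} (d : Dec P) (e : Dec Q) → 𝟙 (d ⊎-dec e) + 𝟙 (d ×-dec e) ≡ 𝟙 d + 𝟙 e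
𝟙-⊎ (no _)  (no _)  = refl
𝟙-⊎ (no _)  (yes _) = refl
𝟙-⊎ (yes _) (no _)  = refl
𝟙-⊎ (yes _) (yes _) = refl

𝟙*-cong : {P : Set} (d : Dec P) {m n : ℕ} → (P → m ≡ n) → 𝟙 d * m ≡ 𝟙 d * n
𝟙*-cong (no _)  _ = refl
𝟙*-cong (yes p) h = cong (1 *_) (h p)

-- Sums of natural numbers over a list

module _ {A : Set} where

  sumOver : (A → ℕ) → List A → ℕ
  sumOver f []       = 0
  sumOver f (x ∷ xs) = f x + sumOver f xs

  sumOver-mono : ∀ {f g} → (∀ x → f x ≤ g x) → ∀ xs → sumOver f xs ≤ sumOver g xs
  sumOver-mono h []       = z≤n
  sumOver-mono h (x ∷ xs) = +-mono-≤ (h x) (sumOver-mono h xs)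

  sumOver-+ : ∀ f g xs → sumOver (λ x → f x + g x) xs ≡ sumOver f xs + sumOver g xs
  sumOver-+ f g []       = refl
  sumOver-+ f g (x ∷ xs) = trans (cong (λ j → (f x + g x) + j) (sumOver-+ f g xs))
    (interchange (f x) (g x) (sumOver f xs) (sumOver g xs))
    where
    interchange : ∀ a b c d → (a + b) + (c + d) ≡ (a + c) + (b + d)
    interchange = solve-∀

  sumOver-* : ∀ c f xs → sumOver (λ x → c * f x) xs ≡ c * sumOver f xs
  sumOver-* c f []       = sym (*-zeroʳ c)
  sumOver-* c f (x ∷ xs) = trans (cong (λ j → c * f x + j) (sumOver-* c f xs)) (sym (*-distribˡ-+ c (f x) _))

  sumOver-1 : ∀ xs → sumOver (λ _ → 1) xs ≡ length xs
  sumOver-1 []       = refl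
  sumOver-1 (x ∷ xs) = cong suc (sumOver-1 xs)

  sumOver-pigeon : ∀ {f g} → (∀ x → f x ≤ g x) → ∀ xs → sumOver g xs ≤ sumOver f xs →
                   ∀ {x} → x ∈ xs → f x ≡ g x
  sumOver-pigeon {f} {g} h (y ∷ ys) le (here refl) = ≤-antisym (h y)
    (+-cancelʳ-≤ (sumOver g ys) _ _ (≤-trans le (+-monoʳ-≤ (f y) (sumOver-mono h ys))))
  sumOver-pigeon {f} {g} h (y ∷ ys) le (there x∈ys) = sumOver-pigeon h ys
    (+-cancelˡ-≤ (g y) _ _ (≤-trans le (+-monoˡ-≤ (sumOver f ys) (h y)))) x∈ys

-- Summation and counting over a finite set, with ordered pairs and triples

module _ {A : Set} (_≟_ : DecidableEquality A) (elements : List A)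
         (complete : ∀ x → x ∈ elements) (unique : Unique elements) where

  module FiniteSums where

    ∑ : (A → ℕ) → ℕ
    ∑ f = sumOver f elements

    infix 5 ∑
    syntax ∑ (λ x → e) = ∑[ x ] e

    ∑-mono : ∀ {f g} → (∀ x → f x ≤ g x) → ∑ f ≤ ∑ g
    ∑-mono h = sumOver-mono h elements

    ∑-cong : ∀ {f g} → (∀ x → f x ≡ g x) → ∑ f ≡ ∑ g
    ∑-cong h = ≤-antisym (∑-mono (≤-reflexive ∘ h)) (∑-mono (≤-reflexive ∘ sym ∘ h))

    ∑-+ : ∀ f g → ∑[ x ] (f x + g x) ≡ ∑ f + ∑ g
    ∑-+ f g = sumOver-+ f g elements

    ∑-*ˡ : ∀ c f → ∑[ x ] (c * f x) ≡ c * ∑ f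
    ∑-*ˡ c f = sumOver-* c f elements

    ∑-*ʳ : ∀ c f → ∑[ x ] (f x * c) ≡ ∑ f * c
    ∑-*ʳ c f = trans (∑-cong λ x → *-comm (f x) c) (trans (∑-*ˡ c f) (*-comm c _))

    ∑-zero : ∑[ x ] 0 ≡ 0
    ∑-zero = ∑-*ˡ 0 (λ _ → 0)

    ∑-one : ∑[ x ] 1 ≡ length elements
    ∑-one = sumOver-1 elements

    ∑-const : ∀ c → ∑[ x ] c ≡ length elements * c
    ∑-const c = trans (∑-cong {g = λ _ → 1 * c} λ _ → sym (*-identityˡ c)) (trans (∑-*ʳ c (λ _ → 1)) (cong (_* c) ∑-one))

    ∑-swap : ∀ (f : A → A → ℕ) → ∑[ x ] ∑[ y ] f x y ≡ ∑[ y ] ∑[ x ] f x y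
    ∑-swap f = go elements
      where
      go : ∀ xs → sumOver (λ x → ∑[ y ] f x y) xs ≡ ∑[ y ] sumOver (λ x → f x y) xs
      go []       = sym ∑-zero
      go (x ∷ xs) = trans (cong (λ j → ∑ (f x) + j) (go xs)) (sym (∑-+ (f x) _))

    -- Turns a total into exact information at every point. Fibre sizes, the description of the
    -- prime field and the existence of a point with `N a ≡ 0` are all obtained this way.
    ∑-pigeon : ∀ {f g} → (∀ x → f x ≤ g x) → ∑ g ≤ ∑ f → ∀ x → f x ≡ g x
    ∑-pigeon h le x = sumOver-pigeon h elements le (complete x)

    -- Sifting by a Kronecker delta. Among these sums this is the one place where `unique` is used;
    -- reindexing and counting of singletons go through it.
    ∑-point : ∀ y (f : A → ℕ) → ∑[ x ] 𝟙 (x ≟ y) * f x ≡ f y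
    ∑-point y f = go elements unique (complete y)
      where
      miss : ∀ xs → All (y ≢_) xs → sumOver (λ x → 𝟙 (x ≟ y) * f x) xs ≡ 0
      miss []       _        = refl
      miss (x ∷ xs) (n ∷ ns) = cong₂ _+_ (cong (_* f x) (𝟙-no (x ≟ y) (n ∘ sym))) (miss xs ns)
      go : ∀ xs → Unique xs → y ∈ xs → sumOver (λ x → 𝟙 (x ≟ y) * f x) xs ≡ f y
      go (x ∷ xs) (n ∷ us) (here refl) = trans
        (cong₂ _+_ (cong (_* f y) (𝟙-yes (y ≟ y) refl)) (miss xs n))
        (trans (+-identityʳ _) (*-identityˡ _))
      go (x ∷ xs) (n ∷ us) (there y∈xs) = trans
        (cong (λ c → c * f x + _) (𝟙-no (x ≟ y) (All.lookup n y∈xs)))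
        (go xs us y∈xs)

    -- Insert a Kronecker delta, swap the two sums, and read y = σ x as x = τ y.
    ∑-reindex : (σ τ : A → A) → (∀ x → τ (σ x) ≡ x) → (∀ x → σ (τ x) ≡ x) →
                ∀ (f : A → ℕ) → ∑[ x ] f (σ x) ≡ ∑ f
    ∑-reindex σ τ τσ στ f = begin
      ∑[ x ] f (σ x)                          ≡⟨ ∑-cong (λ x → sym (∑-point (σ x) f)) ⟩
      ∑[ x ] ∑[ y ] 𝟙 (y ≟ σ x) * f y         ≡⟨ ∑-swap _ ⟩
      ∑[ y ] ∑[ x ] 𝟙 (y ≟ σ x) * f y         ≡⟨ ∑-cong (λ y → ∑-cong λ x → cong (_* f y)
                                                   (𝟙-cong (y ≟ σ x) (x ≟ τ y)
                                                     (λ { refl → sym (τσ x) }) (λ { refl → sym (στ y) }))) ⟩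
      ∑[ y ] ∑[ x ] 𝟙 (x ≟ τ y) * f y         ≡⟨ ∑-cong (λ y → ∑-point (τ y) (λ _ → f y)) ⟩
      ∑ f                                     ∎
      where open ≡-Reasoning

    search : {P : A → Set} → (∀ x → Dec (P x)) → ∃ P ⊎ (∀ x → ¬ P x)
    search P? with Any.any? P? elements
    ... | yes p = inj₁ (Any.satisfied p)
    ... | no ¬p = inj₂ λ x px → ¬p (lose (complete x) px)

    count : {P : A → Set} → (∀ x → Dec (P x)) → ℕ
    count P? = ∑[ x ] 𝟙 (P? x)

    module _ {P : A → Set} (P? : ∀ x → Dec (P x)) where

      count-none : (∀ x → ¬ P x) → count P? ≡ 0
      count-none h = trans (∑-cong λ x → 𝟙-no (P? x) (h x)) ∑-zero

      count-one : ∀ x → P x → (∀ y → P y → y ≡ x) → count P? ≡ 1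
      count-one x px h = trans
        (∑-cong λ y → trans (𝟙-cong (P? y) (y ≟ x) (h y) (λ { refl → px })) (sym (*-identityʳ _)))
        (∑-point x (λ _ → 1))

      count≤1 : (∀ x y → P x → P y → x ≡ y) → count P? ≤ 1
      count≤1 h with search P?
      ... | inj₁ (x , px) = ≤-reflexive (count-one x px (λ y py → h y x py px))
      ... | inj₂ none     = ≤-trans (≤-reflexive (count-none none)) z≤n

    count-cong : {P Q : A → Set} (P? : ∀ x → Dec (P x)) (Q? : ∀ x → Dec (Q x)) →
                 (∀ x → P x → Q x) → (∀ x → Q x → P x) → count P? ≡ count Q?
    count-cong P? Q? f g = ∑-cong λ x → 𝟙-cong (P? x) (Q? x) (f x) (g x)

    count-split : {P Q : A → Set} (P? : ∀ x → Dec (P x)) (Q? : ∀ x → Dec (Q x)) →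
                  count P? ≡ count (λ x → P? x ×-dec Q? x) + count (λ x → P? x ×-dec ¬? (Q? x))
    count-split P? Q? = trans
      (∑-cong λ x → trans (trans (sym (*-identityʳ _)) (cong (𝟙 (P? x) *_) (sym (𝟙-¬ (Q? x)))))
        (trans (*-distribˡ-+ (𝟙 (P? x)) _ _) (sym (cong₂ _+_ (𝟙-× (P? x) (Q? x)) (𝟙-× (P? x) (¬? (Q? x)))))))
      (∑-+ _ _)

    ∑-𝟙× : {P : Set} {Q : A → Set} (d : Dec P) (Q? : ∀ x → Dec (Q x)) → ∑[ x ] 𝟙 (d ×-dec Q? x) ≡ 𝟙 d * count Q?
    ∑-𝟙× d Q? = trans (∑-cong λ x → 𝟙-× d (Q? x)) (∑-*ˡ (𝟙 d) _)

    count-others : {P : A → Set} (P? : ∀ x → Dec (P x)) → ∀ y → P y → 1 + count (λ x → P? x ×-dec ¬? (y ≟ x)) ≡ count P?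
    count-others P? y py = sym (trans (count-split P? (y ≟_))
      (cong (_+ count (λ x → P? x ×-dec ¬? (y ≟ x)))
        (count-one (λ x → P? x ×-dec (y ≟ x)) y (py , refl) (λ { x (_ , refl) → refl }))))

    module _ {P : A → Set} (P? : ∀ x → Dec (P x)) where

      pair? : ∀ x y → Dec (P x × (P y × x ≢ y))
      pair? x y = P? x ×-dec (P? y ×-dec ¬? (x ≟ y))

      -- Nested so that the condition on `z` removes first `x` and then `y` from `P`; two uses of
      -- `count-others` then count the possible `z`.
      triple? : ∀ x y z → Dec (P x × ((P y × x ≢ y) × ((P z × x ≢ z) × y ≢ z)))
      triple? x y z = P? x ×-dec ((P? y ×-dec ¬? (x ≟ y)) ×-dec ((P? z ×-dec ¬? (x ≟ z)) ×-dec ¬? (y ≟ z)))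

      pairs : ℕ
      pairs = ∑[ x ] ∑[ y ] 𝟙 (pair? x y)

      triples : ℕ
      triples = ∑[ x ] ∑[ y ] ∑[ z ] 𝟙 (triple? x y z)

      -- With c the count, this and `triples+2pairs` identify `pairs` with c(c - 1) and `triples`
      -- with c(c - 1)(c - 2). The negative terms stand on the left because subtraction on ℕ
      -- truncates.
      pairs+count : pairs + count P? ≡ count P? * count P?
      pairs+count = trans (sym (∑-+ _ _)) (trans (∑-cong first) (∑-*ʳ (count P?) _))
        where
        first : ∀ x → (∑[ y ] 𝟙 (pair? x y)) + 𝟙 (P? x) ≡ 𝟙 (P? x) * count P?
        first x = trans (cong (_+ 𝟙 (P? x)) (∑-𝟙× (P? x) _))
          (trans (rearrange (𝟙 (P? x)) _) (𝟙*-cong (P? x) (count-others P? x)))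
          where
          rearrange : ∀ a b → a * b + a ≡ a * (1 + b)
          rearrange = solve-∀

      triples+2pairs : triples + 2 * pairs ≡ pairs * count P?
      triples+2pairs = begin
        triples + 2 * pairs                                                     ≡⟨ cong (λ j → triples + j) (sym (trans (∑-cong λ x → ∑-*ˡ 2 _) (∑-*ˡ 2 _))) ⟩
        triples + (∑[ x ] ∑[ y ] 2 * 𝟙 (pair? x y))                             ≡⟨ sym (trans (∑-cong λ x → ∑-+ _ _) (∑-+ _ _)) ⟩
        ∑[ x ] ∑[ y ] ((∑[ z ] 𝟙 (triple? x y z)) + 2 * 𝟙 (pair? x y))          ≡⟨ ∑-cong (λ x → ∑-cong λ y → second x y) ⟩
        ∑[ x ] ∑[ y ] 𝟙 (pair? x y) * count P?                                  ≡⟨ trans (∑-cong λ x → ∑-*ʳ (count P?) _) (∑-*ʳ (count P?) _) ⟩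
        pairs * count P?                                                        ∎
        where
        open ≡-Reasoning
        rearrange : ∀ a b c → a * (b * c) + 2 * (a * b) ≡ a * (b * (2 + c))
        rearrange = solve-∀
        second : ∀ x y → (∑[ z ] 𝟙 (triple? x y z)) + 2 * 𝟙 (pair? x y) ≡ 𝟙 (pair? x y) * count P?
        second x y = begin
          (∑[ z ] 𝟙 (triple? x y z)) + 2 * 𝟙 (pair? x y)
            ≡⟨ cong₂ (λ a b → a + 2 * b) (trans (∑-𝟙× (P? x) _) (cong (𝟙 (P? x) *_) (∑-𝟙× y? _))) (𝟙-× (P? x) y?) ⟩
          𝟙 (P? x) * (𝟙 y? * count z?) + 2 * (𝟙 (P? x) * 𝟙 y?)
            ≡⟨ rearrange (𝟙 (P? x)) (𝟙 y?) (count z?) ⟩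
          𝟙 (P? x) * (𝟙 y? * (2 + count z?))
            ≡⟨ 𝟙*-cong (P? x) (λ px → 𝟙*-cong y? (λ { (py , x≢y) → trans
                 (cong suc (count-others (λ z → P? z ×-dec ¬? (x ≟ z)) y (py , x≢y))) (count-others P? x px) })) ⟩
          𝟙 (P? x) * (𝟙 y? * count P?)
            ≡⟨ trans (sym (*-assoc (𝟙 (P? x)) _ _)) (cong (_* count P?) (sym (𝟙-× (P? x) y?))) ⟩
          𝟙 (pair? x y) * count P? ∎
          where
          y? = P? y ×-dec ¬? (x ≟ y)
          z? = λ z → (P? z ×-dec ¬? (x ≟ z)) ×-dec ¬? (y ≟ z)

-- Arithmetic in a finite field, with a ring solver

module FieldTheory (L : FiniteField) where

  open FiniteField L public
    renaming ( _+_ to infixl 6 _⊕_ ; _*_ to infixl 7 _⊗_ ; -_ to infix 8 ⊖_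
             ; _-_ to infixl 6 _⊝_ ; _^_ to infixr 8 _↑_ ; _≟F_ to infix 4 _≟L_ )

  open FiniteSums _≟L_ elements complete unique public

  commutativeRing : CommutativeRing 0ℓ 0ℓ
  commutativeRing = record { isCommutativeRing = isCommutativeRing }

  module R = CommutativeRing commutativeRing

  open import Algebra.Properties.Ring R.ring using (-0#≈0#; -‿distribˡ-*; -‿distribʳ-*; -‿involutive; -‿anti-homo-+)

  ι-+ : ∀ m n → ι (m + n) ≡ ι m ⊕ ι n
  ι-+ zero    n = sym (R.+-identityˡ _)
  ι-+ (suc m) n = trans (cong (1# ⊕_) (ι-+ m n)) (sym (R.+-assoc 1# (ι m) (ι n)))

  ι-* : ∀ m n → ι (m * n) ≡ ι m ⊗ ι n
  ι-* zero    n = sym (R.zeroˡ _)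
  ι-* (suc m) n = trans (ι-+ n (m * n)) (trans (cong₂ _⊕_ (sym (R.*-identityˡ _)) (ι-* m n)) (sym (R.distribʳ _ _ _)))

  -- Unlike ι, sends 1 to 1# definitionally, so that solver constants match ring constants.
  num : ℕ → Carrier
  num zero          = 0#
  num (suc zero)    = 1#
  num (suc (suc n)) = 1# ⊕ num (suc n)

  num≡ι : ∀ n → num n ≡ ι n
  num≡ι zero          = refl
  num≡ι (suc zero)    = sym (R.+-identityʳ 1#)
  num≡ι (suc (suc n)) = cong (1# ⊕_) (num≡ι (suc n))

  num-suc : ∀ n → num (suc n) ≡ 1# ⊕ num n
  num-suc n = trans (num≡ι (suc n)) (cong (1# ⊕_) (sym (num≡ι n)))

  num-+ : ∀ m n → num (m + n) ≡ num m ⊕ num n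
  num-+ m n = trans (num≡ι (m + n)) (trans (ι-+ m n) (sym (cong₂ _⊕_ (num≡ι m) (num≡ι n))))

  num-* : ∀ m n → num (m * n) ≡ num m ⊗ num n
  num-* m n = trans (num≡ι (m * n)) (trans (ι-* m n) (sym (cong₂ _⊗_ (num≡ι m) (num≡ι n))))

  fromℤ : ℤ → Carrier
  fromℤ (+ n)    = num n
  fromℤ -[1+ n ] = ⊖ num (suc n)

  private

    fromℤ-⊖ : ∀ m n → fromℤ (m ℤ.⊖ n) ≡ num m ⊝ num n
    fromℤ-⊖ m       zero    = sym (trans (cong (num m ⊕_) -0#≈0#) (R.+-identityʳ _))
    fromℤ-⊖ zero    (suc n) = sym (R.+-identityˡ _)
    fromℤ-⊖ (suc m) (suc n) = trans (cong fromℤ (ℤ.[1+m]⊖[1+n]≡m⊖n m n)) (trans (fromℤ-⊖ m n) (sym (trans (cong₂ _⊝_ (num-suc m) (num-suc n)) (begin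
      (1# ⊕ num m) ⊝ (1# ⊕ num n)       ≡⟨ cong ((1# ⊕ num m) ⊕_) (-‿anti-homo-+ 1# (num n)) ⟩
      (1# ⊕ num m) ⊕ (⊖ num n ⊕ ⊖ 1#)   ≡⟨ cong (_⊕ (⊖ num n ⊕ ⊖ 1#)) (R.+-comm 1# (num m)) ⟩
      (num m ⊕ 1#) ⊕ (⊖ num n ⊕ ⊖ 1#)   ≡⟨ R.+-assoc (num m) 1# _ ⟩
      num m ⊕ (1# ⊕ (⊖ num n ⊕ ⊖ 1#))   ≡⟨ cong (λ t → num m ⊕ (1# ⊕ t)) (R.+-comm (⊖ num n) (⊖ 1#)) ⟩
      num m ⊕ (1# ⊕ (⊖ 1# ⊕ ⊖ num n))   ≡⟨ cong (num m ⊕_) (sym (R.+-assoc 1# (⊖ 1#) _)) ⟩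
      num m ⊕ ((1# ⊝ 1#) ⊕ ⊖ num n)     ≡⟨ cong (λ t → num m ⊕ (t ⊕ ⊖ num n)) (R.-‿inverseʳ 1#) ⟩
      num m ⊕ (0# ⊕ ⊖ num n)            ≡⟨ cong (num m ⊕_) (R.+-identityˡ _) ⟩
      num m ⊝ num n                     ∎))))
      where open ≡-Reasoning

    fromℤ-+ : ∀ i j → fromℤ (i ℤ.+ j) ≡ fromℤ i ⊕ fromℤ j
    fromℤ-+ (+ m)    (+ n)    = num-+ m n
    fromℤ-+ (+ m)    -[1+ n ] = fromℤ-⊖ m (suc n)
    fromℤ-+ -[1+ m ] (+ n)    = trans (fromℤ-⊖ n (suc m)) (R.+-comm _ _)
    fromℤ-+ -[1+ m ] -[1+ n ] = trans (cong (λ t → ⊖ num t) (trans (cong suc (sym (+-suc m n))) refl))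
      (trans (cong ⊖_ (num-+ (suc m) (suc n))) (trans (-‿anti-homo-+ _ _) (R.+-comm _ _)))

    fromℤ-neg : ∀ i → fromℤ (ℤ.- i) ≡ ⊖ fromℤ i
    fromℤ-neg (+ zero)  = sym -0#≈0#
    fromℤ-neg (+ suc n) = refl
    fromℤ-neg -[1+ n ]  = sym (-‿involutive _)

    fromℤ-pos* : ∀ m j → fromℤ (+ m ℤ.* j) ≡ num m ⊗ fromℤ j
    fromℤ-pos* m (+ n)    = trans (cong fromℤ (sym (ℤ.pos-* m n))) (num-* m n)
    fromℤ-pos* m -[1+ n ] = begin
      fromℤ (+ m ℤ.* -[1+ n ])          ≡⟨ cong fromℤ (sym (ℤ.neg-distribʳ-* (+ m) (+ suc n))) ⟩
      fromℤ (ℤ.- (+ m ℤ.* + suc n))     ≡⟨ fromℤ-neg (+ m ℤ.* + suc n) ⟩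
      ⊖ fromℤ (+ m ℤ.* + suc n)         ≡⟨ cong ⊖_ (fromℤ-pos* m (+ suc n)) ⟩
      ⊖ (num m ⊗ num (suc n))               ≡⟨ -‿distribʳ-* _ _ ⟩
      num m ⊗ ⊖ num (suc n)                 ∎
      where open ≡-Reasoning

    fromℤ-* : ∀ i j → fromℤ (i ℤ.* j) ≡ fromℤ i ⊗ fromℤ j
    fromℤ-* (+ m)    j = fromℤ-pos* m j
    fromℤ-* -[1+ m ] j = begin
      fromℤ (-[1+ m ] ℤ.* j)            ≡⟨ cong fromℤ (sym (ℤ.neg-distribˡ-* (+ suc m) j)) ⟩
      fromℤ (ℤ.- (+ suc m ℤ.* j))       ≡⟨ fromℤ-neg (+ suc m ℤ.* j) ⟩
      ⊖ fromℤ (+ suc m ℤ.* j)           ≡⟨ cong ⊖_ (fromℤ-pos* (suc m) j) ⟩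
      ⊖ (num (suc m) ⊗ fromℤ j)           ≡⟨ -‿distribˡ-* _ _ ⟩
      ⊖ num (suc m) ⊗ fromℤ j             ∎
      where open ≡-Reasoning

    ℤ⟶L : ℤ.+-*-rawRing -Raw-AlmostCommutative⟶ fromCommutativeRing commutativeRing
    ℤ⟶L = record
      { ⟦_⟧ = fromℤ ; +-homo = fromℤ-+ ; *-homo = fromℤ-* ; -‿homo = fromℤ-neg
      ; 0-homo = refl ; 1-homo = refl }

  -- Coefficients are integers: their equality can be computed, so terms cancel although `L` is
  -- abstract.
  module Solver = RingSolver ℤ.+-*-rawRing (fromCommutativeRing commutativeRing) ℤ⟶L
    (λ i j → Maybe.map (cong fromℤ) (dec⇒maybe (i ℤ.≟ j)))
  open Solver using (solve; _:=_; _:+_; _:*_; _:-_; :-_; con)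

  x⊝x : ∀ x → x ⊝ x ≡ 0#
  x⊝x = R.-‿inverseʳ

  ⊝≡0⇒≡ : ∀ {x y} → x ⊝ y ≡ 0# → x ≡ y
  ⊝≡0⇒≡ {x} {y} h = trans (solve 2 (λ x y → x := (x :- y) :+ y) refl x y) (trans (cong (_⊕ y) h) (R.+-identityˡ y))

  ≡⇒⊝≡0 : ∀ {x y} → x ≡ y → x ⊝ y ≡ 0#
  ≡⇒⊝≡0 refl = x⊝x _

  private
    drop : ∀ z c x → z ⊕ c ⊗ (x ⊝ x) ≡ z
    drop z c x = trans (cong (z ⊕_) (trans (cong (c ⊗_) (x⊝x x)) (R.zeroʳ c))) (R.+-identityʳ z)

  -- Proofs by linear combination of hypotheses: only the coefficient identity is left to the ring solver.
  combine₁ : ∀ {x y l r} c → l ≡ r → x ⊝ y ≡ c ⊗ (l ⊝ r) → x ≡ y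
  combine₁ c refl h = ⊝≡0⇒≡ (trans h (trans (cong (c ⊗_) (x⊝x _)) (R.zeroʳ c)))

  combine₂ : ∀ {x y l r l′ r′} c c′ → l ≡ r → l′ ≡ r′ →
             x ⊝ y ≡ c ⊗ (l ⊝ r) ⊕ c′ ⊗ (l′ ⊝ r′) → x ≡ y
  combine₂ c c′ h refl e = combine₁ c h (trans e (drop _ c′ _))

  combine₃ : ∀ {x y l r l′ r′ l″ r″} c c′ c″ → l ≡ r → l′ ≡ r′ → l″ ≡ r″ →
             x ⊝ y ≡ c ⊗ (l ⊝ r) ⊕ c′ ⊗ (l′ ⊝ r′) ⊕ c″ ⊗ (l″ ⊝ r″) → x ≡ y
  combine₃ c c′ c″ h h′ refl e = combine₂ c c′ h h′ (trans e (drop _ c″ _))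

  combine₄ : ∀ {x y l r l′ r′ l″ r″ l‴ r‴} c c′ c″ c‴ → l ≡ r → l′ ≡ r′ → l″ ≡ r″ → l‴ ≡ r‴ →
             x ⊝ y ≡ c ⊗ (l ⊝ r) ⊕ c′ ⊗ (l′ ⊝ r′) ⊕ c″ ⊗ (l″ ⊝ r″) ⊕ c‴ ⊗ (l‴ ⊝ r‴) → x ≡ y
  combine₄ c c′ c″ c‴ h h′ h″ refl e = combine₃ c c′ c″ h h′ h″ (trans e (drop _ c‴ _))

  -- Zero products, powers, and root counting for polynomial functions

  1≢0 : 1# ≢ 0#
  1≢0 = 0≢1 ∘ sym

  zero-product : ∀ {x y} → x ⊗ y ≡ 0# → x ≡ 0# ⊎ y ≡ 0#
  zero-product {x} {y} xy≡0 with x ≟L 0#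
  ... | yes x≡0 = inj₁ x≡0
  ... | no  x≢0 with inverse x x≢0
  ...   | x′ , xx′≡1 = inj₂ (combine₂ (⊖ y) x′ xx′≡1 xy≡0
            (solve 3 (λ x y x′ → y :- con (+ 0) := (:- y) :* (x :* x′ :- con (+ 1)) :+ x′ :* (x :* y :- con (+ 0))) refl x y x′))

  ⊗-cancelˡ : ∀ {x y z} → x ≢ 0# → x ⊗ y ≡ x ⊗ z → y ≡ z
  ⊗-cancelˡ {x} {y} {z} x≢0 h = [ ⊥-elim ∘ x≢0 , ⊝≡0⇒≡ ]′ (zero-product
    (combine₁ 1# h (solve 3 (λ x y z → x :* (y :- z) :- con (+ 0) := con (+ 1) :* (x :* y :- x :* z)) refl x y z)))

  ↑-+ : ∀ x m n → x ↑ (m + n) ≡ x ↑ m ⊗ x ↑ n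
  ↑-+ x zero    n = sym (R.*-identityˡ _)
  ↑-+ x (suc m) n = trans (cong (x ⊗_) (↑-+ x m n)) (sym (R.*-assoc x _ _))

  ⊗-↑ : ∀ x y m → (x ⊗ y) ↑ m ≡ x ↑ m ⊗ y ↑ m
  ⊗-↑ x y zero    = sym (R.*-identityˡ 1#)
  ⊗-↑ x y (suc m) = trans (cong ((x ⊗ y) ⊗_) (⊗-↑ x y m))
    (solve 4 (λ x y a b → (x :* y) :* (a :* b) := (x :* a) :* (y :* b)) refl x y (x ↑ m) (y ↑ m))

  1↑ : ∀ m → 1# ↑ m ≡ 1#
  1↑ zero    = refl
  1↑ (suc m) = trans (R.*-identityˡ _) (1↑ m)

  ↑-* : ∀ x m n → x ↑ (m * n) ≡ (x ↑ m) ↑ n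
  ↑-* x zero    n = sym (1↑ n)
  ↑-* x (suc m) n = trans (↑-+ x n (m * n)) (trans (cong (x ↑ n ⊗_) (↑-* x m n)) (sym (⊗-↑ x (x ↑ m) n)))

  ↑-1 : ∀ x → x ↑ 1 ≡ x
  ↑-1 = R.*-identityʳ

  ↑-comm : ∀ x m n → (x ↑ m) ↑ n ≡ (x ↑ n) ↑ m
  ↑-comm x m n = trans (sym (↑-* x m n)) (trans (cong (x ↑_) (*-comm m n)) (↑-* x n m))

  0↑ : ∀ {m} → 0 < m → 0# ↑ m ≡ 0#
  0↑ {suc m} _ = R.zeroˡ _

  ↑≢0 : ∀ {x} m → x ≢ 0# → x ↑ m ≢ 0#
  ↑≢0 zero    x≢0 = 1≢0
  ↑≢0 (suc m) x≢0 h = [ x≢0 , ↑≢0 m x≢0 ]′ (zero-product h)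

  ⊗≢0 : ∀ {x y} → x ≢ 0# → y ≢ 0# → x ⊗ y ≢ 0#
  ⊗≢0 x≢0 y≢0 h = [ x≢0 , y≢0 ]′ (zero-product h)

  -- Poly m ℓ f: f is a polynomial function of degree at most m whose coefficient at degree m is ℓ.
  -- Divided differences are taken as the definition because they make root counting immediate.
  Poly : ℕ → Carrier → (Carrier → Carrier) → Set
  Poly zero    ℓ f = ∀ x → f x ≡ ℓ
  Poly (suc m) ℓ f = ∀ r → ∃ λ g → Poly m ℓ g × (∀ x → f x ≡ f r ⊕ (x ⊝ r) ⊗ g x)

  poly-+ : ∀ m {ℓ ℓ′ f f′} → Poly m ℓ f → Poly m ℓ′ f′ → Poly m (ℓ ⊕ ℓ′) (λ x → f x ⊕ f′ x)
  poly-+ zero    p p′ x = cong₂ _⊕_ (p x) (p′ x)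
  poly-+ (suc m) {f = f} {f′} p p′ r with p r | p′ r
  ... | g , pg , e | g′ , pg′ , e′ = (λ x → g x ⊕ g′ x) , poly-+ m pg pg′ , λ x →
    trans (cong₂ _⊕_ (e x) (e′ x))
      (solve 6 (λ a b x r u v → (a :+ (x :- r) :* u) :+ (b :+ (x :- r) :* v) := (a :+ b) :+ (x :- r) :* (u :+ v))
        refl (f r) (f′ r) x r (g x) (g′ x))

  poly-scale : ∀ m c {ℓ f} → Poly m ℓ f → Poly m (c ⊗ ℓ) (λ x → c ⊗ f x)
  poly-scale zero    c p x = cong (c ⊗_) (p x)
  poly-scale (suc m) c {f = f} p r with p r
  ... | g , pg , e = (λ x → c ⊗ g x) , poly-scale m c pg , λ x →
    trans (cong (c ⊗_) (e x))
      (solve 5 (λ c a x r u → c :* (a :+ (x :- r) :* u) := c :* a :+ (x :- r) :* (c :* u)) refl c (f r) x r (g x))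

  poly-suc : ∀ m {ℓ f} → Poly m ℓ f → Poly (suc m) 0# f
  poly-suc zero    {ℓ} {f} p r = (λ _ → 0#) , (λ _ → refl) , λ x →
    trans (trans (p x) (sym (p r))) (sym (trans (cong (f r ⊕_) (R.zeroʳ _)) (R.+-identityʳ _)))
  poly-suc (suc m) p r with p r
  ... | g , pg , e = g , poly-suc m pg , e

  poly-< : ∀ {m n ℓ f} → m < n → Poly m ℓ f → Poly n 0# f
  poly-< m<n p = go (≤⇒≤′ m<n) p
    where
    go : ∀ {m n ℓ f} → suc m ≤′ n → Poly m ℓ f → Poly n 0# f
    go {m} ≤′-refl p = poly-suc m p
    go (≤′-step {n} h) p = poly-suc n (go h p)

  poly-cong : ∀ m {ℓ ℓ′ f} → ℓ ≡ ℓ′ → Poly m ℓ f → Poly m ℓ′ f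
  poly-cong m refl p = p

  -- Product rule for divided differences: x f(x) - r f(r) = (x - r)(f(x) + r g(x)).
  poly-x* : ∀ m {ℓ f} → Poly m ℓ f → Poly (suc m) ℓ (λ x → x ⊗ f x)
  poly-x* zero {ℓ} {f} p r = (λ _ → ℓ) , (λ _ → refl) , λ x →
    trans (cong (x ⊗_) (p x)) (trans (solve 3 (λ x r l → x :* l := r :* l :+ (x :- r) :* l) refl x r ℓ)
      (cong (λ t → r ⊗ t ⊕ (x ⊝ r) ⊗ ℓ) (sym (p r))))
  poly-x* (suc m) {ℓ} {f} p r with p r
  ... | g , pg , e = (λ x → f x ⊕ r ⊗ g x)
    , poly-cong (suc m) (trans (cong (ℓ ⊕_) (R.zeroʳ r)) (R.+-identityʳ ℓ)) (poly-+ (suc m) p (poly-scale (suc m) r (poly-suc m pg)))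
    , λ x → combine₁ r (e x)
        (solve 5 (λ x r f a g → x :* f :- (r :* a :+ (x :- r) :* (f :+ r :* g)) := r :* (f :- (a :+ (x :- r) :* g)))
          refl x r (f x) (f r) (g x))

  poly-↑ : ∀ m → Poly m 1# (_↑ m)
  poly-↑ zero    x = refl
  poly-↑ (suc m) = poly-x* m (poly-↑ m)

  poly-const : ∀ c → Poly 0 c (λ _ → c)
  poly-const c x = refl

  poly-monic : ∀ {m n ℓ f} → n < m → Poly n ℓ f → Poly m 1# (λ x → x ↑ m ⊕ f x)
  poly-monic {m} n<m p = poly-cong m (R.+-identityʳ 1#) (poly-+ m (poly-↑ m) (poly-< n<m p))

  -- If r is a root, then f(x) = (x - r) g(x), so every other root is a root of g, whose degree is
  -- one less and whose leading coefficient is the same.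
  roots≤degree : ∀ m {ℓ f} → ℓ ≢ 0# → Poly m ℓ f → count (λ x → f x ≟L 0#) ≤ m
  roots≤degree zero ℓ≢0 p = ≤-reflexive (count-none _ λ x fx≡0 → ℓ≢0 (trans (sym (p x)) fx≡0))
  roots≤degree (suc m) {f = f} ℓ≢0 p with search (λ x → f x ≟L 0#)
  ... | inj₂ none = ≤-trans (≤-reflexive (count-none _ none)) z≤n
  ... | inj₁ (r , fr≡0) with p r
  ...   | g , pg , e = begin
    count (λ x → f x ≟L 0#)                        ≤⟨ ∑-mono (λ x → ≤-trans (𝟙-mono (f x ≟L 0#) ((x ≟L r) ⊎-dec (g x ≟L 0#)) (split x))
                                                                     (≤-trans (m≤m+n _ _) (≤-reflexive (𝟙-⊎ (x ≟L r) (g x ≟L 0#))))) ⟩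
    ∑[ x ] (𝟙 (x ≟L r) + 𝟙 (g x ≟L 0#))            ≡⟨ ∑-+ _ _ ⟩
    count (λ x → x ≟L r) + count (λ x → g x ≟L 0#) ≤⟨ +-mono-≤ (≤-reflexive (count-one _ r refl (λ _ h → h))) (roots≤degree m ℓ≢0 pg) ⟩
    suc m                                          ∎
    where
    open ≤-Reasoning
    split : ∀ x → f x ≡ 0# → x ≡ r ⊎ g x ≡ 0#
    split x fx≡0 = [ inj₁ ∘ ⊝≡0⇒≡ , inj₂ ]′ (zero-product
      (combine₂ 1# (⊖ 1#) fx≡0 (trans (e x) (cong (_⊕ (x ⊝ r) ⊗ g x) fr≡0))
        (solve 4 (λ f x r g → (x :- r) :* g :- con (+ 0) := con (+ 1) :* (f :- con (+ 0)) :+ (:- con (+ 1)) :* (f :- (con (+ 0) :+ (x :- r) :* g))) refl (f x) x r (g x))))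

  -- Sums and products over all field elements

  private
    ∏ : (Carrier → Carrier) → List Carrier → Carrier
    ∏ f xs = foldr _⊗_ 1# (map f xs)

    ∑L : (Carrier → Carrier) → List Carrier → Carrier
    ∑L f xs = foldr _⊕_ 0# (map f xs)

    bijection⇒↭ : (σ τ : Carrier → Carrier) → (∀ x → τ (σ x) ≡ x) → (∀ x → σ (τ x) ≡ x) →
                  map σ elements ↭ elements
    bijection⇒↭ σ τ τσ στ = ∼bag⇒↭ (unique∧set⇒bag
      (map⁺ (λ {x} {y} h → trans (sym (τσ x)) (trans (cong τ h) (τσ y))) unique) unique
      (λ {x} → mk⇔ (λ _ → complete x) (λ _ → subst (_∈ map σ elements) (στ x) (∈-map⁺ σ (complete (τ x))))))

  -- Translation by 1 permutes the field, so the sum S of all its elements satisfies S + `ι order` =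
  -- S.
  order-ι : ι order ≡ 0#
  order-ι = combine₁ 1# shift
    (solve 2 (λ a s → a :- con (+ 0) := con (+ 1) :* ((s :+ a) :- s)) refl (ι order) (∑L id elements))
    where
    split : ∀ xs → ∑L (_⊕ 1#) xs ≡ ∑L id xs ⊕ ι (length xs)
    split []       = sym (R.+-identityʳ 0#)
    split (x ∷ xs) = trans (cong ((x ⊕ 1#) ⊕_) (split xs))
      (solve 3 (λ x s a → (x :+ con (+ 1)) :+ (s :+ a) := (x :+ s) :+ (con (+ 1) :+ a)) refl x (∑L id xs) (ι (length xs)))
    map-id′ : ∀ xs → foldr _⊕_ 0# xs ≡ ∑L id xs
    map-id′ []       = refl
    map-id′ (x ∷ xs) = cong (x ⊕_) (map-id′ xs)
    shift : ∑L id elements ⊕ ι order ≡ ∑L id elements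
    shift = trans (sym (split elements)) (trans
      (foldr-commMonoid (setoid Carrier) R.+-isCommutativeMonoid (↭⇒↭ₛ (bijection⇒↭ (_⊕ 1#) (_⊝ 1#)
        (λ x → solve 1 (λ x → (x :+ con (+ 1)) :- con (+ 1) := x) refl x)
        (λ x → solve 1 (λ x → (x :- con (+ 1)) :+ con (+ 1) := x) refl x))))
      (map-id′ elements))

  -- Multiplication by `a` permutes the nonzero elements, so their product P satisfies a^{order - 1}
  -- P = P.
  fermat : ∀ a → a ≢ 0# → a ↑ (order ∸ 1) ≡ 1#
  fermat a a≢0 with inverse a a≢0
  ... | a′ , aa′≡1 = trans (cong (a ↑_) (cong (_∸ 1) (sym nonzeros))) (⊗-cancelˡ (∏≢0 elements) (begin
      ∏ v elements ⊗ a ↑ count (λ x → ¬? (x ≟L 0#))   ≡⟨ R.*-comm _ _ ⟩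
      a ↑ count (λ x → ¬? (x ≟L 0#)) ⊗ ∏ v elements   ≡⟨ sym (scale elements) ⟩
      ∏ (λ x → v (a ⊗ x)) elements                    ≡⟨ map-∘′ elements ⟩
      ∏ v (map (a ⊗_) elements)                       ≡⟨ fold-v ⟩
      ∏ v elements                                    ≡⟨ sym (R.*-identityʳ _) ⟩
      ∏ v elements ⊗ 1#                               ∎))
    where
    open ≡-Reasoning
    -- Sends 0 to 1, so that the product can run over the whole list `elements` and still be the
    -- product of the nonzero elements.
    v : Carrier → Carrier
    v x with x ≟L 0#
    ... | yes _ = 1#
    ... | no  _ = x
    v≢0 : ∀ x → v x ≢ 0#
    v≢0 x with x ≟L 0#
    ... | yes _   = 1≢0
    ... | no  x≢0 = x≢0
    ∏≢0 : ∀ xs → ∏ v xs ≢ 0#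
    ∏≢0 []       = 1≢0
    ∏≢0 (x ∷ xs) = ⊗≢0 (v≢0 x) (∏≢0 xs)
    nonzeros : 1 + count (λ x → ¬? (x ≟L 0#)) ≡ order
    nonzeros = trans (cong (_+ count (λ x → ¬? (x ≟L 0#))) (sym (count-one (_≟L 0#) 0# refl (λ _ h → h))))
      (trans (sym (∑-+ _ _)) (trans (∑-cong (λ x → 𝟙-¬ (x ≟L 0#))) ∑-one))
    scale : ∀ xs → ∏ (λ x → v (a ⊗ x)) xs ≡ a ↑ sumOver (λ x → 𝟙 (¬? (x ≟L 0#))) xs ⊗ ∏ v xs
    scale []       = sym (R.*-identityˡ 1#)
    scale (x ∷ xs) with x ≟L 0# | a ⊗ x ≟L 0#
    ... | yes _    | yes _   = trans (cong (1# ⊗_) (scale xs))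
          (solve 2 (λ p q → con (+ 1) :* (p :* q) := p :* (con (+ 1) :* q)) refl _ _)
    ... | yes refl | no ¬h   = ⊥-elim (¬h (R.zeroʳ a))
    ... | no x≢0   | yes h   = ⊥-elim (⊗≢0 a≢0 x≢0 h)
    ... | no _     | no _    = trans (cong ((a ⊗ x) ⊗_) (scale xs))
          (solve 4 (λ a x p q → (a :* x) :* (p :* q) := (a :* p) :* (x :* q)) refl a x _ _)
    map-∘′ : ∀ xs → ∏ (λ x → v (a ⊗ x)) xs ≡ ∏ v (map (a ⊗_) xs)
    map-∘′ []       = refl
    map-∘′ (x ∷ xs) = cong (v (a ⊗ x) ⊗_) (map-∘′ xs)
    fold-v : ∏ v (map (a ⊗_) elements) ≡ ∏ v elements
    fold-v = foldr-commMonoid (setoid Carrier) R.*-isCommutativeMonoid (↭⇒↭ₛ (↭-map⁺ v (bijection⇒↭ (a ⊗_) (a′ ⊗_)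
      (λ x → combine₁ x aa′≡1 (solve 3 (λ a a′ x → a′ :* (a :* x) :- x := x :* (a :* a′ :- con (+ 1))) refl a a′ x))
      (λ x → combine₁ x aa′≡1 (solve 3 (λ a a′ x → a :* (a′ :* x) :- x := x :* (a :* a′ :- con (+ 1))) refl a a′ x)))))

-- Binomial coefficients modulo a prime

prime∤! : ∀ {p} → Prime p → ∀ j → j < p → p ∤ j !
prime∤! {p} pp zero j<p p∣1 with ∣1⇒≡1 p∣1
... | refl = <-irrefl refl (nonTrivial⇒n>1 p {{prime⇒nonTrivial pp}})
prime∤! pp (suc j) j<p p∣ with euclidsLemma (suc j) (j !) pp p∣
... | inj₁ h = <⇒≱ j<p (∣⇒≤ h)
... | inj₂ h = prime∤! pp j (<-trans (n<1+n j) j<p) h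

-- The prime divides p! = C(p,k) k! (p - k)!, but neither of the two factorials on the right.
prime∣C : ∀ {p k} → Prime p → 0 < k → k < p → p ∣ (p C k)
prime∣C {p@(suc p′)} {k} pp 0<k k<p with euclidsLemma (p C k) (k ! * (p ∸ k) !) pp
    (subst (p ∣_) (sym C*) (m∣m*n (p′ !)))
  where
  instance
    nz : NonZero (k ! * (p ∸ k) !)
    nz = m*n≢0 (k !) ((p ∸ k) !) {{k !≢0}} {{(p ∸ k) !≢0}}
  C* : (p C k) * (k ! * (p ∸ k) !) ≡ p !
  C* = trans (cong (_* (k ! * (p ∸ k) !)) (nCk≡n!/k![n-k]! (<⇒≤ k<p))) (m/n*n≡m (k![n∸k]!∣n! (<⇒≤ k<p)))
... | inj₁ h = h
... | inj₂ h with euclidsLemma (k !) ((p ∸ k) !) pp h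
...   | inj₁ h′ = ⊥-elim (prime∤! pp k k<p h′)
...   | inj₂ h′ = ⊥-elim (prime∤! pp (p ∸ k) (∸-monoʳ-< {p} 0<k (<⇒≤ k<p)) h′)

-- A field of order q²: characteristic and Frobenius map

module QuadraticExtension (L : FiniteField) (p n : ℕ) (prime-p : Prime p) (0<n : 0 < n)
    (order≡ : FiniteField.order L ≡ p ^ (2 * n)) where

  open FieldTheory L public
  open Solver public using (solve; _:=_; _:+_; _:*_; _:-_; :-_; con)

  q : ℕ
  q = p ^ n

  instance
    p-nonZero : NonZero p
    p-nonZero = prime⇒nonZero prime-p

  1<p : 1 < p
  1<p = nonTrivial⇒n>1 p {{prime⇒nonTrivial prime-p}}

  p≤q : p ≤ q
  p≤q = ≤-trans (≤-reflexive (sym (^-identityʳ p))) (^-monoʳ-≤ p 0<n)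

  1<q : 1 < q
  1<q = <-≤-trans 1<p p≤q

  order≡q*q : order ≡ q * q
  order≡q*q = trans order≡ (trans (cong (λ m → p ^ (n + m)) (+-identityʳ n)) (^-distribˡ-+-* p n n))

  ι-^ : ∀ m j → ι (m ^ j) ≡ ι m ↑ j
  ι-^ m zero    = R.+-identityʳ 1#
  ι-^ m (suc j) = trans (ι-* m (m ^ j)) (cong (ι m ⊗_) (ι-^ m j))

  -- The power of `ι p` with exponent 2n is `ι order`, hence zero, and a field has no nonzero
  -- nilpotents.
  ι-p : ι p ≡ 0#
  ι-p with ι p ≟L 0#
  ... | yes h = h
  ... | no ¬h = ⊥-elim (↑≢0 (2 * n) ¬h (trans (sym (ι-^ p (2 * n))) (trans (cong ι (sym order≡)) order-ι)))

  ι-multiple : ∀ m → ι (m * p) ≡ 0#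
  ι-multiple m = trans (ι-* m p) (trans (cong (ι m ⊗_) ι-p) (R.zeroʳ _))

  ι≢0 : ∀ {c} → 0 < c → c < p → ι c ≢ 0#
  ι≢0 {c@(suc _)} 0<c c<p ιc≡0 with coprime-Bézout (prime⇒coprime prime-p c<p)
  ... | Bézout.+- x y eq = 1≢0 (begin
    1#                     ≡⟨ sym (R.+-identityʳ 1#) ⟩
    1# ⊕ 0#                ≡⟨ cong (1# ⊕_) (sym (trans (ι-* y c) (trans (cong (ι y ⊗_) ιc≡0) (R.zeroʳ _)))) ⟩
    ι (1 + y * c)          ≡⟨ cong ι eq ⟩
    ι (x * p)              ≡⟨ ι-multiple x ⟩
    0#                     ∎)
    where open ≡-Reasoning
  ... | Bézout.-+ x y eq = 1≢0 (begin
    1#                     ≡⟨ sym (R.+-identityʳ 1#) ⟩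
    1# ⊕ 0#                ≡⟨ cong (1# ⊕_) (sym (ι-multiple x)) ⟩
    ι (1 + x * p)          ≡⟨ cong ι eq ⟩
    ι (y * c)              ≡⟨ trans (ι-* y c) (trans (cong (ι y ⊗_) ιc≡0) (R.zeroʳ _)) ⟩
    0#                     ∎)
    where open ≡-Reasoning

  ι-<-≢ : ∀ {a b} → a < b → b < p → ι a ≢ ι b
  ι-<-≢ {a} {b} a<b b<p h = ι≢0 (m<n⇒0<n∸m a<b) (≤-<-trans (m∸n≤m b a) b<p)
    (combine₂ (⊖ 1#) (⊖ 1#) h (trans (cong ι (sym (m+[n∸m]≡n (<⇒≤ a<b)))) (ι-+ a (b ∸ a)))
      (solve 3 (λ a b c → c :- con (+ 0) := (:- con (+ 1)) :* (a :- b) :+ (:- con (+ 1)) :* (b :- (a :+ c))) refl (ι a) (ι b) (ι (b ∸ a))))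

  ι-injective : ∀ {a b} → a < p → b < p → ι a ≡ ι b → a ≡ b
  ι-injective {a} {b} a<p b<p h with <-cmp a b
  ... | tri< a<b _ _ = ⊥-elim (ι-<-≢ a<b b<p h)
  ... | tri≈ _ a≡b _ = a≡b
  ... | tri> _ _ b<a = ⊥-elim (ι-<-≢ b<a a<p (sym h))

  frobenius : ∀ x y → (x ⊕ y) ↑ p ≡ x ↑ p ⊕ y ↑ p
  frobenius x y = go p refl
    where
    open import Algebra.Properties.CommutativeSemiring.Binomial R.commutativeSemiring using (theorem; binomialTerm)
    open import Algebra.Properties.Semiring.Exp R.semiring using () renaming (_^_ to _^′_)
    open import Algebra.Properties.Semiring.Mult R.semiring using () renaming (_×_ to _·_)
    open import Algebra.Properties.Semiring.Sum R.semiring using (sum; sum-init-last; sum-cong-≋; sum-replicate-zero)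
    open import Data.Vec.Functional using (tail; init; last; replicate)
    ^≡↑ : ∀ x m → x ^′ m ≡ x ↑ m
    ^≡↑ x zero    = refl
    ^≡↑ x (suc m) = cong (x ⊗_) (^≡↑ x m)
    ·≡ι : ∀ m x → m · x ≡ ι m ⊗ x
    ·≡ι zero    x = sym (R.zeroˡ x)
    ·≡ι (suc m) x = trans (cong (x ⊕_) (·≡ι m x)) (trans (cong (_⊕ ι m ⊗ x) (sym (R.*-identityˡ x))) (sym (R.distribʳ x 1# (ι m))))
    middle : ∀ {m z} → p ∣ m → m · z ≡ 0#
    middle {m} {z} (divides c refl) = trans (·≡ι m z) (trans (cong (_⊗ z) (ι-multiple c)) (R.zeroˡ z))
    -- Stated for a variable exponent so that a split into successors exposes the last binomial
    -- term. All terms strictly between the ends have a coefficient divisible by p.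
    go : ∀ m → m ≡ p → (x ⊕ y) ↑ m ≡ x ↑ m ⊕ y ↑ m
    go zero    refl = ⊥-elim (n≮0 1<p)
    go (suc m) refl = begin
      (x ⊕ y) ↑ suc m                                  ≡⟨ sym (^≡↑ (x ⊕ y) (suc m)) ⟩
      (x ⊕ y) ^′ suc m                                 ≡⟨ theorem (suc m) x y ⟩
      t Fin.zero ⊕ sum (tail t)                        ≡⟨ cong (t Fin.zero ⊕_) (sum-init-last (tail t)) ⟩
      t Fin.zero ⊕ (sum (init (tail t)) ⊕ last (tail t)) ≡⟨ cong₂ (λ a b → a ⊕ (b ⊕ last (tail t))) first (trans (sum-cong-≋ mid) (sum-replicate-zero m)) ⟩
      y ↑ suc m ⊕ (0# ⊕ last (tail t))                 ≡⟨ cong (y ↑ suc m ⊕_) (trans (R.+-identityˡ _) final) ⟩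
      y ↑ suc m ⊕ x ↑ suc m                            ≡⟨ R.+-comm _ _ ⟩
      x ↑ suc m ⊕ y ↑ suc m                            ∎
      where
      open ≡-Reasoning
      t : Fin (suc (suc m)) → Carrier
      t = binomialTerm x y (suc m)
      first : t Fin.zero ≡ y ↑ suc m
      first = trans (R.+-identityʳ _) (trans (R.*-identityˡ _) (^≡↑ y (suc m)))
      mid : ∀ i → init (tail t) i ≡ replicate m 0# i
      mid i = middle {suc m C toℕ (Fin.suc (inject₁ i))} (prime∣C prime-p (s≤s z≤n) (s≤s (subst (_< m) (sym (toℕ-inject₁ i)) (toℕ<n i))))
      final : last (tail t) ≡ x ↑ suc m
      final = begin
        (suc m C suc (toℕ (fromℕ m))) · (x ^′ suc (toℕ (fromℕ m)) ⊗ y ^′ (m ∸ toℕ (fromℕ m)))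
          ≡⟨ cong (λ j → (suc m C suc j) · (x ^′ suc j ⊗ y ^′ (m ∸ j))) (toℕ-fromℕ m) ⟩
        (suc m C suc m) · (x ^′ suc m ⊗ y ^′ (m ∸ m))
          ≡⟨ cong₂ (λ c e → c · (x ^′ suc m ⊗ y ^′ e)) (nCn≡1 (suc m)) (n∸n≡0 m) ⟩
        (x ^′ suc m ⊗ 1#) ⊕ 0#
          ≡⟨ trans (R.+-identityʳ _) (R.*-identityʳ _) ⟩
        x ^′ suc m
          ≡⟨ ^≡↑ x (suc m) ⟩
        x ↑ suc m ∎

  frobenius-iter : ∀ i x y → (x ⊕ y) ↑ (p ^ i) ≡ x ↑ (p ^ i) ⊕ y ↑ (p ^ i)
  frobenius-iter zero    x y = trans (↑-1 _) (sym (cong₂ _⊕_ (↑-1 x) (↑-1 y)))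
  frobenius-iter (suc i) x y = begin
    (x ⊕ y) ↑ (p * p ^ i)                     ≡⟨ ↑-* (x ⊕ y) p (p ^ i) ⟩
    ((x ⊕ y) ↑ p) ↑ (p ^ i)                   ≡⟨ cong (_↑ (p ^ i)) (frobenius x y) ⟩
    (x ↑ p ⊕ y ↑ p) ↑ (p ^ i)                 ≡⟨ frobenius-iter i (x ↑ p) (y ↑ p) ⟩
    (x ↑ p) ↑ (p ^ i) ⊕ (y ↑ p) ↑ (p ^ i)     ≡⟨ sym (cong₂ _⊕_ (↑-* x p (p ^ i)) (↑-* y p (p ^ i))) ⟩
    x ↑ (p * p ^ i) ⊕ y ↑ (p * p ^ i)         ∎
    where open ≡-Reasoning

  -- Conjugation, the norm-one group U and the subfield F

  conj : Carrier → Carrier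
  conj x = x ↑ q

  conj-⊕ : ∀ x y → conj (x ⊕ y) ≡ conj x ⊕ conj y
  conj-⊕ = frobenius-iter n

  conj-⊗ : ∀ x y → conj (x ⊗ y) ≡ conj x ⊗ conj y
  conj-⊗ x y = ⊗-↑ x y q

  conj-0 : conj 0# ≡ 0#
  conj-0 = 0↑ (<-trans (s≤s z≤n) 1<q)

  conj-1 : conj 1# ≡ 1#
  conj-1 = 1↑ q

  conj-⊖ : ∀ x → conj (⊖ x) ≡ ⊖ conj x
  conj-⊖ x = combine₂ 1# (⊖ 1#) (trans (cong conj (R.-‿inverseʳ x)) conj-0) (conj-⊕ x (⊖ x))
    (solve 3 (λ c d e → d :- (:- c) := con (+ 1) :* (e :- con (+ 0)) :+ (:- con (+ 1)) :* (e :- (c :+ d))) refl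
      (conj x) (conj (⊖ x)) (conj (x ⊕ ⊖ x)))

  conj-⊝ : ∀ x y → conj (x ⊝ y) ≡ conj x ⊝ conj y
  conj-⊝ x y = trans (conj-⊕ x (⊖ y)) (cong (conj x ⊕_) (conj-⊖ y))

  conj-↑ : ∀ x m → conj (x ↑ m) ≡ conj x ↑ m
  conj-↑ x m = ↑-comm x m q

  ↑-order : ∀ x → x ↑ order ≡ x
  ↑-order x with x ≟L 0#
  ... | yes refl = 0↑ (subst (0 <_) (sym order≡q*q) (*-mono-< {0} {q} {0} {q} (<-trans (s≤s z≤n) 1<q) (<-trans (s≤s z≤n) 1<q)))
  ... | no x≢0   = trans (cong (x ↑_) (sym (m+[n∸m]≡n {1} {order} 1≤order)))
                     (trans (cong (x ⊗_) (fermat x x≢0)) (R.*-identityʳ x))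
    where
    1≤order : 1 ≤ order
    1≤order = subst (1 ≤_) (sym order≡q*q) (*-mono-≤ {1} {q} {1} {q} (<⇒≤ 1<q) (<⇒≤ 1<q))

  conj-conj : ∀ x → conj (conj x) ≡ x
  conj-conj x = trans (sym (↑-* x q q)) (trans (cong (x ↑_) (sym order≡q*q)) (↑-order x))

  -- For x ≠ 0, `x ↑ r` is conj x / x; this map sends L* onto U, and its fibres are the cosets of
  -- F*.
  r : ℕ
  r = q ∸ 1

  q≡1+r : q ≡ suc r
  q≡1+r = sym (m+[n∸m]≡n (<⇒≤ 1<q))

  order≡1+ : order ≡ suc (suc q * r)
  order≡1+ = trans order≡q*q (trans (cong₂ _*_ q≡1+r q≡1+r) (trans (lemma r) (cong (λ m → suc (suc m * r)) (sym q≡1+r))))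
    where
    lemma : ∀ r → suc r * suc r ≡ suc (suc (suc r) * r)
    lemma = solve-∀

  conj≡⊗ : ∀ x → conj x ≡ x ⊗ x ↑ r
  conj≡⊗ x = cong (x ↑_) q≡1+r

  private
    -- The cofactor (x^{(t+1)d} - 1) / (x^d - 1) = x^{td} + ... + x^d + 1.
    geometric : ℕ → ℕ → Carrier → Carrier
    geometric d zero    x = 1#
    geometric d (suc t) x = x ↑ (suc t * d) ⊕ geometric d t x

    geometric-poly : ∀ {d} → 0 < d → ∀ t → Poly (t * d) 1# (geometric d t)
    geometric-poly 0<d zero    = poly-const 1#
    geometric-poly {d@(suc _)} 0<d (suc t) = poly-monic (m<n+m (t * d) 0<d) (geometric-poly 0<d t)

    geometric-sum : ∀ d t x → (x ↑ d ⊝ 1#) ⊗ geometric d t x ≡ x ↑ (suc t * d) ⊝ 1#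
    geometric-sum d zero    x = trans (R.*-identityʳ _) (cong (λ m → x ↑ m ⊝ 1#) (sym (+-identityʳ d)))
    geometric-sum d (suc t) x = combine₂ 1# (⊖ 1#) (geometric-sum d t x) (↑-+ x d (suc t * d))
      (solve 4 (λ D G a b → (D :- con (+ 1)) :* (a :+ G) :- (b :- con (+ 1))
           := con (+ 1) :* ((D :- con (+ 1)) :* G :- (a :- con (+ 1))) :+ (:- con (+ 1)) :* (b :- D :* a)) refl
         (x ↑ d) (geometric d t x) (x ↑ (suc t * d)) (x ↑ (suc (suc t) * d)))

  ↑-roots≤ : ∀ m c → 0 < m → count (λ x → x ↑ m ≟L c) ≤ m
  ↑-roots≤ m c 0<m = ≤-trans (≤-reflexive (count-cong _ _ (λ x h → ≡⇒⊝≡0 h) (λ x h → ⊝≡0⇒≡ h)))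
    (roots≤degree m 1≢0 (poly-monic 0<m (poly-const (⊖ c))))

  -- x ^ (order - 1) - 1 splits, hence so does its divisor x ^ d - 1.
  roots-of-unity : ∀ d t → d * t ≡ order ∸ 1 → 0 < d → 0 < t → count (λ x → x ↑ d ≟L 1#) ≡ d
  roots-of-unity d (suc t) dt≡ 0<d _ = ≤-antisym (↑-roots≤ d 1# 0<d)
    (+-cancelʳ-≤ (t * d) d _ (begin
      d + t * d                                                           ≡⟨ *-comm (suc t) d ⟩
      d * suc t                                                           ≡⟨ dt≡ ⟩
      order ∸ 1                                                           ≡⟨ cong (_∸ 1) (trans (sym ∑-one) (trans (∑-cong (λ x → sym (𝟙-¬ (x ≟L 0#)))) (∑-+ _ _))) ⟩
      count (_≟L 0#) + count (λ x → ¬? (x ≟L 0#)) ∸ 1                     ≡⟨ cong (λ m → m + count (λ x → ¬? (x ≟L 0#)) ∸ 1) (count-one (_≟L 0#) 0# refl (λ _ h → h)) ⟩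
      count (λ x → ¬? (x ≟L 0#))                                          ≤⟨ ∑-mono (λ x → ≤-trans (𝟙-mono (¬? (x ≟L 0#)) ((x ↑ d ≟L 1#) ⊎-dec (geometric d t x ≟L 0#)) (root x)) (≤-trans (m≤m+n _ _) (≤-reflexive (𝟙-⊎ (x ↑ d ≟L 1#) (geometric d t x ≟L 0#))))) ⟩
      ∑[ x ] (𝟙 (x ↑ d ≟L 1#) + 𝟙 (geometric d t x ≟L 0#))                ≡⟨ ∑-+ _ _ ⟩
      count (λ x → x ↑ d ≟L 1#) + count (λ x → geometric d t x ≟L 0#)     ≤⟨ +-monoʳ-≤ _ (roots≤degree (t * d) 1≢0 (geometric-poly 0<d t)) ⟩
      count (λ x → x ↑ d ≟L 1#) + t * d                                   ∎))
    where
    open ≤-Reasoning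
    root : ∀ x → x ≢ 0# → x ↑ d ≡ 1# ⊎ geometric d t x ≡ 0#
    root x x≢0 = [ inj₁ ∘ ⊝≡0⇒≡ , inj₂ ]′ (zero-product (trans (geometric-sum d t x) (≡⇒⊝≡0
      (trans (cong (x ↑_) (trans (*-comm (suc t) d) dt≡)) (fermat x x≢0)))))

  0<r : 0 < r
  0<r = m<n⇒0<n∸m 1<q

  -- Definitionally `u ↑ suc q ≡ 1#`; `count-U` and `U-↑-multiple` use it in that form.
  U : Carrier → Set
  U u = u ⊗ conj u ≡ 1#

  U? : ∀ u → Dec (U u)
  U? u = u ⊗ conj u ≟L 1#

  F : Carrier → Set
  F x = conj x ≡ x

  F? : ∀ x → Dec (F x)
  F? x = conj x ≟L x

  F* : Carrier → Set
  F* x = x ≢ 0# × F x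

  F*? : ∀ x → Dec (F* x)
  F*? x = ¬? (x ≟L 0#) ×-dec F? x

  U-1 : U 1#
  U-1 = trans (R.*-identityˡ _) conj-1

  U-⊗ : ∀ {u v} → U u → U v → U (u ⊗ v)
  U-⊗ {u} {v} hu hv = trans (cong ((u ⊗ v) ⊗_) (conj-⊗ u v))
    (combine₂ (v ⊗ conj v) 1# hu hv
      (solve 4 (λ u v u′ v′ → (u :* v) :* (u′ :* v′) :- con (+ 1) := (v :* v′) :* (u :* u′ :- con (+ 1)) :+ con (+ 1) :* (v :* v′ :- con (+ 1)))
        refl u v (conj u) (conj v)))

  U-conj : ∀ {u} → U u → U (conj u)
  U-conj {u} hu = trans (cong (conj u ⊗_) (conj-conj u)) (trans (R.*-comm _ _) hu)

  U-↑ : ∀ {u} m → U u → U (u ↑ m)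
  U-↑ zero    hu = U-1
  U-↑ (suc m) hu = U-⊗ hu (U-↑ m hu)

  U-⊖ : ∀ {u} → U u → U (⊖ u)
  U-⊖ {u} hu = trans (cong ((⊖ u) ⊗_) (conj-⊖ u))
    (combine₁ 1# hu (solve 2 (λ u u′ → (:- u) :* (:- u′) :- con (+ 1) := con (+ 1) :* (u :* u′ :- con (+ 1))) refl u (conj u)))

  U≢0 : ∀ {u} → U u → u ≢ 0#
  U≢0 hu refl = 1≢0 (trans (sym hu) (R.zeroˡ _))

  count-U : count U? ≡ suc q
  count-U = roots-of-unity (suc q) r (sym (cong (_∸ 1) order≡1+)) (s≤s z≤n) 0<r

  F*-↑r : ∀ {x} → F* x → x ↑ r ≡ 1#
  F*-↑r {x} (x≢0 , hx) = ⊗-cancelˡ x≢0 (trans (sym (conj≡⊗ x)) (trans hx (sym (R.*-identityʳ x))))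

  ↑r-F* : ∀ {x} → x ↑ r ≡ 1# → F* x
  ↑r-F* {x} h = (λ { refl → 1≢0 (trans (sym h) (0↑ 0<r)) })
    , trans (conj≡⊗ x) (trans (cong (x ⊗_) h) (R.*-identityʳ x))

  count-F* : count F*? ≡ r
  count-F* = trans (count-cong F*? (λ x → x ↑ r ≟L 1#) (λ _ → F*-↑r) (λ _ → ↑r-F*))
    (roots-of-unity r (suc q) (trans (*-comm r (suc q)) (sym (cong (_∸ 1) order≡1+))) 0<r (s≤s z≤n))

  count-0 : count (_≟L 0#) ≡ 1
  count-0 = count-one (_≟L 0#) 0# refl (λ _ h → h)

  F-split : ∀ x → 𝟙 (F? x) ≡ 𝟙 (x ≟L 0#) + 𝟙 (F*? x)
  F-split x with x ≟L 0#
  ... | yes refl = 𝟙-yes (F? 0#) conj-0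
  ... | no  x≢0  = 𝟙-cong (F? x) (¬? (no x≢0) ×-dec F? x) (x≢0 ,_) proj₂

  count-F : count F? ≡ q
  count-F = trans (∑-cong F-split) (trans (∑-+ _ _) (trans (cong₂ _+_ count-0 count-F*) (sym q≡1+r)))

  ↑r-U : ∀ {x} → x ≢ 0# → U (x ↑ r)
  ↑r-U {x} x≢0 = ⊗-cancelˡ x≢0 (begin
    x ⊗ (x ↑ r ⊗ conj (x ↑ r))      ≡⟨ sym (R.*-assoc _ _ _) ⟩
    (x ⊗ x ↑ r) ⊗ conj (x ↑ r)      ≡⟨ cong₂ _⊗_ (sym (conj≡⊗ x)) (conj-↑ x r) ⟩
    conj x ⊗ conj x ↑ r             ≡⟨ sym (conj≡⊗ (conj x)) ⟩
    conj (conj x)                   ≡⟨ conj-conj x ⟩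
    x                               ≡⟨ sym (R.*-identityʳ x) ⟩
    x ⊗ 1#                          ∎)
    where open ≡-Reasoning

  fibre? : ∀ u x → Dec (x ≢ 0# × u ≡ x ↑ r)
  fibre? u x = ¬? (x ≟L 0#) ×-dec (u ≟L x ↑ r)

  -- All q + 1 fibres over U have at most q - 1 points, and together they have q² - 1.
  count-fibre : ∀ {u} → U u → count (fibre? u) ≡ r
  count-fibre {u} hu = trans (∑-pigeon {λ u → count (fibre? u)} {λ u → 𝟙 (U? u) * r} bound (≤-reflexive total) u)
    (trans (cong (_* r) (𝟙-yes (U? u) hu)) (*-identityˡ r))
    where
    bound : ∀ u → count (fibre? u) ≤ 𝟙 (U? u) * r
    bound u with U? u
    ... | yes _  = ≤-trans (∑-mono (λ x → 𝟙-mono (fibre? u x) (x ↑ r ≟L u) (sym ∘ proj₂)))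
                     (≤-trans (↑-roots≤ r u 0<r) (≤-reflexive (sym (+-identityʳ r))))
    ... | no ¬hu = ≤-reflexive (count-none (fibre? u) (λ { x (x≢0 , refl) → ¬hu (↑r-U x≢0) }))
    total : ∑[ u ] 𝟙 (U? u) * r ≡ ∑[ u ] count (fibre? u)
    total = begin
      ∑[ u ] 𝟙 (U? u) * r                                       ≡⟨ trans (∑-*ʳ r _) (cong (_* r) count-U) ⟩
      suc q * r                                                 ≡⟨ sym (cong (_∸ 1) order≡1+) ⟩
      order ∸ 1                                                 ≡⟨ cong (_∸ 1) (trans (sym ∑-one) (trans (∑-cong (λ x → sym (𝟙-¬ (x ≟L 0#)))) (∑-+ _ _))) ⟩
      count (_≟L 0#) + count (λ x → ¬? (x ≟L 0#)) ∸ 1           ≡⟨ cong (λ m → m + count (λ x → ¬? (x ≟L 0#)) ∸ 1) count-0 ⟩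
      count (λ x → ¬? (x ≟L 0#))                                ≡⟨ ∑-cong (λ x → sym (trans (∑-cong λ u → trans (𝟙-× (¬? (x ≟L 0#)) (u ≟L x ↑ r)) (*-comm (𝟙 (¬? (x ≟L 0#))) (𝟙 (u ≟L x ↑ r))))
                                                                     (∑-point (x ↑ r) (λ _ → 𝟙 (¬? (x ≟L 0#)))))) ⟩
      ∑[ x ] ∑[ u ] 𝟙 (fibre? u x)                              ≡⟨ ∑-swap (λ x u → 𝟙 (fibre? u x)) ⟩
      ∑[ u ] count (fibre? u)                                   ∎
      where open ≡-Reasoning

  -- Stands in for the quotient of L* by F*: each u ∈ U equals x^{q-1} for exactly q - 1 elements x.
  -- The hypothesis confines `f` to U.
  ∑-via-↑r : ∀ (f : Carrier → ℕ) → (∀ u → ¬ U u → f u ≡ 0) → ∑[ x ] 𝟙 (¬? (x ≟L 0#)) * f (x ↑ r) ≡ r * ∑ f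
  ∑-via-↑r f h = begin
    ∑[ x ] 𝟙 (¬? (x ≟L 0#)) * f (x ↑ r)                           ≡⟨ ∑-cong (λ x → trans (cong (𝟙 (¬? (x ≟L 0#)) *_) (sym (∑-point (x ↑ r) f))) (sym (∑-*ˡ (𝟙 (¬? (x ≟L 0#))) (λ u → 𝟙 (u ≟L x ↑ r) * f u)))) ⟩
    ∑[ x ] ∑[ u ] 𝟙 (¬? (x ≟L 0#)) * (𝟙 (u ≟L x ↑ r) * f u)       ≡⟨ ∑-swap _ ⟩
    ∑[ u ] ∑[ x ] 𝟙 (¬? (x ≟L 0#)) * (𝟙 (u ≟L x ↑ r) * f u)       ≡⟨ ∑-cong (λ u → trans (∑-cong (λ x → trans (sym (*-assoc (𝟙 (¬? (x ≟L 0#))) _ _)) (cong (_* f u) (sym (𝟙-× (¬? (x ≟L 0#)) (u ≟L x ↑ r)))))) (∑-*ʳ (f u) _)) ⟩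
    ∑[ u ] count (fibre? u) * f u                                 ≡⟨ ∑-cong fibre ⟩
    ∑[ u ] r * f u                                                ≡⟨ ∑-*ˡ r f ⟩
    r * ∑ f                                                       ∎
    where
    open ≡-Reasoning
    fibre : ∀ u → count (fibre? u) * f u ≡ r * f u
    fibre u with U? u
    ... | yes hu = cong (_* f u) (count-fibre hu)
    ... | no ¬hu = trans (cong (count (fibre? u) *_) (h u ¬hu)) (trans (*-zeroʳ (count (fibre? u))) (trans (sym (*-zeroʳ r)) (cong (r *_) (sym (h u ¬hu)))))

  -- Power maps on U

  U-↑-multiple : ∀ {w} m → U w → w ↑ (m * suc q) ≡ 1#
  U-↑-multiple {w} m hw = trans (↑-comm′ m) (1↑ m)
    where
    ↑-comm′ : ∀ m → w ↑ (m * suc q) ≡ 1# ↑ m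
    ↑-comm′ m = trans (cong (w ↑_) (*-comm m (suc q))) (trans (↑-* w (suc q) m) (cong (_↑ m) hw))

  -- Bézout: on U the power maps to m and to gcd m (q + 1) have the same image and kernel.
  ↑gcd-image : ∀ m {w} → U w → ∃ λ u → U u × u ↑ m ≡ w ↑ gcd m (suc q)
  ↑gcd-image m {w} hw with Bézout.identity (gcd-GCD m (suc q))
  ... | Bézout.+- x y eq = w ↑ x , U-↑ x hw , (begin
    (w ↑ x) ↑ m                               ≡⟨ sym (↑-* w x m) ⟩
    w ↑ (x * m)                               ≡⟨ cong (w ↑_) (sym eq) ⟩
    w ↑ (gcd m (suc q) + y * suc q)           ≡⟨ ↑-+ w (gcd m (suc q)) (y * suc q) ⟩
    w ↑ gcd m (suc q) ⊗ w ↑ (y * suc q)       ≡⟨ cong (w ↑ gcd m (suc q) ⊗_) (U-↑-multiple y hw) ⟩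
    w ↑ gcd m (suc q) ⊗ 1#                    ≡⟨ R.*-identityʳ _ ⟩
    w ↑ gcd m (suc q)                         ∎)
    where open ≡-Reasoning
  ... | Bézout.-+ x y eq = conj w ↑ x , U-↑ x (U-conj hw) , (begin
    (conj w ↑ x) ↑ m                          ≡⟨ sym (↑-* (conj w) x m) ⟩
    conj w ↑ (x * m)                          ≡⟨ sym (R.*-identityˡ _) ⟩
    1# ⊗ conj w ↑ (x * m)                     ≡⟨ cong (_⊗ conj w ↑ (x * m)) (sym (trans (sym (↑-+ w (gcd m (suc q)) (x * m))) (trans (cong (w ↑_) eq) (U-↑-multiple y hw)))) ⟩
    (w ↑ gcd m (suc q) ⊗ w ↑ (x * m)) ⊗ conj w ↑ (x * m) ≡⟨ R.*-assoc _ _ _ ⟩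
    w ↑ gcd m (suc q) ⊗ (w ↑ (x * m) ⊗ conj w ↑ (x * m)) ≡⟨ cong (w ↑ gcd m (suc q) ⊗_) (trans (sym (⊗-↑ w (conj w) (x * m))) (trans (cong (_↑ (x * m)) hw) (1↑ (x * m)))) ⟩
    w ↑ gcd m (suc q) ⊗ 1#                    ≡⟨ R.*-identityʳ _ ⟩
    w ↑ gcd m (suc q)                         ∎)
    where open ≡-Reasoning

  ↑gcd-kernel : ∀ m {w} → U w → w ↑ m ≡ 1# → w ↑ gcd m (suc q) ≡ 1#
  ↑gcd-kernel m {w} hw h with Bézout.identity (gcd-GCD m (suc q))
  ... | Bézout.+- x y eq = begin
    w ↑ gcd m (suc q)                         ≡⟨ sym (R.*-identityʳ _) ⟩
    w ↑ gcd m (suc q) ⊗ 1#                    ≡⟨ cong (w ↑ gcd m (suc q) ⊗_) (sym (U-↑-multiple y hw)) ⟩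
    w ↑ gcd m (suc q) ⊗ w ↑ (y * suc q)       ≡⟨ sym (↑-+ w (gcd m (suc q)) (y * suc q)) ⟩
    w ↑ (gcd m (suc q) + y * suc q)           ≡⟨ cong (w ↑_) eq ⟩
    w ↑ (x * m)                               ≡⟨ trans (↑-* w x m) (trans (↑-comm w x m) (trans (cong (_↑ x) h) (1↑ x))) ⟩
    1#                                        ∎
    where open ≡-Reasoning
  ... | Bézout.-+ x y eq = begin
    w ↑ gcd m (suc q)                         ≡⟨ sym (R.*-identityʳ _) ⟩
    w ↑ gcd m (suc q) ⊗ 1#                    ≡⟨ cong (w ↑ gcd m (suc q) ⊗_) (sym (trans (↑-* w x m) (trans (↑-comm w x m) (trans (cong (_↑ x) h) (1↑ x))))) ⟩
    w ↑ gcd m (suc q) ⊗ w ↑ (x * m)           ≡⟨ sym (↑-+ w (gcd m (suc q)) (x * m)) ⟩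
    w ↑ (gcd m (suc q) + x * m)               ≡⟨ cong (w ↑_) eq ⟩
    w ↑ (y * suc q)                           ≡⟨ U-↑-multiple y hw ⟩
    1#                                        ∎
    where open ≡-Reasoning

  ↑-multiple-1 : ∀ {w m d} → d ∣ m → w ↑ d ≡ 1# → w ↑ m ≡ 1#
  ↑-multiple-1 {w} {m} {d} (divides c refl) h = trans (cong (w ↑_) (*-comm c d)) (trans (↑-* w d c) (trans (cong (_↑ c) h) (1↑ c)))

  private
    suc-q∣ : suc q ∣ order ∸ 1
    suc-q∣ = divides r (trans (cong (_∸ 1) order≡1+) (*-comm (suc q) r))

  U-⊗-reindex : ∀ {u} → U u → ∀ (f : Carrier → ℕ) → ∑[ x ] f (u ⊗ x) ≡ ∑ f
  U-⊗-reindex {u} hu = ∑-reindex (u ⊗_) (conj u ⊗_)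
    (λ x → combine₁ x hu (solve 3 (λ u u′ x → u′ :* (u :* x) :- x := x :* (u :* u′ :- con (+ 1))) refl u (conj u) x))
    (λ x → combine₁ x hu (solve 3 (λ u u′ x → u :* (u′ :* x) :- x := x :* (u :* u′ :- con (+ 1))) refl u (conj u) x))

  U-cofactor : ∀ {u x} → U u → U (u ⊗ x) → U x
  U-cofactor {u} {x} hu hux = combine₂ (⊖ (x ⊗ conj x)) 1# hu (trans (cong ((u ⊗ x) ⊗_) (sym (conj-⊗ u x))) hux)
    (solve 4 (λ u u′ x x′ → x :* x′ :- con (+ 1) := (:- (x :* x′)) :* (u :* u′ :- con (+ 1)) :+ con (+ 1) :* ((u :* x) :* (u′ :* x′) :- con (+ 1)))
      refl u (conj u) x (conj x))

  -- Division by `u₀` turns the fibre into the kernel, which consists of the roots of y^g = 1 for g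
  -- = gcd(m, q + 1). As g divides q² - 1, all g of these roots lie in L.
  count-↑-fibre : ∀ m {u₀} → U u₀ → count (λ u → U? u ×-dec (u ↑ m ≟L u₀ ↑ m)) ≡ gcd m (suc q)
  count-↑-fibre m {u₀} hu₀ = begin
    count (λ u → U? u ×-dec (u ↑ m ≟L u₀ ↑ m))                     ≡⟨ sym (U-⊗-reindex hu₀ _) ⟩
    count (λ y → U? (u₀ ⊗ y) ×-dec ((u₀ ⊗ y) ↑ m ≟L u₀ ↑ m))       ≡⟨ count-cong _ (λ y → y ↑ g ≟L 1#) to from ⟩
    count (λ y → y ↑ g ≟L 1#)                                      ≡⟨ exact (∣-trans (gcd[m,n]∣n m (suc q)) suc-q∣) ⟩
    g                                                              ∎
    where
    open ≡-Reasoning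
    g = gcd m (suc q)
    to : ∀ y → U (u₀ ⊗ y) × (u₀ ⊗ y) ↑ m ≡ u₀ ↑ m → y ↑ g ≡ 1#
    to y (hu , h) = ↑gcd-kernel m (U-cofactor hu₀ hu) (⊗-cancelˡ (↑≢0 m (U≢0 hu₀))
      (trans (sym (⊗-↑ u₀ y m)) (trans h (sym (R.*-identityʳ _)))))
    from : ∀ y → y ↑ g ≡ 1# → U (u₀ ⊗ y) × (u₀ ⊗ y) ↑ m ≡ u₀ ↑ m
    from y h = U-⊗ hu₀ (↑-multiple-1 (gcd[m,n]∣n m (suc q)) h)
      , trans (⊗-↑ u₀ y m) (trans (cong (u₀ ↑ m ⊗_) (↑-multiple-1 (gcd[m,n]∣m m (suc q)) h)) (R.*-identityʳ _))
    0<g : 0 < g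
    0<g = n≢0⇒n>0 (gcd[m,n]≢0 m (suc q) (inj₂ λ ()))
    exact : g ∣ order ∸ 1 → count (λ y → y ↑ g ≟L 1#) ≡ g
    exact (divides zero eq) = ⊥-elim (n≮0 (subst (0 <_) (trans (sym (cong (_∸ 1) order≡1+)) eq) (*-mono-< {0} {suc q} (s≤s z≤n) 0<r)))
    exact (divides c@(suc _) eq) = roots-of-unity g c (trans (*-comm g c) (sym eq)) 0<g (s≤s z≤n)

  ↑-injective-on-U : ∀ m → gcd m (suc q) ≡ 1 → ∀ {u v} → U u → U v → u ↑ m ≡ v ↑ m → u ≡ v
  ↑-injective-on-U m g≡1 {u} {v} hu hv h = combine₂ v (⊖ u)
    (trans (sym (↑-1 _)) (trans (cong ((u ⊗ conj v) ↑_) (sym g≡1)) (↑gcd-kernel m (U-⊗ hu (U-conj hv)) ratio))) hv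
    (solve 3 (λ u v v′ → u :- v := v :* (u :* v′ :- con (+ 1)) :+ (:- u) :* (v :* v′ :- con (+ 1))) refl u v (conj v))
    where
    ratio : (u ⊗ conj v) ↑ m ≡ 1#
    ratio = trans (⊗-↑ u (conj v) m) (trans (cong (_⊗ conj v ↑ m) h)
      (trans (sym (⊗-↑ v (conj v) m)) (trans (cong (_↑ m) hv) (1↑ m))))

  -- Traces, as partial sums x + x^p + ... of variable length

  tr : ℕ → Carrier → Carrier
  tr j x = sumL L p (2 * n) j (λ i → x ↑ (p ^ i))

  tr-⊕ : ∀ j x y → tr j (x ⊕ y) ≡ tr j x ⊕ tr j y
  tr-⊕ zero    x y = sym (R.+-identityʳ 0#)
  tr-⊕ (suc j) x y = trans (cong₂ _⊕_ (frobenius-iter j x y) (tr-⊕ j x y))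
    (solve 4 (λ a b c d → (a :+ b) :+ (c :+ d) := (a :+ c) :+ (b :+ d)) refl (x ↑ (p ^ j)) (y ↑ (p ^ j)) (tr j x) (tr j y))

  ↑p-fixed : ∀ {x} j → x ↑ p ≡ x → x ↑ (p ^ j) ≡ x
  ↑p-fixed         zero    h = ↑-1 _
  ↑p-fixed {x} (suc j) h = trans (↑-* x p (p ^ j)) (trans (cong (_↑ (p ^ j)) h) (↑p-fixed j h))

  tr-scale : ∀ j {c} x → c ↑ p ≡ c → tr j (c ⊗ x) ≡ c ⊗ tr j x
  tr-scale zero    {c} x h = sym (R.zeroʳ c)
  tr-scale (suc j) {c} x h = trans (cong₂ _⊕_ (trans (⊗-↑ c x (p ^ j)) (cong (_⊗ x ↑ (p ^ j)) (↑p-fixed j h))) (tr-scale j x h))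
    (sym (R.distribˡ c _ _))

  tr-0 : ∀ j → tr j 0# ≡ 0#
  tr-0 zero    = refl
  tr-0 (suc j) = trans (cong₂ _⊕_ (0↑ (m^n>0 p j)) (tr-0 j)) (R.+-identityʳ 0#)

  tr-+ : ∀ j x → tr (j + n) x ≡ tr j (conj x) ⊕ tr n x
  tr-+ zero    x = sym (R.+-identityˡ _)
  tr-+ (suc j) x = trans (cong₂ _⊕_ (trans (cong (x ↑_) (^-distribˡ-+-* p j n)) (trans (↑-* x (p ^ j) q) (↑-comm x (p ^ j) q))) (tr-+ j x))
    (sym (R.+-assoc _ _ _))

  absTr : Carrier → Carrier
  absTr x = tr (2 * n) x

  relTr : Carrier → Carrier
  relTr x = x ⊕ conj x

  -- Transitivity of the trace: the terms of exponent p^{n+i} in the trace of x are the terms of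
  -- exponent p^i for conj x.
  absTr-via-relTr : ∀ x → absTr x ≡ tr n (relTr x)
  absTr-via-relTr x = trans (cong (λ j → tr (n + j) x) (+-identityʳ n)) (trans (tr-+ n x)
    (trans (R.+-comm _ _) (sym (tr-⊕ n x (conj x)))))

  relTr-F : ∀ x → F (relTr x)
  relTr-F x = trans (conj-⊕ x (conj x)) (trans (cong (conj x ⊕_) (conj-conj x)) (R.+-comm _ _))

  relTr-scale : ∀ {y} x → F y → relTr (y ⊗ x) ≡ y ⊗ relTr x
  relTr-scale {y} x hy = trans (cong (y ⊗ x ⊕_) (trans (conj-⊗ y x) (cong (_⊗ conj x) hy))) (sym (R.distribˡ y x (conj x)))

  -- Raising to the power p shifts the sum by one term: it gains x^{p^{2n}} and loses x, and these
  -- two are equal.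
  absTr-↑p : ∀ x → absTr x ↑ p ≡ absTr x
  absTr-↑p x = combine₂ 1# 1# (telescope (2 * n)) (trans (cong (x ↑_) (sym order≡)) (↑-order x))
    (solve 4 (λ a b c d → a :- b := con (+ 1) :* ((a :+ c) :- (b :+ d)) :+ con (+ 1) :* (d :- c)) refl (absTr x ↑ p) (absTr x) x (x ↑ (p ^ (2 * n))))
    where
    telescope : ∀ j → tr j x ↑ p ⊕ x ≡ tr j x ⊕ x ↑ (p ^ j)
    telescope zero    = trans (cong (_⊕ x) (0↑ (<-trans (s≤s z≤n) 1<p))) (cong (0# ⊕_) (sym (↑-1 x)))
    telescope (suc j) = combine₃ 1# 1# (⊖ 1#) (frobenius (x ↑ (p ^ j)) (tr j x)) (telescope j)
      (trans (↑-* x p (p ^ j)) (↑-comm x p (p ^ j)))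
      (solve 7 (λ s Xp tp x X t c → (s :+ x) :- ((X :+ t) :+ c)
          := con (+ 1) :* (s :- (Xp :+ tp)) :+ con (+ 1) :* ((tp :+ x) :- (t :+ X)) :+ (:- con (+ 1)) :* (c :- Xp))
        refl (tr (suc j) x ↑ p) ((x ↑ (p ^ j)) ↑ p) (tr j x ↑ p) x (x ↑ (p ^ j)) (tr j x) (x ↑ (p ^ suc j)))

  tr-poly : ∀ j → Poly (p ^ j) 1# (tr (suc j))
  tr-poly zero    = poly-monic {1} {0} (s≤s z≤n) (poly-const 0#)
  tr-poly (suc j) = poly-monic (m<m*n′ (p ^ j) {{>-nonZero (m^n>0 p j)}}) (tr-poly j)
    where
    m<m*n′ : ∀ m .{{_ : NonZero m}} → m < p * m
    m<m*n′ m = subst (m <_) (*-comm m p) (m<m*n m p 1<p)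

  -- tr n has degree p^{n-1} < q, so it cannot vanish on F.
  tr-nonzero : ∃ λ w → F w × tr n w ≢ 0#
  tr-nonzero = [ id , (λ none → ⊥-elim (<⇒≱ small (≤-trans (≤-reflexive (sym count-F))
      (≤-trans (∑-mono (λ w → 𝟙-mono (F? w) (tr n w ≟L 0#) (λ hw → vanish none w hw))) roots)))) ]′
    (search (λ w → F? w ×-dec ¬? (tr n w ≟L 0#)))
    where
    n≡ : suc (n ∸ 1) ≡ n
    n≡ = m+[n∸m]≡n 0<n
    vanish : (∀ w → ¬ (F w × tr n w ≢ 0#)) → ∀ w → F w → tr n w ≡ 0#
    vanish none w hw with tr n w ≟L 0#
    ... | yes h = h
    ... | no ¬h = ⊥-elim (none w (hw , ¬h))
    roots : count (λ w → tr n w ≟L 0#) ≤ p ^ (n ∸ 1)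
    roots = roots≤degree (p ^ (n ∸ 1)) 1≢0 (subst (λ j → Poly (p ^ (n ∸ 1)) 1# (tr j)) n≡ (tr-poly (n ∸ 1)))
    small : p ^ (n ∸ 1) < q
    small = ^-monoʳ-< p 1<p (≤-reflexive n≡)

  ι-↑p : ∀ m → ι m ↑ p ≡ ι m
  ι-↑p zero    = 0↑ (<-trans (s≤s z≤n) 1<p)
  ι-↑p (suc m) = trans (frobenius 1# (ι m)) (cong₂ _⊕_ (1↑ p) (ι-↑p m))

  -- The prime field and the distribution of traces over F

  private
    -- The indicator of {ι 0, ..., ι (j - 1)} with multiplicity. As a sum it has total j, and
    -- pigeonhole can compare it with the roots of x^p - x.
    hits : ℕ → Carrier → ℕ
    hits zero    y = 0
    hits (suc j) y = 𝟙 (y ≟L ι j) + hits j y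

    ∑-hits : ∀ j → ∑ (hits j) ≡ j
    ∑-hits zero    = ∑-zero
    ∑-hits (suc j) = trans (∑-+ _ _) (cong₂ _+_ (count-one (_≟L ι j) (ι j) refl (λ _ h → h)) (∑-hits j))

    hits-found : ∀ j y → hits j y ≢ 0 → ∃ λ c → c < j × y ≡ ι c
    hits-found zero    y h = ⊥-elim (h refl)
    hits-found (suc j) y h with y ≟L ι j
    ... | yes e = j , ≤-refl , e
    ... | no _ with hits-found j y h
    ...   | c , c<j , e = c , m<n⇒m<1+n c<j , e

    hits≤1 : ∀ j → j ≤ p → ∀ y → hits j y ≤ 1
    hits≤1 zero    _   y = z≤n
    hits≤1 (suc j) j<p y with y ≟L ι j
    ... | no _ = hits≤1 j (<⇒≤ j<p) y
    ... | yes e = s≤s (≤-reflexive (missed (hits j y ≟ 0)))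
      where
      missed : Dec (hits j y ≡ 0) → hits j y ≡ 0
      missed (yes h) = h
      missed (no ¬h) with hits-found j y ¬h
      ... | c , c<j , e′ = ⊥-elim (<⇒≢ c<j (ι-injective (<-trans c<j j<p) j<p (trans (sym e′) e)))

  -- x^p - x has at most p roots, and the p elements of the prime field are such.
  prime-field : ∀ x → x ↑ p ≡ x → ∃ λ c → c < p × x ≡ ι c
  prime-field x h = hits-found p x (λ hits≡0 → 0≢1+n (trans (sym hits≡0) (trans (∑-pigeon hits≤root roots≤hits x) (𝟙-yes (x ↑ p ≟L x) h))))
    where
    hits≤root : ∀ y → hits p y ≤ 𝟙 (y ↑ p ≟L y)
    hits≤root y with hits p y ≟ 0
    ... | yes e = ≤-trans (≤-reflexive e) z≤n
    ... | no ¬e with hits-found p y ¬e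
    ...   | c , _ , refl = ≤-trans (hits≤1 p ≤-refl y) (≤-reflexive (sym (𝟙-yes (ι c ↑ p ≟L ι c) (ι-↑p c))))
    roots≤hits : count (λ y → y ↑ p ≟L y) ≤ ∑ (hits p)
    roots≤hits = ≤-trans (≤-reflexive (count-cong _ (λ y → y ↑ p ⊕ (⊖ 1#) ⊗ (y ↑ 1) ≟L 0#) to from))
      (≤-trans (roots≤degree p 1≢0 (poly-monic 1<p (poly-scale 1 (⊖ 1#) (poly-↑ 1)))) (≤-reflexive (sym (∑-hits p))))
      where
      to : ∀ y → y ↑ p ≡ y → y ↑ p ⊕ (⊖ 1#) ⊗ (y ↑ 1) ≡ 0#
      to y e = combine₁ 1# e (solve 2 (λ a y → (a :+ (:- con (+ 1)) :* (y :* con (+ 1))) :- con (+ 0) := con (+ 1) :* (a :- y)) refl (y ↑ p) y)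
      from : ∀ y → y ↑ p ⊕ (⊖ 1#) ⊗ (y ↑ 1) ≡ 0# → y ↑ p ≡ y
      from y e = combine₁ 1# e (solve 2 (λ a y → a :- y := con (+ 1) :* ((a :+ (:- con (+ 1)) :* (y :* con (+ 1))) :- con (+ 0))) refl (y ↑ p) y)

  -- Take w ∈ F with `tr n w` ≠ 0. Then w / relTr z multiplies z to an element of relative trace w,
  -- hence of absolute trace `tr n w`, and the scalar ι i / `tr n w` from the prime field adjusts
  -- this to ι i.
  shift-by : ∀ z i → relTr z ≢ 0# → ∃ λ y → F y × absTr (y ⊗ z) ≡ ι i
  shift-by z i Tz≢0 = build (inverse (relTr z) Tz≢0) tr-nonzero (λ w h → inverse (tr n w) h)
    where
    F-⊗ : ∀ {x y} → F x → F y → F (x ⊗ y)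
    F-⊗ hx hy = trans (conj-⊗ _ _) (cong₂ _⊗_ hx hy)
    F-prime : ∀ {x} → x ↑ p ≡ x → F x
    F-prime = ↑p-fixed n
    inverse-fixed : ∀ {x x⁻¹} m → x ⊗ x⁻¹ ≡ 1# → x ↑ m ≡ x → x⁻¹ ↑ m ≡ x⁻¹
    inverse-fixed {x} {x⁻¹} m e h = combine₂ (x⁻¹) (⊖ x⁻¹ ↑ m) (trans (cong (_⊗ x⁻¹ ↑ m) (sym h)) (trans (sym (⊗-↑ x x⁻¹ m)) (trans (cong (_↑ m) e) (1↑ m)))) e
      (solve 3 (λ x y z → z :- y := y :* (x :* z :- con (+ 1)) :+ (:- z) :* (x :* y :- con (+ 1))) refl x x⁻¹ (x⁻¹ ↑ m))
    build : (∃ λ g → relTr z ⊗ g ≡ 1#) → (∃ λ w → F w × tr n w ≢ 0#) →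
            (∀ w → tr n w ≢ 0# → ∃ λ t → tr n w ⊗ t ≡ 1#) → ∃ λ y → F y × absTr (y ⊗ z) ≡ ι i
    build (g , Tz⊗g≡1) (w , w∈F , trw≢0) invert =
      (ι i ⊗ t) ⊗ (w ⊗ g) , F-⊗ (F-⊗ (F-prime (ι-↑p i)) (F-prime t-prime)) (F-⊗ w∈F g∈F) , value
      where
        t = proj₁ (invert w trw≢0)
        trw⊗t≡1 = proj₂ (invert w trw≢0)
        g∈F : F g
        g∈F = inverse-fixed q Tz⊗g≡1 (relTr-F z)
        t₀ : absTr ((w ⊗ g) ⊗ z) ≡ tr n w
        t₀ = trans (absTr-via-relTr _) (cong (tr n) (trans (relTr-scale z (F-⊗ w∈F g∈F))
          (combine₁ w Tz⊗g≡1 (solve 3 (λ w g s → (w :* g) :* s :- w := w :* (s :* g :- con (+ 1))) refl w g (relTr z)))))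
        -- By `t₀`, `tr n w` is itself an absolute trace, so it lies in the prime field, and so does
        -- its inverse `t`.
        t-prime : t ↑ p ≡ t
        t-prime = inverse-fixed p trw⊗t≡1 (subst (λ s → s ↑ p ≡ s) t₀ (absTr-↑p _))
        it-prime : (ι i ⊗ t) ↑ p ≡ ι i ⊗ t
        it-prime = trans (⊗-↑ (ι i) t p) (cong₂ _⊗_ (ι-↑p i) t-prime)
        value : absTr (((ι i ⊗ t) ⊗ (w ⊗ g)) ⊗ z) ≡ ι i
        value = trans (cong absTr (R.*-assoc _ _ _)) (trans (tr-scale (2 * n) ((w ⊗ g) ⊗ z) it-prime) (trans (cong ((ι i ⊗ t) ⊗_) t₀)
          (combine₁ (ι i) trw⊗t≡1 (solve 3 (λ i t s → (i :* t) :* s :- i := i :* (s :* t :- con (+ 1))) refl (ι i) t (tr n w)))))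

  -- The additive character y ↦ μ (y z) of F is balanced unless it is trivial.
  balanced : ∀ z {i} → 0 < i → i < p →
             count (λ y → F? y ×-dec (absTr (y ⊗ z) ≟L 0#)) ≡ count (λ y → F? y ×-dec (absTr (y ⊗ z) ≟L ι i)) + 𝟙 (relTr z ≟L 0#) * q
  balanced z {i} 0<i i<p with relTr z ≟L 0#
  ... | yes h = trans (trans (count-cong _ F? (λ _ → proj₁) (λ y hy → hy , trivial hy)) count-F)
        (sym (trans (cong (_+ (q + 0)) (count-none _ (λ { y (hy , e) → ι≢0 0<i i<p (trans (sym e) (trivial hy)) }))) (+-identityʳ q)))
    where
    trivial : ∀ {y} → F y → absTr (y ⊗ z) ≡ 0#
    trivial {y} hy = trans (absTr-via-relTr _) (trans (cong (tr n) (trans (relTr-scale z hy) (trans (cong (y ⊗_) h) (R.zeroʳ y)))) (tr-0 n))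
  ... | no Tz≢0  = shift (shift-by z i Tz≢0)
    where
    shift : (∃ λ y₁ → F y₁ × absTr (y₁ ⊗ z) ≡ ι i) →
            count (λ y → F? y ×-dec (absTr (y ⊗ z) ≟L 0#)) ≡ count (λ y → F? y ×-dec (absTr (y ⊗ z) ≟L ι i)) + 0
    shift (y₁ , y₁∈F , Ty₁) = trans (count-cong _ _ to from)
      (trans (∑-reindex (_⊕ y₁) (_⊝ y₁) (λ x → solve 2 (λ x y → (x :+ y) :- y := x) refl x y₁) (λ x → solve 2 (λ x y → (x :- y) :+ y := x) refl x y₁) _)
        (sym (+-identityʳ _)))
      where
      absTr-shift : ∀ y → absTr ((y ⊕ y₁) ⊗ z) ≡ absTr (y ⊗ z) ⊕ ι i
      absTr-shift y = trans (cong absTr (R.distribʳ z y y₁)) (trans (tr-⊕ (2 * n) (y ⊗ z) (y₁ ⊗ z)) (cong (absTr (y ⊗ z) ⊕_) Ty₁))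
      to : ∀ y → F y × absTr (y ⊗ z) ≡ 0# → F (y ⊕ y₁) × absTr ((y ⊕ y₁) ⊗ z) ≡ ι i
      to y (hy , e) = trans (conj-⊕ y y₁) (cong₂ _⊕_ hy y₁∈F) , trans (absTr-shift y) (trans (cong (_⊕ ι i) e) (R.+-identityˡ _))
      from : ∀ y → F (y ⊕ y₁) × absTr ((y ⊕ y₁) ⊗ z) ≡ ι i → F y × absTr (y ⊗ z) ≡ 0#
      from y (hy , e) = combine₃ 1# (⊖ 1#) (⊖ 1#) hy (conj-⊕ y y₁) y₁∈F
          (solve 5 (λ y′ y s y₁ y₁′ → y′ :- y := con (+ 1) :* (s :- (y :+ y₁)) :+ (:- con (+ 1)) :* (s :- (y′ :+ y₁′)) :+ (:- con (+ 1)) :* (y₁′ :- y₁))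
            refl (conj y) y (conj (y ⊕ y₁)) y₁ (conj y₁))
        , combine₂ 1# (⊖ 1#) e (absTr-shift y)
          (solve 3 (λ a b c → a :- con (+ 0) := con (+ 1) :* (b :- c) :+ (:- con (+ 1)) :* (b :- (a :+ c))) refl (absTr (y ⊗ z)) (absTr ((y ⊕ y₁) ⊗ z)) (ι i))

  -- The element y = 0 counts only for i = 0. This is the source of the summand 1 next to `K 0 x` in
  -- `coefficient-gap`.
  count-F-split : ∀ z i → count (λ y → F? y ×-dec (absTr (y ⊗ z) ≟L ι i)) ≡ 𝟙 (0# ≟L ι i) + count (λ y → F*? y ×-dec (absTr (y ⊗ z) ≟L ι i))
  count-F-split z i = begin
    count (λ y → F? y ×-dec (absTr (y ⊗ z) ≟L ι i))
      ≡⟨ ∑-cong (λ y → trans (𝟙-× (F? y) (absTr (y ⊗ z) ≟L ι i)) (trans (cong (_* 𝟙 (absTr (y ⊗ z) ≟L ι i)) (F-split y)) (*-distribʳ-+ _ (𝟙 (y ≟L 0#)) _))) ⟩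
    ∑[ y ] (𝟙 (y ≟L 0#) * 𝟙 (absTr (y ⊗ z) ≟L ι i) + 𝟙 (F*? y) * 𝟙 (absTr (y ⊗ z) ≟L ι i))
      ≡⟨ ∑-+ _ _ ⟩
    (∑[ y ] 𝟙 (y ≟L 0#) * 𝟙 (absTr (y ⊗ z) ≟L ι i)) + (∑[ y ] 𝟙 (F*? y) * 𝟙 (absTr (y ⊗ z) ≟L ι i))
      ≡⟨ cong₂ _+_ (trans (∑-point 0# (λ y → 𝟙 (absTr (y ⊗ z) ≟L ι i))) (𝟙-cong _ _ (λ h → trans (sym T0) h) (λ h → trans T0 h)))
                   (∑-cong (λ y → sym (𝟙-× (F*? y) (absTr (y ⊗ z) ≟L ι i)))) ⟩
    𝟙 (0# ≟L ι i) + count (λ y → F*? y ×-dec (absTr (y ⊗ z) ≟L ι i)) ∎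
    where
    open ≡-Reasoning
    T0 : absTr (0# ⊗ z) ≡ 0#
    T0 = trans (cong absTr (R.zeroˡ z)) (tr-0 (2 * n))

-- Parity of d₁ + d₂

Even Odd : ℕ → Set
Even m = ∃ λ j → m ≡ 2 * j
Odd  m = ∃ λ j → m ≡ suc (2 * j)

even-or-odd : ∀ m → Even m ⊎ Odd m
even-or-odd zero    = inj₁ (0 , refl)
even-or-odd (suc m) with even-or-odd m
... | inj₁ (j , refl) = inj₂ (j , refl)
... | inj₂ (j , refl) = inj₁ (suc j , cong suc (sym (+-suc j (j + 0))))

even-odd-⊥ : ∀ {m} → Even m → Odd m → ⊥
even-odd-⊥ (j , refl) (j′ , e) = even≢odd j j′ e

odd-* : ∀ {m n} → Odd m → Odd n → Odd (m * n)
odd-* (i , refl) (j , refl) = i + j + 2 * i * j , lemma i j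
  where
  lemma : ∀ i j → suc (2 * i) * suc (2 * j) ≡ suc (2 * (i + j + 2 * i * j))
  lemma = solve-∀

odd-^ : ∀ {m} n → Odd m → Odd (m ^ n)
odd-^ zero    _ = 0 , refl
odd-^ (suc n) h = odd-* h (odd-^ n h)

even-suc : ∀ {m} → Odd m → Even (suc m)
even-suc {m} (j , refl) = suc j , cong suc (sym (+-suc j (j + 0)))

odd-divisor : ∀ {d m} → d ∣ m → Odd m → Odd d
odd-divisor {d} (divides c refl) h with even-or-odd d
... | inj₂ o = o
... | inj₁ (j , refl) = ⊥-elim (even-odd-⊥ (c * j , lemma c j) h)
  where
  lemma : ∀ c j → c * (2 * j) ≡ 2 * (c * j)
  lemma = solve-∀

even-gcd : ∀ {m n} → Even m → Even n → Even (gcd m n)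
even-gcd {m} {n} (i , ei) (j , ej) with gcd-greatest {m} {n} {2} (divides i (trans ei (*-comm 2 i))) (divides j (trans ej (*-comm 2 j)))
... | divides c e = c , trans e (*-comm c 2)

-- One of k - 1 and k is even, and for odd q only that one shares the factor 2 with q + 1.
gcd-sum-odd : ∀ k′ {q} → Odd q → Odd (gcd (suc k′) (suc q) + gcd k′ (suc q))
gcd-sum-odd k′ {q} hq with even-or-odd k′
... | inj₁ even-k′ = odd+even (odd-divisor (gcd[m,n]∣m (suc k′) (suc q)) (odd-suc even-k′)) (even-gcd even-k′ (even-suc hq))
  where
  odd-suc : ∀ {m} → Even m → Odd (suc m)
  odd-suc (j , e) = j , cong suc e
  odd+even : ∀ {m n} → Odd m → Even n → Odd (m + n)
  odd+even (i , refl) (j , refl) = i + j , cong suc (sym (*-distribˡ-+ 2 i j))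
... | inj₂ odd-k′ = even+odd (even-gcd (even-suc odd-k′) (even-suc hq)) (odd-divisor (gcd[m,n]∣m k′ (suc q)) odd-k′)
  where
  even+odd : ∀ {m n} → Even m → Odd n → Odd (m + n)
  even+odd (i , refl) (j , refl) = i + j , trans (+-suc (2 * i) (2 * j)) (cong suc (sym (*-distribˡ-+ 2 i j)))

embℤ-zero : ∀ {p} m (i : Fin p) → toℕ i ≡ 0 → embℤ m i ≡ m
embℤ-zero m Fin.zero _ = refl

embℤ-suc : ∀ {p} m (i : Fin p) → 0 < toℕ i → embℤ m i ≡ + 0
embℤ-suc m (Fin.suc i) _ = refl

-- The family of lines indexed by U, with k = k′ + 1

module NihoWeilSum (L : FiniteField) (p n : ℕ) (prime-p : Prime p) (0<n : 0 < n)
    (order≡ : FiniteField.order L ≡ p ^ (2 * n))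
    (k′ : ℕ) (coprime : gcd (suc (k′ + k′)) (suc (p ^ n)) ≡ 1) where

  open QuadraticExtension L p n prime-p 0<n order≡ public

  k : ℕ
  k = suc k′

  -- A point a ∈ L lies on the line of u ∈ U iff u is a root of u^{2k-1} - ā u^k - a u^{k-1} + 1.
  c : Carrier → Carrier
  c u = u ↑ k ⊕ conj u ↑ k′

  Inc : Carrier → Carrier → Set
  Inc a u = U u × a ⊕ conj a ⊗ u ≡ c u

  Inc? : ∀ a u → Dec (Inc a u)
  Inc? a u = U? u ×-dec (a ⊕ conj a ⊗ u ≟L c u)

  N : Carrier → ℕ
  N a = count (Inc? a)

  U-↑-inverse : ∀ {u} m → U u → u ↑ m ⊗ conj u ↑ m ≡ 1#
  U-↑-inverse {u} m hu = trans (sym (⊗-↑ u (conj u) m)) (trans (cong (_↑ m) hu) (1↑ m))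

  -- Both `c u` and a + ā u are fixed by z ↦ conj z · u, and the z fixed by this map form a line
  -- over F. So the equation of `Inc` is one condition over F, not two.
  conj-c : ∀ {u} → U u → c u ≡ conj (c u) ⊗ u
  conj-c {u} hu = trans
    (combine₁ (⊖ conj u ↑ k′) hu
      (solve 4 (λ u u′ J J′ → (u :* J :+ J′) :- (u′ :* J′ :+ J) :* u := (:- J′) :* (u :* u′ :- con (+ 1))) refl u (conj u) (u ↑ k′) (conj u ↑ k′)))
    (cong (_⊗ u) (sym (trans (conj-⊕ (u ↑ k) (conj u ↑ k′))
      (cong₂ _⊕_ (conj-↑ u k) (trans (conj-↑ (conj u) k′) (cong (_↑ k′) (conj-conj u)))))))

  -- The point u^k lies on the line. Subtracting it leaves b + conj b · u = 0, whose nonzero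
  -- solutions are the fibre b^{q-1} = -conj u. Its dependence on u is why no two lines are
  -- parallel.
  count-line : ∀ {u} → U u → count (λ a → Inc? a u) ≡ q
  count-line {u} hu = begin
    count (λ a → Inc? a u)                       ≡⟨ sym (∑-reindex (_⊕ u ↑ k) (_⊝ u ↑ k)
                                                      (λ x → solve 2 (λ x y → (x :+ y) :- y := x) refl x (u ↑ k))
                                                      (λ x → solve 2 (λ x y → (x :- y) :+ y := x) refl x (u ↑ k)) _) ⟩
    count (λ b → Inc? (b ⊕ u ↑ k) u)             ≡⟨ ∑-cong direction ⟩
    ∑[ b ] (𝟙 (b ≟L 0#) + 𝟙 (fibre? (⊖ conj u) b)) ≡⟨ ∑-+ _ _ ⟩
    count (_≟L 0#) + count (fibre? (⊖ conj u))   ≡⟨ cong₂ _+_ count-0 (count-fibre (U-⊖ (U-conj hu))) ⟩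
    suc r                                        ≡⟨ sym q≡1+r ⟩
    q                                            ∎
    where
    open ≡-Reasoning
    shift : ∀ b → (b ⊕ u ↑ k) ⊕ conj (b ⊕ u ↑ k) ⊗ u ≡ c u ⊕ (b ⊕ conj b ⊗ u)
    shift b = trans (cong (λ z → (b ⊕ u ↑ k) ⊕ z ⊗ u) (trans (conj-⊕ b (u ↑ k)) (cong (conj b ⊕_) (conj-↑ u k))))
      (combine₁ (conj u ↑ k′) hu
        (solve 6 (λ b b′ u u′ K J′ → ((b :+ K) :+ (b′ :+ u′ :* J′) :* u) :- ((K :+ J′) :+ (b :+ b′ :* u)) := J′ :* (u :* u′ :- con (+ 1)))
          refl b (conj b) u (conj u) (u ↑ k) (conj u ↑ k′)))
    to : ∀ {b} → b ≢ 0# → Inc (b ⊕ u ↑ k) u → ⊖ conj u ≡ b ↑ r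
    to {b} b≢0 (_ , h) = ⊗-cancelˡ b≢0 (combine₃ (⊖ conj u) (b ⊗ b ↑ r) (⊖ (conj u ⊗ u)) (trans (sym (shift b)) h) hu (sym (conj≡⊗ b))
      (solve 6 (λ b b′ u u′ g c → b :* (:- u′) :- b :* g
          := (:- u′) :* ((c :+ (b :+ b′ :* u)) :- c) :+ (b :* g) :* (u :* u′ :- con (+ 1)) :+ (:- (u′ :* u)) :* (b :* g :- b′))
        refl b (conj b) u (conj u) (b ↑ r) (c u)))
    from : ∀ {b} → ⊖ conj u ≡ b ↑ r → Inc (b ⊕ u ↑ k) u
    from {b} h = hu , trans (shift b) (combine₃ u (⊖ (b ⊗ u)) (⊖ b) (conj≡⊗ b) h hu
      (solve 6 (λ b b′ u u′ g c → (c :+ (b :+ b′ :* u)) :- c := u :* (b′ :- b :* g) :+ (:- (b :* u)) :* ((:- u′) :- g) :+ (:- b) :* (u :* u′ :- con (+ 1)))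
        refl b (conj b) u (conj u) (b ↑ r) (c u)))
    direction : ∀ b → 𝟙 (Inc? (b ⊕ u ↑ k) u) ≡ 𝟙 (b ≟L 0#) + 𝟙 (fibre? (⊖ conj u) b)
    direction b with b ≟L 0#
    ... | yes refl = 𝟙-yes (Inc? (0# ⊕ u ↑ k) u) (hu , trans (shift 0#) (trans (cong (λ z → c u ⊕ (0# ⊕ z ⊗ u)) conj-0)
            (solve 2 (λ c u → c :+ (con (+ 0) :+ con (+ 0) :* u) := c) refl (c u) u)))
    ... | no b≢0   = 𝟙-cong (Inc? (b ⊕ u ↑ k) u) (¬? (no b≢0) ×-dec (⊖ conj u ≟L b ↑ r)) (λ h → b≢0 , to b≢0 h) (from ∘ proj₂)

  meet-conj : ∀ {a u v} → Inc a u → Inc a v → conj a ⊗ (u ⊝ v) ≡ c u ⊝ c v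
  meet-conj {a} {u} {v} (_ , hu) (_ , hv) = combine₂ 1# (⊖ 1#) hu hv
    (solve 6 (λ a a′ u v cu cv → a′ :* (u :- v) :- (cu :- cv) := con (+ 1) :* ((a :+ a′ :* u) :- cu) :+ (:- con (+ 1)) :* ((a :+ a′ :* v) :- cv))
      refl a (conj a) u v (c u) (c v))

  ⊝≢0 : ∀ {u v} → u ≢ v → u ⊝ v ≢ 0#
  ⊝≢0 u≢v h = u≢v (⊝≡0⇒≡ h)

  meet-unique : ∀ {a b u v} → u ≢ v → Inc a u × Inc a v → Inc b u × Inc b v → a ≡ b
  meet-unique {a} {b} {u} {v} u≢v (hau , hav) (hbu , hbv) = trans (sym (conj-conj a)) (trans (cong conj
    (⊗-cancelˡ (⊝≢0 u≢v) (trans (R.*-comm _ _) (trans (meet-conj hau hav) (trans (sym (meet-conj hbu hbv)) (R.*-comm _ _))))))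
    (conj-conj b))

  -- Cramer's rule, with a and conj a treated as independent unknowns. `a′D` then checks, through
  -- `conj-c`, that the second unknown really is the conjugate of the first.
  meet : ∀ {u v} → U u → U v → u ≢ v → ∃ λ a → Inc a u × Inc a v
  meet {u} {v} hu hv u≢v with inverse (u ⊝ v) (⊝≢0 u≢v)
  ... | i , Di≡1 = a , (hu , on-u) , (hv , on-v)
    where
    D = u ⊝ v
    a = (u ⊗ c v ⊝ v ⊗ c u) ⊗ i
    aD : a ⊗ D ≡ u ⊗ c v ⊝ v ⊗ c u
    aD = combine₁ (u ⊗ c v ⊝ v ⊗ c u) Di≡1
      (solve 3 (λ z i D → (z :* i) :* D :- z := z :* (D :* i :- con (+ 1))) refl (u ⊗ c v ⊝ v ⊗ c u) i D)
    conj-aD : conj a ⊗ (conj u ⊝ conj v) ≡ conj u ⊗ conj (c v) ⊝ conj v ⊗ conj (c u)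
    conj-aD = trans (cong (conj a ⊗_) (sym (conj-⊝ u v))) (trans (sym (conj-⊗ a D)) (trans (cong conj aD)
      (trans (conj-⊝ (u ⊗ c v) (v ⊗ c u)) (cong₂ _⊝_ (conj-⊗ u (c v)) (conj-⊗ v (c u))))))
    a′D : conj a ⊗ D ≡ c u ⊝ c v
    a′D = trans (combine₃ (⊖ (u ⊗ v)) (v ⊗ conj a ⊝ v ⊗ conj (c v)) (u ⊗ conj (c u) ⊝ u ⊗ conj a) conj-aD hu hv
        (solve 7 (λ a′ u v u′ v′ x y → a′ :* (u :- v) :- (x :* u :- y :* v)
            := (:- (u :* v)) :* (a′ :* (u′ :- v′) :- (u′ :* y :- v′ :* x))
               :+ (v :* a′ :- v :* y) :* (u :* u′ :- con (+ 1))
               :+ (u :* x :- u :* a′) :* (v :* v′ :- con (+ 1)))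
          refl (conj a) u v (conj u) (conj v) (conj (c u)) (conj (c v))))
      (sym (cong₂ _⊝_ (conj-c hu) (conj-c hv)))
    on-u : a ⊕ conj a ⊗ u ≡ c u
    on-u = ⊗-cancelˡ (⊝≢0 u≢v) (combine₂ 1# u aD a′D
      (solve 6 (λ a a′ u v x y → (u :- v) :* (a :+ a′ :* u) :- (u :- v) :* x
          := con (+ 1) :* (a :* (u :- v) :- (u :* y :- v :* x)) :+ u :* (a′ :* (u :- v) :- (x :- y)))
        refl a (conj a) u v (c u) (c v)))
    on-v : a ⊕ conj a ⊗ v ≡ c v
    on-v = ⊗-cancelˡ (⊝≢0 u≢v) (combine₂ 1# v aD a′D
      (solve 6 (λ a a′ u v x y → (u :- v) :* (a :+ a′ :* v) :- (u :- v) :* y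
          := con (+ 1) :* (a :* (u :- v) :- (u :* y :- v :* x)) :+ v :* (a′ :* (u :- v) :- (x :- y)))
        refl a (conj a) u v (c u) (c v)))

  -- First and second moments of N

  ∑-N : ∑ N ≡ suc q * q
  ∑-N = begin
    ∑ N                                      ≡⟨ ∑-swap _ ⟩
    ∑[ u ] count (λ a → Inc? a u)            ≡⟨ ∑-cong (λ u → line u (U? u)) ⟩
    ∑[ u ] 𝟙 (U? u) * q                      ≡⟨ ∑-*ʳ q _ ⟩
    count U? * q                             ≡⟨ cong (_* q) count-U ⟩
    suc q * q                                ∎
    where
    open ≡-Reasoning
    line : ∀ u (d : Dec (U u)) → count (λ a → Inc? a u) ≡ 𝟙 d * q
    line u (yes hu) = trans (count-line hu) (sym (*-identityˡ q))
    line u (no ¬hu) = count-none (λ a → Inc? a u) (λ a h → ¬hu (proj₁ h))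

  pairs-U : pairs U? ≡ suc q * q
  pairs-U = +-cancelʳ-≡ (count U?) _ _ (trans (pairs+count U?) (trans (cong (λ m → m * m) count-U) (trans (lemma q) (cong (λ j → suc q * q + j) (sym count-U)))))
    where
    lemma : ∀ q → suc q * suc q ≡ suc q * q + suc q
    lemma = solve-∀

  -- Two distinct lines meet in exactly one point, so the sum counts the ordered pairs of distinct
  -- elements of U.
  ∑-pairs : ∑[ a ] pairs (Inc? a) ≡ suc q * q
  ∑-pairs = begin
    ∑[ a ] ∑[ u ] ∑[ v ] 𝟙 (pair? (Inc? a) u v)     ≡⟨ trans (∑-swap _) (∑-cong λ u → ∑-swap _) ⟩
    ∑[ u ] ∑[ v ] ∑[ a ] 𝟙 (pair? (Inc? a) u v)     ≡⟨ ∑-cong (λ u → ∑-cong λ v → point u v (pair? U? u v)) ⟩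
    pairs U?                                        ≡⟨ pairs-U ⟩
    suc q * q                                       ∎
    where
    open ≡-Reasoning
    point : ∀ u v (d : Dec (U u × (U v × u ≢ v))) → ∑[ a ] 𝟙 (pair? (Inc? a) u v) ≡ 𝟙 d
    point u v (yes (hu , hv , u≢v)) = at (meet hu hv u≢v)
      where
      at : (∃ λ a → Inc a u × Inc a v) → ∑[ a ] 𝟙 (pair? (Inc? a) u v) ≡ 1
      at (a , au , av) = count-one (λ a → pair? (Inc? a) u v) a (au , av , u≢v)
        (λ { b (bu , bv , _) → meet-unique u≢v (bu , bv) (au , av) })
    point u v (no ¬h) = count-none (λ a → pair? (Inc? a) u v) (λ { a ((hu , _) , ((hv , _) , u≢v)) → ¬h (hu , hv , u≢v) })

  -- This is 2k - 1, the degree in u of the line equation once conj u is cleared; `coprime` makes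
  -- its power map injective on U.
  m : ℕ
  m = suc (k′ + k′)

  ↑-m : ∀ u → u ↑ m ≡ u ⊗ (u ↑ k′ ⊗ u ↑ k′)
  ↑-m u = cong (u ⊗_) (↑-+ u k′ k′)

  ↑m-injective : ∀ {u v} → U u → U v → u ↑ m ≡ v ↑ m → u ≡ v
  ↑m-injective = ↑-injective-on-U m coprime

  -- N at the points of U and at 0

  on-unit⇒ : ∀ {v u} → U v → Inc v u → u ↑ k ≡ v ⊎ u ↑ k′ ≡ conj v
  on-unit⇒ {v} {u} hv (hu , h) = [ inj₁ ∘ ⊝≡0⇒≡ , inj₂ ∘ ⊝≡0⇒≡ ]′ (zero-product
    (combine₃ (⊖ u ↑ k′) (⊖ 1#) 1# h (U-↑-inverse k′ hu) hv
      (solve 5 (λ u v v′ J J′ → (u :* J :- v) :* (J :- v′) :- con (+ 0)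
          := (:- J) :* ((v :+ v′ :* u) :- (u :* J :+ J′)) :+ (:- con (+ 1)) :* (J :* J′ :- con (+ 1)) :+ con (+ 1) :* (v :* v′ :- con (+ 1)))
        refl u v (conj v) (u ↑ k′) (conj u ↑ k′))))

  on-unit⇐ : ∀ {v u} → U v → U u → u ↑ k ≡ v ⊎ u ↑ k′ ≡ conj v → Inc v u
  on-unit⇐ {v} {u} hv hu (inj₁ refl) = hu , trans (cong (λ z → u ↑ k ⊕ z ⊗ u) (conj-↑ u k))
    (combine₁ (conj u ↑ k′) hu (solve 4 (λ u u′ J J′ → (u :* J :+ (u′ :* J′) :* u) :- (u :* J :+ J′) := J′ :* (u :* u′ :- con (+ 1)))
      refl u (conj u) (u ↑ k′) (conj u ↑ k′)))
  on-unit⇐ {v} {u} hv hu (inj₂ J≡v′) = hu , combine₃ (⊖ u) (conj u ↑ k′) (⊖ v) J≡v′ hv J′v≡1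
      (solve 5 (λ u v v′ J J′ → (v :+ v′ :* u) :- (u :* J :+ J′)
          := (:- u) :* (J :- v′) :+ J′ :* (v :* v′ :- con (+ 1)) :+ (:- v) :* (J′ :* v′ :- con (+ 1)))
        refl u v (conj v) (u ↑ k′) (conj u ↑ k′))
    where
    J′v≡1 : conj u ↑ k′ ⊗ conj v ≡ 1#
    J′v≡1 = trans (cong (conj u ↑ k′ ⊗_) (sym J≡v′)) (trans (R.*-comm _ _) (U-↑-inverse k′ hu))

  N-unit : ∀ {v} → U v → N v + count (λ u → (U? u ×-dec (u ↑ k ≟L v)) ×-dec (U? u ×-dec (u ↑ k′ ≟L conj v)))
                       ≡ count (λ u → U? u ×-dec (u ↑ k ≟L v)) + count (λ u → U? u ×-dec (u ↑ k′ ≟L conj v))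
  N-unit {v} hv = trans (cong (_+ count (λ u → A? u ×-dec B? u)) (count-cong (Inc? v) (λ u → A? u ⊎-dec B? u)
      (λ u h → [ (λ e → inj₁ (proj₁ h , e)) , (λ e → inj₂ (proj₁ h , e)) ]′ (on-unit⇒ hv h))
      (λ { u (inj₁ (hu , e)) → on-unit⇐ hv hu (inj₁ e) ; u (inj₂ (hu , e)) → on-unit⇐ hv hu (inj₂ e) })))
    (trans (sym (∑-+ _ _)) (trans (∑-cong (λ u → 𝟙-⊎ (A? u) (B? u))) (∑-+ _ _)))
    where
    A? = λ u → U? u ×-dec (u ↑ k ≟L v)
    B? = λ u → U? u ×-dec (u ↑ k′ ≟L conj v)

  d₁ d₂ : ℕ
  d₁ = gcd k (suc q)
  d₂ = gcd k′ (suc q)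

  B : ℕ
  B = N 1#

  -- The solutions of u^k = 1 and those of u^{k-1} = 1 share only u = 1, which accounts for the
  -- correction by one.
  B+1 : B + 1 ≡ d₁ + d₂
  B+1 = begin
    B + 1  ≡⟨ cong (λ j → B + j) (sym (count-one _ 1# ((U-1 , 1↑ k) , (U-1 , trans (1↑ k′) (sym conj-1))) only-1)) ⟩
    _      ≡⟨ N-unit U-1 ⟩
    _      ≡⟨ cong₂ _+_ (trans (count-cong _ _ (λ u → λ { (hu , e) → hu , trans e (sym (1↑ k)) }) (λ u → λ { (hu , e) → hu , trans e (1↑ k) })) (count-↑-fibre k U-1))
                        (trans (count-cong _ _ (λ u → λ { (hu , e) → hu , trans e (trans conj-1 (sym (1↑ k′))) }) (λ u → λ { (hu , e) → hu , trans e (trans (1↑ k′) (sym conj-1)) })) (count-↑-fibre k′ U-1)) ⟩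
    d₁ + d₂ ∎
    where
    open ≡-Reasoning
    only-1 : ∀ u → (U u × u ↑ k ≡ 1#) × (U u × u ↑ k′ ≡ conj 1#) → u ≡ 1#
    only-1 u ((_ , e) , (_ , e′)) = combine₂ 1# (⊖ u) e (trans e′ conj-1)
      (solve 2 (λ u J → u :- con (+ 1) := con (+ 1) :* (u :* J :- con (+ 1)) :+ (:- u) :* (J :- con (+ 1))) refl u (u ↑ k′))

  -- A d₁d₂-th power is both a d₁-th and a d₂-th power, so u^k = v and u^{k-1} = conj v are both
  -- solvable in U. A common solution would be u = v², forcing v^{2k-1} = 1 and so v = 1.
  N-at-power : ∀ {w} → U w → w ↑ (d₁ * d₂) ≢ 1# → N (w ↑ (d₁ * d₂)) ≡ d₁ + d₂
  N-at-power {w} hw w≢1 = begin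
    N v                                                              ≡⟨ sym (+-identityʳ _) ⟩
    N v + 0                                                          ≡⟨ cong (λ j → N v + j) (sym (count-none _ disjoint)) ⟩
    _                                                                ≡⟨ N-unit hv ⟩
    _                                                                ≡⟨ cong₂ _+_ (first u₁ hu₁ e₁) (second u₂ hu₂ e₂) ⟩
    d₁ + d₂                                                          ∎
    where
    open ≡-Reasoning
    v = w ↑ (d₁ * d₂)
    hv : U v
    hv = U-↑ (d₁ * d₂) hw
    first : ∀ u₀ → U u₀ → u₀ ↑ k ≡ v → count (λ u → U? u ×-dec (u ↑ k ≟L v)) ≡ d₁
    first u₀ hu₀ e = trans (cong (λ z → count (λ u → U? u ×-dec (u ↑ k ≟L z))) (sym e)) (count-↑-fibre k hu₀)
    second : ∀ u₀ → U u₀ → u₀ ↑ k′ ≡ conj v → count (λ u → U? u ×-dec (u ↑ k′ ≟L conj v)) ≡ d₂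
    second u₀ hu₀ e = trans (cong (λ z → count (λ u → U? u ×-dec (u ↑ k′ ≟L z))) (sym e)) (count-↑-fibre k′ hu₀)
    root₁ = ↑gcd-image k (U-↑ d₂ hw)
    u₁ = proj₁ root₁
    hu₁ = proj₁ (proj₂ root₁)
    e₁ : u₁ ↑ k ≡ v
    e₁ = trans (proj₂ (proj₂ root₁)) (trans (sym (↑-* w d₂ d₁)) (cong (w ↑_) (*-comm d₂ d₁)))
    root₂ = ↑gcd-image k′ (U-↑ d₁ (U-conj hw))
    u₂ = proj₁ root₂
    hu₂ = proj₁ (proj₂ root₂)
    e₂ : u₂ ↑ k′ ≡ conj v
    e₂ = trans (proj₂ (proj₂ root₂)) (trans (sym (↑-* (conj w) d₁ d₂)) (sym (conj-↑ w (d₁ * d₂))))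
    disjoint : ∀ u → ¬ ((U u × u ↑ k ≡ v) × (U u × u ↑ k′ ≡ conj v))
    disjoint u ((hu , e) , (_ , e′)) = w≢1 (↑m-injective hv U-1 (trans v↑m≡1 (sym (1↑ m))))
      where
      u≡vv : u ≡ v ⊗ v
      u≡vv = combine₃ v (⊖ (u ⊗ v)) (⊖ u) e e′ hv
        (solve 4 (λ u v v′ J → u :- v :* v := v :* (u :* J :- v) :+ (:- (u :* v)) :* (J :- v′) :+ (:- u) :* (v :* v′ :- con (+ 1)))
          refl u v (conj v) (u ↑ k′))
      v↑m≡1 : v ↑ m ≡ 1#
      v↑m≡1 = begin
        v ↑ m                  ≡⟨ ↑-m v ⟩
        v ⊗ (v ↑ k′ ⊗ v ↑ k′)  ≡⟨ cong (v ⊗_) (sym (⊗-↑ v v k′)) ⟩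
        v ⊗ (v ⊗ v) ↑ k′       ≡⟨ cong (λ z → v ⊗ z ↑ k′) (sym u≡vv) ⟩
        v ⊗ u ↑ k′             ≡⟨ cong (v ⊗_) e′ ⟩
        v ⊗ conj v             ≡⟨ hv ⟩
        1#                     ∎

  -- At a = 0 the equation reads u^{2k-1} = -1, and -1 is a root because 2k - 1 is odd.
  N-0 : N 0# ≡ 1
  N-0 = count-one (Inc? 0#) (⊖ 1#) (U-⊖ U-1 , on-0) (λ u h → ↑m-injective (proj₁ h) (U-⊖ U-1) (trans (root h) (sym (root (U-⊖ U-1 , on-0)))))
    where
    conj-1- : conj (⊖ 1#) ≡ ⊖ 1#
    conj-1- = trans (conj-⊖ 1#) (cong ⊖_ conj-1)
    on-0 : 0# ⊕ conj 0# ⊗ ⊖ 1# ≡ c (⊖ 1#)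
    on-0 = trans (cong (λ z → 0# ⊕ z ⊗ ⊖ 1#) conj-0) (trans
      (solve 1 (λ J → con (+ 0) :+ con (+ 0) :* (:- con (+ 1)) := (:- con (+ 1)) :* J :+ J) refl ((⊖ 1#) ↑ k′))
      (cong (λ z → (⊖ 1#) ↑ k ⊕ z ↑ k′) (sym conj-1-)))
    root : ∀ {u} → Inc 0# u → u ↑ m ≡ ⊖ 1#
    root {u} (hu , h) = trans (↑-m u) (combine₃ (⊖ u ↑ k′) (u ↑ k′ ⊗ u) (⊖ 1#) h conj-0 (U-↑-inverse k′ hu)
      (solve 4 (λ u J J′ z → u :* (J :* J) :- (:- con (+ 1)) :=
         (:- J) :* ((con (+ 0) :+ z :* u) :- (u :* J :+ J′)) :+ (J :* u) :* (z :- con (+ 0)) :+ (:- con (+ 1)) :* (J :* J′ :- con (+ 1)))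
        refl u (u ↑ k′) (conj u ↑ k′) (conj 0#)))

  -- u^{2k-1} α = β is the condition for the lines of u, ur and ut to be concurrent.
  α β : Carrier → Carrier → Carrier
  α r t = (1# ⊝ r ↑ k) ⊗ (1# ⊝ t) ⊝ (1# ⊝ t ↑ k) ⊗ (1# ⊝ r)
  β r t = (1# ⊝ conj t ↑ k′) ⊗ (1# ⊝ r) ⊝ (1# ⊝ conj r ↑ k′) ⊗ (1# ⊝ t)

  c-⊗ : ∀ u r → c (u ⊗ r) ≡ u ↑ k ⊗ r ↑ k ⊕ conj u ↑ k′ ⊗ conj r ↑ k′
  c-⊗ u r = cong₂ _⊕_ (⊗-↑ u r k) (trans (cong (_↑ k′) (conj-⊗ u r)) (⊗-↑ (conj u) (conj r) k′))

  -- Concurrency makes the determinant with rows (1, 1, c(u)), (1, r, c(ur)), (1, t, c(ut)) vanish.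
  -- The first three multipliers are its cofactors t - r, 1 - t and r - 1, times u^{k-1} to clear
  -- the powers of conj u.
  concurrent : ∀ {a u r t} → Inc a u → Inc a (u ⊗ r) → Inc a (u ⊗ t) → u ↑ m ⊗ α r t ≡ β r t
  concurrent {a} {u} {r} {t} (hu , h) (_ , hr) (_ , ht) = trans (cong (_⊗ α r t) (↑-m u))
    (combine₄ (J ⊗ (t ⊝ r)) (J ⊗ (1# ⊝ t)) (⊖ (J ⊗ (1# ⊝ r))) (β r t)
      h (trans hr (c-⊗ u r)) (trans ht (c-⊗ u t)) (U-↑-inverse k′ hu)
      (solve 11 (λ a a′ u J J′ r R S t T Q →
          let A = (con (+ 1) :- R) :* (con (+ 1) :- t) :- (con (+ 1) :- T) :* (con (+ 1) :- r)
              Z = (con (+ 1) :- Q) :* (con (+ 1) :- r) :- (con (+ 1) :- S) :* (con (+ 1) :- t)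
          in (u :* (J :* J)) :* A :- Z
             := (J :* (t :- r)) :* ((a :+ a′ :* u) :- (u :* J :+ J′))
                :+ (J :* (con (+ 1) :- t)) :* ((a :+ a′ :* (u :* r)) :- ((u :* J) :* R :+ J′ :* S))
                :+ (:- (J :* (con (+ 1) :- r))) :* ((a :+ a′ :* (u :* t)) :- ((u :* J) :* T :+ J′ :* Q))
                :+ Z :* (J :* J′ :- con (+ 1)))
        refl a (conj a) u J J′ r (r ↑ k) (conj r ↑ k′) t (t ↑ k) (conj t ↑ k′)))
    where
    J = u ↑ k′
    J′ = conj u ↑ k′

  -- Conjugating (1 - r^k)(1 - t) = (1 - t^k)(1 - r) gives the same equation twisted by t^{k-1} : r^{k-1}.
  collinear : ∀ {r t} → U r → U t → 1# ≢ r → 1# ≢ t → r ≢ t → α r t ≡ 0# → Inc 1# r × Inc 1# t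
  collinear {r} {t} hr ht r≢1 t≢1 r≢t α≡0 with r ↑ k ≟L 1#
  ... | yes R≡1 = on-unit⇐ U-1 hr (inj₁ R≡1) , on-unit⇐ U-1 ht (inj₁ (sym (⊝≡0⇒≡ (⊗-cancelˡ (⊝≢0 r≢1)
          (combine₂ (⊖ 1#) (⊖ (1# ⊝ t)) α≡0 R≡1
            (solve 4 (λ r t R T → (con (+ 1) :- r) :* (con (+ 1) :- T) :- (con (+ 1) :- r) :* con (+ 0)
                := (:- con (+ 1)) :* (((con (+ 1) :- R) :* (con (+ 1) :- t) :- (con (+ 1) :- T) :* (con (+ 1) :- r)) :- con (+ 0))
                   :+ (:- (con (+ 1) :- t)) :* (R :- con (+ 1)))
              refl r t (r ↑ k) (t ↑ k)))))))
  ... | no R≢1 = on-unit⇐ U-1 hr (inj₂ (trans S≡1 (sym conj-1))) , on-unit⇐ U-1 ht (inj₂ (trans (sym S≡T) (trans S≡1 (sym conj-1))))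
    where
    S = r ↑ k′
    T = t ↑ k′
    X≢0 : (1# ⊝ r ⊗ S) ⊗ (1# ⊝ t) ≢ 0#
    X≢0 = ⊗≢0 (⊝≢0 (R≢1 ∘ sym)) (⊝≢0 t≢1)
    conj-1⊝ : ∀ x → conj (1# ⊝ x) ≡ 1# ⊝ conj x
    conj-1⊝ x = trans (conj-⊝ 1# x) (cong (_⊝ conj x) conj-1)
    αbar : (1# ⊝ conj (r ↑ k)) ⊗ (1# ⊝ conj t) ≡ (1# ⊝ conj (t ↑ k)) ⊗ (1# ⊝ conj r)
    αbar = trans (sym (trans (conj-⊗ _ _) (cong₂ _⊗_ (conj-1⊝ (r ↑ k)) (conj-1⊝ t))))
      (trans (cong conj (⊝≡0⇒≡ α≡0)) (trans (conj-⊗ _ _) (cong₂ _⊗_ (conj-1⊝ (t ↑ k)) (conj-1⊝ r))))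
    -- On U one has x(1 - conj x) = -(1 - x), so the factor xy undoes the conjugation in both
    -- brackets and the two signs cancel.
    clear : ∀ {x y} z → U x → U y → ((1# ⊝ conj x) ⊗ (1# ⊝ conj y)) ⊗ ((x ⊗ y) ⊗ z) ≡ ((1# ⊝ x) ⊗ (1# ⊝ y)) ⊗ z
    clear {x} {y} z hx hy = combine₂ (⊖ ((1# ⊝ conj y) ⊗ y ⊗ z)) ((x ⊝ 1#) ⊗ (⊖ 1#) ⊗ z) hx hy
      (solve 5 (λ x y z x′ y′ → ((con (+ 1) :- x′) :* (con (+ 1) :- y′)) :* ((x :* y) :* z) :- ((con (+ 1) :- x) :* (con (+ 1) :- y)) :* z
         := (:- ((con (+ 1) :- y′) :* y :* z)) :* (x :* x′ :- con (+ 1)) :+ ((x :- con (+ 1)) :* (:- con (+ 1)) :* z) :* (y :* y′ :- con (+ 1)))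
        refl x y z (conj x) (conj y))
    twisted : ((1# ⊝ r ↑ k) ⊗ (1# ⊝ t)) ⊗ (t ↑ k ⊗ r) ≡ ((1# ⊝ t ↑ k) ⊗ (1# ⊝ r)) ⊗ (r ↑ k ⊗ t)
    twisted = trans (sym (clear (t ↑ k ⊗ r) (U-↑ k hr) ht)) (trans (cong₂ _⊗_ αbar (R.*-comm _ _)) (clear (r ↑ k ⊗ t) (U-↑ k ht) hr))
    S≡T : S ≡ T
    S≡T = sym (⊗-cancelˡ (⊗≢0 (U≢0 ht) (U≢0 hr)) (⊗-cancelˡ X≢0
      (combine₂ 1# (⊖ (r ⊗ S ⊗ t)) twisted α≡0
        (solve 4 (λ r t S T → ((con (+ 1) :- r :* S) :* (con (+ 1) :- t)) :* ((t :* r) :* T) :- ((con (+ 1) :- r :* S) :* (con (+ 1) :- t)) :* ((t :* r) :* S)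
            := con (+ 1) :* (((con (+ 1) :- r :* S) :* (con (+ 1) :- t)) :* ((t :* T) :* r) :- ((con (+ 1) :- t :* T) :* (con (+ 1) :- r)) :* ((r :* S) :* t))
               :+ (:- (r :* S :* t)) :* (((con (+ 1) :- r :* S) :* (con (+ 1) :- t) :- (con (+ 1) :- t :* T) :* (con (+ 1) :- r)) :- con (+ 0)))
          refl r t S T))))
    -- Once S = T, the quantity `α r t` collapses to (r - t)(1 - S).
    S≡1 : S ≡ 1#
    S≡1 = sym (⊝≡0⇒≡ (⊗-cancelˡ (⊝≢0 r≢t) (combine₂ 1# (t ⊗ (1# ⊝ r)) α≡0 S≡T
      (solve 4 (λ r t S T → (r :- t) :* (con (+ 1) :- S) :- (r :- t) :* con (+ 0)
          := con (+ 1) :* (((con (+ 1) :- r :* S) :* (con (+ 1) :- t) :- (con (+ 1) :- t :* T) :* (con (+ 1) :- r)) :- con (+ 0))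
             :+ (t :* (con (+ 1) :- r)) :* (S :- T))
        refl r t S T))))

  -- Bound for the third moment

  V? : ∀ x → Dec (U x × 1# ≢ x)
  V? x = U? x ×-dec ¬? (1# ≟L x)

  R? : ∀ x → Dec (Inc 1# x × 1# ≢ x)
  R? x = Inc? 1# x ×-dec ¬? (1# ≟L x)

  -- Triples are sorted by their ratios r and t, which are distinct elements of U other than 1. If α
  -- ≠ 0, at most one u remains. By `collinear`, α = 0 only when both ratios satisfy `R?`; there the
  -- trivial bound of q + 1 values of u is used, split as 1 + q.
  ∑-triples≤ : ∑[ a ] triples (Inc? a) ≤ pairs V? + pairs R? * q
  ∑-triples≤ = begin
    ∑[ a ] triples (Inc? a)                                             ≡⟨ ∑-cong (λ a → ∑-cong λ u → rescale a u) ⟩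
    ∑[ a ] ∑[ u ] ∑[ r ] ∑[ t ] f a u r t                               ≡⟨ ∑-cong (λ a → trans (∑-swap _) (∑-cong λ r → ∑-swap _)) ⟩
    ∑[ a ] ∑[ r ] ∑[ t ] ∑[ u ] f a u r t                               ≡⟨ trans (∑-swap _) (∑-cong λ r → ∑-swap _) ⟩
    ∑[ r ] ∑[ t ] ∑[ a ] ∑[ u ] f a u r t                               ≡⟨ ∑-cong (λ r → ∑-cong λ t → ∑-swap _) ⟩
    ∑[ r ] ∑[ t ] ∑[ u ] ∑[ a ] f a u r t                               ≤⟨ ∑-mono (λ r → ∑-mono λ t → bound r t (pair? V? r t) (pair? R? r t)) ⟩
    ∑[ r ] ∑[ t ] (𝟙 (pair? V? r t) + 𝟙 (pair? R? r t) * q)             ≡⟨ trans (∑-cong (λ r → trans (∑-+ _ _) (cong (λ j → ∑ (λ t → 𝟙 (pair? V? r t)) + j) (∑-*ʳ q _)))) (trans (∑-+ _ _) (cong (λ j → pairs V? + j) (∑-*ʳ q _))) ⟩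
    pairs V? + pairs R? * q                                             ∎
    where
    open ≤-Reasoning
    f : Carrier → Carrier → Carrier → Carrier → ℕ
    f a u r t = 𝟙 (triple? (Inc? a) u (u ⊗ r) (u ⊗ t))
    rescale : ∀ a u → ∑[ v ] ∑[ w ] 𝟙 (triple? (Inc? a) u v w) ≡ ∑[ r ] ∑[ t ] f a u r t
    rescale a u = go (U? u)
      where
      vanish : ¬ U u → (g : Carrier → Carrier) → ∑[ v ] ∑[ w ] 𝟙 (triple? (Inc? a) u (g v) (g w)) ≡ 0
      vanish ¬hu g = trans (∑-cong (λ v → count-none (λ w → triple? (Inc? a) u (g v) (g w)) (λ w h → ¬hu (proj₁ (proj₁ h))))) ∑-zero
      go : Dec (U u) → ∑[ v ] ∑[ w ] 𝟙 (triple? (Inc? a) u v w) ≡ ∑[ r ] ∑[ t ] f a u r t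
      go (no ¬hu) = trans (vanish ¬hu id) (sym (vanish ¬hu (u ⊗_)))
      go (yes hu) = sym (trans (∑-cong (λ r → U-⊗-reindex hu (λ w → 𝟙 (triple? (Inc? a) u (u ⊗ r) w))))
                     (U-⊗-reindex hu (λ v → ∑[ w ] 𝟙 (triple? (Inc? a) u v w))))
    one-point : ∀ {u v w} → u ≢ v → count (λ a → triple? (Inc? a) u v w) ≤ 1
    one-point {u} {v} {w} u≢v = count≤1 (λ a → triple? (Inc? a) u v w)
      (λ { a b (au , (av , _) , _) (bu , (bv , _) , _) → meet-unique u≢v (au , av) (bu , bv) })
    directions : ∀ {a u r t} → Inc a u × ((Inc a (u ⊗ r) × u ≢ u ⊗ r) × ((Inc a (u ⊗ t) × u ≢ u ⊗ t) × u ⊗ r ≢ u ⊗ t)) →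
                 (U r × 1# ≢ r) × ((U t × 1# ≢ t) × r ≢ t)
    directions {a} {u} ((hu , _) , (((hur , _) , u≢ur) , (((hut , _) , u≢ut) , ur≢ut))) =
      (U-cofactor hu hur , λ { refl → u≢ur (sym (R.*-identityʳ u)) })
      , (U-cofactor hu hut , λ { refl → u≢ut (sym (R.*-identityʳ u)) })
      , λ { refl → ur≢ut refl }
    bound : ∀ r t (d : Dec ((U r × 1# ≢ r) × ((U t × 1# ≢ t) × r ≢ t))) (e : Dec ((Inc 1# r × 1# ≢ r) × ((Inc 1# t × 1# ≢ t) × r ≢ t))) →
            ∑[ u ] ∑[ a ] f a u r t ≤ 𝟙 d + 𝟙 e * q
    bound r t (no ¬d) e = ≤-trans (≤-reflexive (trans (∑-cong (λ u →
      count-none (λ a → triple? (Inc? a) u (u ⊗ r) (u ⊗ t)) (λ a h → ¬d (directions h)))) ∑-zero)) z≤n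
    bound r t (yes ((hr , 1≢r) , _)) (yes _) = begin
      ∑[ u ] ∑[ a ] f a u r t   ≤⟨ ∑-mono (λ u → per-u u (U? u)) ⟩
      count U?                  ≡⟨ trans count-U (cong suc (sym (+-identityʳ q))) ⟩
      1 + 1 * q                 ∎
      where
      per-u : ∀ u (d : Dec (U u)) → ∑[ a ] f a u r t ≤ 𝟙 d
      per-u u (yes hu) = one-point (λ h → 1≢r (⊗-cancelˡ (U≢0 hu) (trans (R.*-identityʳ u) h)))
      per-u u (no ¬hu) = ≤-reflexive (count-none (λ a → triple? (Inc? a) u (u ⊗ r) (u ⊗ t)) (λ a h → ¬hu (proj₁ (proj₁ h))))
    bound r t (yes ((hr , 1≢r) , ((ht , 1≢t) , r≢t))) (no ¬e) = begin
      ∑[ u ] ∑[ a ] f a u r t                                       ≤⟨ ∑-mono per-u ⟩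
      count (λ u → U? u ×-dec (u ↑ m ⊗ α r t ≟L β r t))             ≤⟨ count≤1 _ (λ u v hu hv → ↑m-injective (proj₁ hu) (proj₁ hv)
                                                                       (⊗-cancelˡ α≢0 (trans (R.*-comm _ _) (trans (proj₂ hu) (trans (sym (proj₂ hv)) (R.*-comm _ _)))))) ⟩
      1                                                             ≤⟨ m≤m+n 1 _ ⟩
      1 + 0 * q                                                     ∎
      where
      α≢0 : α r t ≢ 0#
      α≢0 h = ¬e ((proj₁ both , 1≢r) , ((proj₂ both , 1≢t) , r≢t))
        where both = collinear hr ht 1≢r 1≢t r≢t h
      per-u : ∀ u → ∑[ a ] f a u r t ≤ 𝟙 (U? u ×-dec (u ↑ m ⊗ α r t ≟L β r t))
      per-u u with U? u ×-dec (u ↑ m ⊗ α r t ≟L β r t)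
      ... | yes (hu , _) = one-point (λ h → 1≢r (⊗-cancelˡ (U≢0 hu) (trans (R.*-identityʳ u) h)))
      ... | no ¬h        = ≤-reflexive (count-none (λ a → triple? (Inc? a) u (u ⊗ r) (u ⊗ t))
                             (λ { a (iu , (ir , _) , ((it , _) , _)) → ¬h (proj₁ iu , concurrent iu ir it) }))

  N≤q+1 : ∀ a → N a ≤ suc q
  N≤q+1 a = ≤-trans (∑-mono (λ u → 𝟙-mono (Inc? a u) (U? u) proj₁)) (≤-reflexive count-U)

  ∑-N² : ∑[ a ] N a * N a ≡ 2 * (suc q * q)
  ∑-N² = trans (∑-cong (λ a → sym (pairs+count (Inc? a)))) (trans (∑-+ _ _) (trans (cong₂ _+_ ∑-pairs ∑-N) (lemma (suc q * q))))
    where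
    lemma : ∀ x → x + x ≡ 2 * x
    lemma = solve-∀

  -- The values 0 and 1 of N, and a value from 2 to B - 1

  module _ (4≤B : 4 ≤ B) (B≤q : B ≤ q) where

    -- Otherwise ∑ (q + 1 - N)(N - 1) = 0 has non-negative terms and a positive one at a = 1.
    exists-N≡0 : ∃ λ a → N a ≡ 0
    exists-N≡0 = [ id , (λ none → ⊥-elim (impossible none)) ]′ (search (λ a → N a ≟ 0))
      where
      module _ (none : ∀ a → ¬ N a ≡ 0) where
        expand : ∀ x y → suc (suc x + y) * suc x ≡ (suc x * suc x + (suc x + y)) + x * y
        expand = solve-∀
        difference : ∀ {x q′} → 1 ≤ x → x ≤ q′ → suc q′ * x ≡ (x * x + q′) + (x ∸ 1) * (q′ ∸ x)
        difference {suc x} {q′} (s≤s z≤n) x≤q′ = subst (λ z → suc z * suc x ≡ (suc x * suc x + z) + x * (q′ ∸ suc x))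
          (m+[n∸m]≡n x≤q′) (expand x (q′ ∸ suc x))
        at : ∀ a → suc (suc q) * N a ≡ (N a * N a + suc q) + (N a ∸ 1) * (suc q ∸ N a)
        at a = difference (n≢0⇒n>0 (none a)) (N≤q+1 a)
        sums : ∑[ a ] suc (suc q) * N a ≤ ∑[ a ] (N a * N a + suc q)
        sums = ≤-reflexive (begin
          ∑[ a ] suc (suc q) * N a                     ≡⟨ trans (∑-*ˡ (suc (suc q)) N) (cong (suc (suc q) *_) ∑-N) ⟩
          suc (suc q) * (suc q * q)                    ≡⟨ lemma q ⟩
          2 * (suc q * q) + (q * q) * suc q            ≡⟨ sym (cong₂ _+_ ∑-N² (trans (∑-const (suc q)) (cong (_* suc q) order≡q*q))) ⟩
          (∑[ a ] N a * N a) + (∑[ a ] suc q)          ≡⟨ sym (∑-+ _ _) ⟩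
          ∑[ a ] (N a * N a + suc q)                   ∎)
          where
          open ≡-Reasoning
          lemma : ∀ q → suc (suc q) * (suc q * q) ≡ 2 * (suc q * q) + (q * q) * suc q
          lemma = solve-∀
        product≡0 : (B ∸ 1) * (suc q ∸ B) ≡ 0
        product≡0 = m+n≡m⇒n≡0 (trans (sym (at 1#)) (sym (∑-pigeon (λ a → ≤-trans (m≤m+n _ _) (≤-reflexive (sym (at a)))) sums 1#)))
          where
          m+n≡m⇒n≡0 : ∀ {m n} → m + n ≡ m → n ≡ 0
          m+n≡m⇒n≡0 {m} {n} h = +-cancelˡ-≡ m n 0 (trans h (sym (+-identityʳ m)))
        impossible : ⊥
        impossible = [ (λ h → <⇒≢ (m<n⇒0<n∸m {1} {B} (≤-trans (s≤s (s≤s z≤n)) 4≤B)) (sym h)) , (λ h → <⇒≢ (m<n⇒0<n∸m (s≤s B≤q)) (sym h)) ]′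
          (m*n≡0⇒m≡0∨n≡0 (B ∸ 1) product≡0)

    -- Otherwise ∑ (N - 1)² = q² is exceeded, the summands at a ≠ 0 being at least 1 and that at a = 1 at least 9.
    exists-N≡1 : ∃ λ a → a ≢ 0# × N a ≡ 1
    exists-N≡1 = [ id , (λ none → ⊥-elim (impossible none)) ]′ (search (λ a → ¬? (a ≟L 0#) ×-dec (N a ≟ 1)))
      where
      module _ (none : ∀ a → ¬ (a ≢ 0# × N a ≡ 1)) where
        x²≥2x : ∀ {x} → x ≢ 1 → 2 * x ≤ x * x
        x²≥2x {zero}        _   = z≤n
        x²≥2x {suc zero}    x≢1 = ⊥-elim (x≢1 refl)
        x²≥2x {suc (suc x)} _   = *-monoˡ-≤ (suc (suc x)) (s≤s (s≤s (z≤n {x})))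
        -- Here N² - 2N = (N - 1)² - 1 is -1 at a = 0, at least 8 = 4² - 2·4 at a = 1, and at least
        -- 0 at every other point where N ≠ 1.
        bound : ∀ a → 2 * N a + 𝟙 (a ≟L 1#) * 8 ≤ N a * N a + 𝟙 (a ≟L 0#)
        bound a with a ≟L 1# | a ≟L 0#
        ... | yes refl | yes 1≡0  = ⊥-elim (1≢0 1≡0)
        ... | yes refl | no _     = ≤-trans (square 4≤B) (m≤m+n _ 0)
          where
          square : ∀ {x} → 4 ≤ x → 2 * x + 8 ≤ x * x
          square {suc (suc (suc (suc x)))} _ = ≤-trans (m≤m+n _ (x * x + 6 * x)) (≤-reflexive (lemma x))
            where
            lemma : ∀ x → (2 * (4 + x) + 8) + (x * x + 6 * x) ≡ (4 + x) * (4 + x)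
            lemma = solve-∀
          square {suc (suc (suc zero))} (s≤s (s≤s (s≤s ())))
          square {suc (suc zero)} (s≤s (s≤s ()))
          square {suc zero} (s≤s ())
        ... | no _     | yes refl = ≤-trans (≤-reflexive (+-identityʳ (2 * N 0#))) (subst (λ x → 2 * x ≤ x * x + 1) (sym N-0) ≤-refl)
        ... | no _     | no a≢0   = ≤-trans (≤-reflexive (+-identityʳ (2 * N a))) (≤-trans (x²≥2x (λ h → none a (a≢0 , h))) (m≤m+n _ 0))
        impossible : ⊥
        impossible = <⇒≱ {1} {8} (s≤s (s≤s z≤n)) (+-cancelˡ-≤ (2 * (suc q * q)) 8 1 (begin
          2 * (suc q * q) + 8                                    ≡⟨ sym (cong₂ _+_ (trans (∑-*ˡ 2 N) (cong (2 *_) ∑-N)) (∑-point 1# (λ _ → 8))) ⟩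
          (∑[ a ] 2 * N a) + (∑[ a ] 𝟙 (a ≟L 1#) * 8)            ≡⟨ sym (∑-+ _ _) ⟩
          ∑[ a ] (2 * N a + 𝟙 (a ≟L 1#) * 8)                     ≤⟨ ∑-mono bound ⟩
          ∑[ a ] (N a * N a + 𝟙 (a ≟L 0#))                       ≡⟨ ∑-+ _ _ ⟩
          (∑[ a ] N a * N a) + count (_≟L 0#)                    ≡⟨ cong₂ _+_ ∑-N² count-0 ⟩
          2 * (suc q * q) + 1                                    ∎))
          where open ≤-Reasoning

    -- Otherwise N (N - 1) (N - B) ≥ 0 everywhere, against the first three moments.
    exists-2≤N<B : ∃ λ a → 2 ≤ N a × N a < B
    exists-2≤N<B = [ id , (λ none → ⊥-elim (impossible none)) ]′ (search (λ a → (2 ≤? N a) ×-dec (N a <? B)))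
      where
      module _ (none : ∀ a → ¬ (2 ≤ N a × N a < B)) where
        few-pairs : ∀ a → N a < 2 → pairs (Inc? a) ≡ 0
        few-pairs a N<2 = +-cancelʳ-≡ (N a) _ 0 (trans (pairs+count (Inc? a)) (idem N<2))
          where
          idem : ∀ {x} → x < 2 → x * x ≡ x
          idem {zero} _ = refl
          idem {suc zero} _ = refl
          idem {suc (suc x)} (s≤s (s≤s ()))
        bound : ∀ a → pairs (Inc? a) * B ≤ triples (Inc? a) + 2 * pairs (Inc? a)
        bound a with 2 ≤? N a
        ... | yes 2≤N = ≤-trans (*-monoʳ-≤ (pairs (Inc? a)) (≮⇒≥ (λ N<B → none a (2≤N , N<B)))) (≤-reflexive (sym (triples+2pairs (Inc? a))))
        ... | no  2≰N = ≤-trans (≤-reflexive (cong (_* B) (few-pairs a (≰⇒> 2≰N)))) z≤n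
        total : (suc q * q) * B ≤ (pairs V? + pairs R? * q) + 2 * (suc q * q)
        total = begin
          (suc q * q) * B                                          ≡⟨ sym (trans (∑-*ʳ B _) (cong (_* B) ∑-pairs)) ⟩
          ∑[ a ] pairs (Inc? a) * B                                ≤⟨ ∑-mono bound ⟩
          ∑[ a ] (triples (Inc? a) + 2 * pairs (Inc? a))           ≡⟨ trans (∑-+ _ _) (cong (λ j → (∑[ a ] triples (Inc? a)) + j) (trans (∑-*ˡ 2 _) (cong (2 *_) ∑-pairs))) ⟩
          (∑[ a ] triples (Inc? a)) + 2 * (suc q * q)              ≤⟨ +-monoˡ-≤ _ ∑-triples≤ ⟩
          (pairs V? + pairs R? * q) + 2 * (suc q * q)              ∎
          where open ≤-Reasoning
        count-V : count V? ≡ q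
        count-V = suc-injective (trans (count-others U? 1# U-1) count-U)
        count-R : suc (count R?) ≡ B
        count-R = count-others (Inc? 1#) 1# (on-unit⇐ U-1 U-1 (inj₁ (1↑ k)))
        -- Used with b = B - 1, X = q(q - 1) and Y = b(b - 1); adding q + bq to both sides turns X
        -- and Yq into q² and b²q.
        contradiction : ∀ X Y b q → 3 ≤ b → b < q → X + q ≡ q * q → Y + b ≡ b * b →
                        (suc q * q) * suc b ≤ (X + Y * q) + 2 * (suc q * q) → ⊥
        contradiction X Y b q 3≤b b<q eX eY h = m+1+n≰m rhs (≤-trans (≤-reflexive (sym identity)) (begin
          (suc q * q) * suc b + (q + b * q)                     ≤⟨ +-monoˡ-≤ (q + b * q) h ⟩
          ((X + Y * q) + 2 * (suc q * q)) + (q + b * q)         ≡⟨ regroup X Y b q ⟩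
          (X + q) + (Y + b) * q + 2 * (suc q * q)               ≡⟨ cong₂ (λ x y → x + y * q + 2 * (suc q * q)) eX eY ⟩
          rhs                                                   ∎))
          where
          open ≤-Reasoning
          rhs = q * q + (b * b) * q + 2 * (suc q * q)
          regroup : ∀ X Y b q → ((X + Y * q) + 2 * (suc q * q)) + (q + b * q) ≡ (X + q) + (Y + b) * q + 2 * (suc q * q)
          regroup = solve-∀
          b′ = b ∸ 3
          e = q ∸ suc b
          -- With b = 3 + b′ and q = b + 1 + e the gap between the two sides is q(b′ + 1)(e + 1),
          -- written here as a successor.
          polynomial : ∀ b′ e → let b = 3 + b′ ; q = suc b + e in
            (suc q * q) * suc b + (q + b * q) ≡ (q * q + (b * b) * q + 2 * (suc q * q)) + suc ((suc b + e) * (b′ + e + b′ * e) + (b + e))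
          polynomial = solve-∀
          identity : (suc q * q) * suc b + (q + b * q) ≡ rhs + suc (q * (b′ + e + b′ * e) + (b + e))
          identity = subst₂ (λ b q → (suc q * q) * suc b + (q + b * q) ≡ (q * q + (b * b) * q + 2 * (suc q * q)) + suc (q * (b′ + e + b′ * e) + (b + e)))
            (m+[n∸m]≡n 3≤b) (trans (cong (λ z → suc z + e) (m+[n∸m]≡n 3≤b)) (m+[n∸m]≡n b<q)) (polynomial b′ e)
        impossible : ⊥
        impossible = contradiction (pairs V?) (pairs R?) (count R?) q
          (s≤s⁻¹ (subst (4 ≤_) (sym count-R) 4≤B)) (subst (_≤ q) (sym count-R) B≤q)
          (subst (λ v → pairs V? + v ≡ v * v) count-V (pairs+count V?)) (pairs+count R?)
          (subst (λ B → (suc q * q) * B ≤ (pairs V? + pairs R? * q) + 2 * (suc q * q)) (sym count-R) total)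

  -- Niho's formula: from N to the coefficients of the Weil sum

  g : Carrier → Carrier → Carrier
  g a x = x ↑ suc (k * r) ⊝ a ⊗ x

  ↑s : ∀ x → x ↑ suc (k * r) ≡ x ⊗ (x ↑ r) ↑ k
  ↑s x = cong (x ⊗_) (trans (↑-* x k r) (↑-comm x k r))

  -- As s ≡ 1 modulo q - 1, the power y^s is y for y ∈ F*; this homogeneity is what permits
  -- averaging over F*.
  g-scale : ∀ {y} a x → F* y → g a (y ⊗ x) ≡ y ⊗ g a x
  g-scale {y} a x hy = combine₂ 1# (x ↑ s) (⊗-↑ y x s) y↑s
    (solve 6 (λ e a y x ys xs → (e :- a :* (y :* x)) :- y :* (xs :- a :* x)
        := con (+ 1) :* (e :- ys :* xs) :+ xs :* (ys :- y))
      refl ((y ⊗ x) ↑ s) a y x (y ↑ s) (x ↑ s))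
    where
    s = suc (k * r)
    y↑s : y ↑ s ≡ y
    y↑s = trans (↑s y) (trans (cong (λ z → y ⊗ z ↑ k) (F*-↑r hy)) (trans (cong (y ⊗_) (1↑ k)) (R.*-identityʳ y)))

  -- Put u = x^{q-1}, so that conj x = xu and x^s = x u^k. The relative trace then vanishes exactly
  -- when a lies on the line of u.
  relTr-g : ∀ a {x} → x ≢ 0# → relTr (g a x) ≡ x ⊗ (c (x ↑ r) ⊝ (a ⊕ conj a ⊗ x ↑ r))
  relTr-g a {x} x≢0 = trans (cong (λ z → g a x ⊕ z) (trans (conj-⊝ (x ↑ suc (k * r)) (a ⊗ x)) (cong₂ _⊝_ conj-power (conj-⊗ a x))))
    (combine₃ 1# (⊖ conj a) (x ⊗ J′) (↑s x) (conj≡⊗ x) (↑r-U x≢0)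
      (solve 9 (λ e a a′ x x′ u u′ K J′ →
          ((e :- a :* x) :+ ((x :* u) :* (u′ :* J′) :- a′ :* x′)) :- x :* ((K :+ J′) :- (a :+ a′ :* u))
          := con (+ 1) :* (e :- x :* K) :+ (:- a′) :* (x′ :- x :* u) :+ (x :* J′) :* (u :* u′ :- con (+ 1)))
        refl (x ↑ suc (k * r)) a (conj a) x (conj x) (x ↑ r) (conj (x ↑ r)) ((x ↑ r) ↑ k) J′))
    where
    J′ = conj (x ↑ r) ↑ k′
    conj-power : conj (x ↑ suc (k * r)) ≡ (x ⊗ x ↑ r) ⊗ (conj (x ↑ r) ⊗ J′)
    conj-power = trans (cong conj (↑s x)) (trans (conj-⊗ x _) (cong₂ _⊗_ (conj≡⊗ x) (conj-↑ (x ↑ r) k)))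

  count-relTr-zeros : ∀ a → count (λ x → relTr (g a x) ≟L 0#) ≡ 1 + r * N a
  count-relTr-zeros a = begin
    count (λ x → relTr (g a x) ≟L 0#)                              ≡⟨ ∑-cong (λ x → split x (x ≟L 0#)) ⟩
    ∑[ x ] (𝟙 (x ≟L 0#) + 𝟙 (¬? (x ≟L 0#)) * 𝟙 (Inc? a (x ↑ r)))   ≡⟨ ∑-+ _ _ ⟩
    count (_≟L 0#) + (∑[ x ] 𝟙 (¬? (x ≟L 0#)) * 𝟙 (Inc? a (x ↑ r))) ≡⟨ cong₂ _+_ count-0 (∑-via-↑r (λ u → 𝟙 (Inc? a u)) (λ u ¬hu → 𝟙-no (Inc? a u) (¬hu ∘ proj₁))) ⟩
    1 + r * N a                                                    ∎
    where
    open ≡-Reasoning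
    at-0 : relTr (g a 0#) ≡ 0#
    at-0 = trans (cong relTr (trans (cong₂ _⊝_ (R.zeroˡ _) (R.zeroʳ a)) (x⊝x 0#))) (trans (cong (0# ⊕_) conj-0) (R.+-identityʳ 0#))
    split : ∀ x (d : Dec (x ≡ 0#)) → 𝟙 (relTr (g a x) ≟L 0#) ≡ 𝟙 d + 𝟙 (¬? d) * 𝟙 (Inc? a (x ↑ r))
    split x (yes refl) = 𝟙-yes (relTr (g a 0#) ≟L 0#) at-0
    split x (no x≢0)   = trans (𝟙-cong _ (Inc? a (x ↑ r)) to from) (sym (+-identityʳ _))
      where
      to : relTr (g a x) ≡ 0# → Inc a (x ↑ r)
      to h = ↑r-U x≢0 , sym (⊝≡0⇒≡ ([ ⊥-elim ∘ x≢0 , id ]′ (zero-product (trans (sym (relTr-g a x≢0)) h))))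
      from : Inc a (x ↑ r) → relTr (g a x) ≡ 0#
      from (_ , h) = trans (relTr-g a x≢0) (trans (cong (x ⊗_) (≡⇒⊝≡0 (sym h))) (R.zeroʳ x))

  -- The coefficient of ζ^i in W(a), as `W-coefficient` shows.
  coefficient : ℕ → Carrier → ℕ
  coefficient i a = count (λ x → absTr (g a x) ≟L ι i)

  -- Averaging over x ↦ y x for y ∈ F*.
  r*coefficient : ∀ i a → r * coefficient i a ≡ ∑[ x ] count (λ y → F*? y ×-dec (absTr (y ⊗ g a x) ≟L ι i))
  r*coefficient i a = begin
    r * coefficient i a                                                  ≡⟨ cong (_* coefficient i a) (sym count-F*) ⟩
    count F*? * coefficient i a                                          ≡⟨ sym (∑-*ʳ (coefficient i a) _) ⟩
    ∑[ y ] 𝟙 (F*? y) * coefficient i a                                   ≡⟨ ∑-cong (λ y → 𝟙*-cong (F*? y) (rescale y)) ⟩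
    ∑[ y ] 𝟙 (F*? y) * count (λ x → absTr (y ⊗ g a x) ≟L ι i)                ≡⟨ ∑-cong (λ y → sym (∑-𝟙× (F*? y) (λ x → absTr (y ⊗ g a x) ≟L ι i))) ⟩
    ∑[ y ] ∑[ x ] 𝟙 (F*? y ×-dec (absTr (y ⊗ g a x) ≟L ι i))                 ≡⟨ ∑-swap _ ⟩
    ∑[ x ] count (λ y → F*? y ×-dec (absTr (y ⊗ g a x) ≟L ι i))              ∎
    where
    open ≡-Reasoning
    rescale : ∀ y → F* y → coefficient i a ≡ count (λ x → absTr (y ⊗ g a x) ≟L ι i)
    rescale y hy = with-inverse (inverse y (proj₁ hy))
      where
      with-inverse : (∃ λ y′ → y ⊗ y′ ≡ 1#) → coefficient i a ≡ count (λ x → absTr (y ⊗ g a x) ≟L ι i)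
      with-inverse (y′ , e) = trans
        (sym (∑-reindex (y ⊗_) (y′ ⊗_)
          (λ x → combine₁ x e (solve 3 (λ y y′ x → y′ :* (y :* x) :- x := x :* (y :* y′ :- con (+ 1))) refl y y′ x))
          (λ x → combine₁ x e (solve 3 (λ y y′ x → y :* (y′ :* x) :- x := x :* (y :* y′ :- con (+ 1))) refl y y′ x))
          (λ x → 𝟙 (absTr (g a x) ≟L ι i))))
        (count-cong (λ x → absTr (g a (y ⊗ x)) ≟L ι i) (λ x → absTr (y ⊗ g a x) ≟L ι i)
          (λ x h → trans (cong absTr (sym (g-scale a x hy))) h) (λ x h → trans (cong absTr (g-scale a x hy)) h))

  -- Niho's formula in coordinates: the coefficients at 0 and at i differ by (N(a) - 1)q. Averaging
  -- over F* multiplies by q - 1; adding y = 0 for each of the q² elements x completes F* to F,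
  -- where `balanced` applies.
  coefficient-gap : ∀ a {i} → 0 < i → i < p → coefficient 0 a + q ≡ coefficient i a + q * N a
  coefficient-gap a {i} 0<i i<p = *-cancelˡ-≡ _ _ r {{>-nonZero 0<r}} (+-cancelʳ-≡ q _ _ (begin
    r * (coefficient 0 a + q) + q                                    ≡⟨ cong (λ z → r * (coefficient 0 a + z) + z) q≡1+r ⟩
    r * (coefficient 0 a + suc r) + suc r                            ≡⟨ regroup r (coefficient 0 a) ⟩
    r * coefficient 0 a + suc r * suc r                              ≡⟨ cong₂ _+_ (r*coefficient 0 a) (sym (cong₂ _*_ q≡1+r q≡1+r)) ⟩
    (∑[ x ] K 0 x) + q * q                                           ≡⟨ cong (λ j → (∑[ x ] K 0 x) + j) (sym (trans ∑-one order≡q*q)) ⟩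
    (∑[ x ] K 0 x) + (∑[ x ] 1)                                      ≡⟨ sym (∑-+ _ _) ⟩
    ∑[ x ] (K 0 x + 1)                                               ≡⟨ ∑-cong pointwise ⟩
    ∑[ x ] (K i x + 𝟙 (relTr (g a x) ≟L 0#) * q)                     ≡⟨ trans (∑-+ _ _) (cong₂ _+_ (sym (r*coefficient i a)) (trans (∑-*ʳ q _) (cong (_* q) (count-relTr-zeros a)))) ⟩
    r * coefficient i a + (1 + r * N a) * q                          ≡⟨ regroup′ r (coefficient i a) (N a) q ⟩
    r * (coefficient i a + q * N a) + q                              ∎))
    where
    open ≡-Reasoning
    K : ℕ → Carrier → ℕ
    K i x = count (λ y → F*? y ×-dec (absTr (y ⊗ g a x) ≟L ι i))
    pointwise : ∀ x → K 0 x + 1 ≡ K i x + 𝟙 (relTr (g a x) ≟L 0#) * q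
    pointwise x = begin
      K 0 x + 1                                                                              ≡⟨ trans (+-comm (K 0 x) 1) (cong (_+ K 0 x) (sym (𝟙-yes (0# ≟L 0#) refl))) ⟩
      𝟙 (0# ≟L ι 0) + K 0 x                                                                  ≡⟨ sym (count-F-split (g a x) 0) ⟩
      count (λ y → F? y ×-dec (absTr (y ⊗ g a x) ≟L 0#))                                         ≡⟨ balanced (g a x) 0<i i<p ⟩
      count (λ y → F? y ×-dec (absTr (y ⊗ g a x) ≟L ι i)) + 𝟙 (relTr (g a x) ≟L 0#) * q           ≡⟨ cong (_+ _) (trans (count-F-split (g a x) i) (cong (_+ K i x) (𝟙-no (0# ≟L ι i) (ι≢0 0<i i<p ∘ sym)))) ⟩
      K i x + 𝟙 (relTr (g a x) ≟L 0#) * q                                                    ∎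
    regroup : ∀ r w → r * (w + suc r) + suc r ≡ r * w + suc r * suc r
    regroup = solve-∀
    regroup′ : ∀ r w N q → r * w + (1 + r * N) * q ≡ r * (w + q * N) + q
    regroup′ = solve-∀

  -- By `prime-field` the search in `findFp` succeeds, and by injectivity of ι below p it can only
  -- return the right residue.
  μ-value : ∀ y (i : Fin p) → μ L p (2 * n) y i ≡ + 𝟙 (absTr y ≟L ι (toℕ i))
  μ-value y i = from-found (found (allFin p) (∈-allFin (fromℕ< c<p)) (trans y≡ιc (cong ι (sym (toℕ-fromℕ< c<p)))))
    where
    c<p = proj₁ (proj₂ (prime-field (absTr y) (absTr-↑p y)))
    y≡ιc = proj₂ (proj₂ (prime-field (absTr y) (absTr-↑p y)))
    found : ∀ {x d} cs → d ∈ cs → x ≡ ι (toℕ d) → ∃ λ e → findFp L p (2 * n) x cs ≡ just e × x ≡ ι (toℕ e)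
    found {x} (d ∷ cs) d∈ x≡ with x ≟L ι (toℕ d)
    found (d ∷ cs) d∈           x≡ | yes h = d , refl , h
    found (d ∷ cs) (here refl)  x≡ | no ¬h = ⊥-elim (¬h x≡)
    found (d ∷ cs) (there d∈cs) x≡ | no _  = found cs d∈cs x≡
    ζ-value : ∀ (e : Fin p) → ζ^ e i ≡ + 𝟙 (e Fin.≟ i)
    ζ-value e with e Fin.≟ i
    ... | yes _ = refl
    ... | no _  = refl
    from-found : (∃ λ e → TrFp L p (2 * n) y ≡ just e × absTr y ≡ ι (toℕ e)) → μ L p (2 * n) y i ≡ + 𝟙 (absTr y ≟L ι (toℕ i))
    from-found (e , eq , h) = trans (cong (λ (t : Maybe (Fin p)) → maybe {B = λ _ → Cyc p} ζ^ 0Cyc t i) eq) (trans (ζ-value e) (cong +_ (𝟙-cong (e Fin.≟ i) _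
      (λ { refl → h }) (λ h′ → toℕ-injective (ι-injective (toℕ<n e) (toℕ<n i) (trans (sym h) h′))))))

  W-coefficient : ∀ a (i : Fin p) → W L p (2 * n) (suc (k * r)) a i ≡ + coefficient (toℕ i) a
  W-coefficient a i = go elements
    where
    go : ∀ xs → sumCyc (λ x → μ L p (2 * n) (g a x)) xs i ≡ + sumOver (λ x → 𝟙 (absTr (g a x) ≟L ι (toℕ i))) xs
    go []       = refl
    go (x ∷ xs) = cong₂ ℤ._+_ (μ-value (g a x) i) (go xs)

  Weil : Carrier → Cyc p
  Weil = W L p (2 * n) (suc (k * r))

  -- Subtracting m from the coefficient at 0 leaves a constant vector; the constant is the
  -- coefficient at 1, an index that exists since 1 < p.
  Weil-value : ∀ a {m} → + (q * N a) ≡ m ℤ.+ + q → Weil a ≈Cyc embℤ m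
  Weil-value a {m} h = + coefficient 1 a , λ i → at i (toℕ i) refl
    where
    at : ∀ i j → toℕ i ≡ j → Weil a i ℤ.- embℤ m i ≡ + coefficient 1 a
    at i zero e = begin
      Weil a i ℤ.- embℤ m i                                          ≡⟨ cong₂ ℤ._-_ (trans (W-coefficient a i) (cong (λ j → + coefficient j a) e)) (embℤ-zero m i e) ⟩
      + coefficient 0 a ℤ.- m                                        ≡⟨ add-sub (+ coefficient 0 a) (+ q) m ⟩
      (+ (coefficient 0 a + q) ℤ.- + q) ℤ.- m                        ≡⟨ cong (λ z → (+ z ℤ.- + q) ℤ.- m) (coefficient-gap a (s≤s z≤n) 1<p) ⟩
      ((+ coefficient 1 a ℤ.+ + (q * N a)) ℤ.- + q) ℤ.- m            ≡⟨ cong (λ z → ((+ coefficient 1 a ℤ.+ z) ℤ.- + q) ℤ.- m) h ⟩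
      ((+ coefficient 1 a ℤ.+ (m ℤ.+ + q)) ℤ.- + q) ℤ.- m            ≡⟨ sub-add (+ coefficient 1 a) m (+ q) ⟩
      + coefficient 1 a                                              ∎
      where
      open ≡-Reasoning
      add-sub : ∀ w q m → w ℤ.- m ≡ ((w ℤ.+ q) ℤ.- q) ℤ.- m
      add-sub = ℤ-RingSolver.solve-∀
      sub-add : ∀ w m q → ((w ℤ.+ (m ℤ.+ q)) ℤ.- q) ℤ.- m ≡ w
      sub-add = ℤ-RingSolver.solve-∀
    at i (suc j) e = begin
      Weil a i ℤ.- embℤ m i                                          ≡⟨ cong₂ ℤ._-_ (W-coefficient a i) (embℤ-suc m i 0<i) ⟩
      + coefficient (toℕ i) a ℤ.- + 0                                ≡⟨ ℤ.+-identityʳ _ ⟩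
      + coefficient (toℕ i) a                                        ≡⟨ cong +_ (+-cancelʳ-≡ (q * N a) _ _ (trans (sym (coefficient-gap a 0<i (toℕ<n i))) (coefficient-gap a (s≤s z≤n) 1<p))) ⟩
      + coefficient 1 a                                              ∎
      where
      open ≡-Reasoning
      0<i : 0 < toℕ i
      0<i = subst (0 <_) (sym e) (s≤s z≤n)

  -- A constant vector does not change the difference of the coefficients at 0 and 1, and this
  -- difference is (N - 1)q.
  Weil-injective : ∀ a b → Weil a ≈Cyc Weil b → N a ≡ N b
  Weil-injective a b (e , h) = *-cancelˡ-≡ (N a) (N b) q {{>-nonZero (<-trans (s≤s z≤n) 1<q)}} (compare
    (coefficient 0 a) (coefficient 1 a) (coefficient 0 b) (coefficient 1 b)
    (coefficient-gap a (s≤s z≤n) 1<p) (coefficient-gap b (s≤s z≤n) 1<p)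
    (ℤ.+-injective (cross (+ coefficient 0 a) (+ coefficient 0 b) (+ coefficient 1 a) (+ coefficient 1 b)
      (trans (at (<-trans (s≤s z≤n) 1<p)) (sym (at 1<p))))))
    where
    at : ∀ {j} (j<p : j < p) → + coefficient j a ℤ.- + coefficient j b ≡ e
    at {j} j<p = trans (sym (cong₂ ℤ._-_ (W-at a) (W-at b))) (h (fromℕ< j<p))
      where
      W-at : ∀ a → Weil a (fromℕ< j<p) ≡ + coefficient j a
      W-at a = trans (W-coefficient a (fromℕ< j<p)) (cong (λ i → + coefficient i a) (toℕ-fromℕ< j<p))
    cross : ∀ x y z w → x ℤ.- y ≡ z ℤ.- w → x ℤ.+ w ≡ z ℤ.+ y
    cross x y z w eq = trans (left x y w) (trans (cong (ℤ._+ (y ℤ.+ w)) eq) (right z w y))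
      where
      left : ∀ x y w → x ℤ.+ w ≡ (x ℤ.- y) ℤ.+ (y ℤ.+ w)
      left = ℤ-RingSolver.solve-∀
      right : ∀ z w y → (z ℤ.- w) ℤ.+ (y ℤ.+ w) ≡ z ℤ.+ y
      right = ℤ-RingSolver.solve-∀
    compare : ∀ a₀ a₁ b₀ b₁ {x y} → a₀ + q ≡ a₁ + x → b₀ + q ≡ b₁ + y → a₀ + b₁ ≡ a₁ + b₀ → x ≡ y
    compare a₀ a₁ b₀ b₁ {x} {y} ea eb ec = +-cancelˡ-≡ (a₁ + (b₀ + q)) x y (begin
      a₁ + (b₀ + q) + x      ≡⟨ shuffle a₁ (b₀ + q) x ⟩
      (a₁ + x) + (b₀ + q)    ≡⟨ cong₂ _+_ (sym ea) eb ⟩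
      (a₀ + q) + (b₁ + y)    ≡⟨ shuffle′ a₀ q b₁ y ⟩
      (a₀ + b₁) + (q + y)    ≡⟨ cong (λ j → j + (q + y)) ec ⟩
      (a₁ + b₀) + (q + y)    ≡⟨ shuffle″ a₁ b₀ q y ⟩
      a₁ + (b₀ + q) + y      ∎)
      where
      open ≡-Reasoning
      shuffle : ∀ a b x → a + b + x ≡ (a + x) + b
      shuffle = solve-∀
      shuffle′ : ∀ a q b y → (a + q) + (b + y) ≡ (a + b) + (q + y)
      shuffle′ = solve-∀
      shuffle″ : ∀ a b q y → (a + b) + (q + y) ≡ a + (b + q) + y
      shuffle″ = solve-∀

  -- Five points with distinct Weil sums

  module FiveValues (5≤d : 5 ≤ d₁ + d₂) (odd-d : Odd (d₁ + d₂)) (d≤p : d₁ + d₂ ≤ p) (d*d≤q : d₁ * d₂ ≤ q) where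

    4≤B : 4 ≤ B
    4≤B = s≤s⁻¹ (subst (5 ≤_) (trans (sym B+1) (+-comm B 1)) 5≤d)

    B≤q : B ≤ q
    B≤q = ≤-trans (m≤m+n B 1) (≤-trans (≤-reflexive B+1) (≤-trans d≤p p≤q))

    0<d*d : 0 < d₁ * d₂
    0<d*d = *-mono-≤ {1} {d₁} {1} {d₂} (positive k) (positive k′)
      where
      positive : ∀ m → 0 < gcd m (suc q)
      positive m = n≢0⇒n>0 (gcd[m,n]≢0 m (suc q) (inj₂ λ ()))

    -- The equation w^{d₁d₂} = 1 has at most d₁d₂ ≤ q solutions, and U has q + 1 elements.
    non-root : ∃ λ w → U w × w ↑ (d₁ * d₂) ≢ 1#
    non-root = [ id , (λ none → ⊥-elim (<⇒≱ {d₁ * d₂} {suc q} (s≤s d*d≤q) (too-many none))) ]′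
      (search (λ w → U? w ×-dec ¬? (w ↑ (d₁ * d₂) ≟L 1#)))
      where
      too-many : (∀ w → ¬ (U w × w ↑ (d₁ * d₂) ≢ 1#)) → suc q ≤ d₁ * d₂
      too-many none = ≤-trans (≤-reflexive (sym count-U)) (≤-trans
        (∑-mono (λ w → 𝟙-mono (U? w) (w ↑ (d₁ * d₂) ≟L 1#) (λ hw → root w hw)))
        (↑-roots≤ (d₁ * d₂) 1# 0<d*d))
        where
        root : ∀ w → U w → w ↑ (d₁ * d₂) ≡ 1#
        root w hw with w ↑ (d₁ * d₂) ≟L 1#
        ... | yes e = e
        ... | no ¬e = ⊥-elim (none w (hw , ¬e))

    -- From d₁ + d₂ = 2α₀ + 1 the values N = 2α₀ + 1 and N = B = 2α₀ give the Weil sums 2α₀q and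
    -- (2α₀ - 1)q, so α = α₀ and β = α₀ - 1. Then β ≥ 1 amounts to d₁ + d₂ ≥ 5.
    α₀ : ℕ
    α₀ = proj₁ odd-d

    B≡2α : B ≡ 2 * α₀
    B≡2α = suc-injective (trans (+-comm 1 B) (trans B+1 (proj₂ odd-d)))

    2≤α : 2 ≤ α₀
    2≤α = *-cancelˡ-≤ 2 (subst (4 ≤_) B≡2α 4≤B)

    private
      p₀ p₂ p₄ : Carrier
      p₀ = proj₁ (exists-N≡1 4≤B B≤q)
      p₂ = proj₁ non-root ↑ (d₁ * d₂)
      p₄ = proj₁ (exists-2≤N<B 4≤B B≤q)
      p₁ = proj₁ (exists-N≡0 4≤B B≤q)

      N₀ : N p₀ ≡ 1
      N₀ = proj₂ (proj₂ (exists-N≡1 4≤B B≤q))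
      N₁ : N p₁ ≡ 0
      N₁ = proj₂ (exists-N≡0 4≤B B≤q)
      N₂ : N p₂ ≡ suc (2 * α₀)
      N₂ = trans (N-at-power (proj₁ (proj₂ non-root)) (proj₂ (proj₂ non-root))) (proj₂ odd-d)
      N₄ : 2 ≤ N p₄ × N p₄ < B
      N₄ = proj₂ (exists-2≤N<B 4≤B B≤q)

      0<1 : N p₁ < N p₀
      0<1 = subst₂ _<_ (sym N₁) (sym N₀) ≤-refl
      1<N₄ : N p₀ < N p₄
      1<N₄ = subst (_< N p₄) (sym N₀) (proj₁ N₄)
      B<N₂ : B < N p₂
      B<N₂ = subst₂ _<_ (sym B≡2α) (sym N₂) ≤-refl

    points : Fin 5 → Carrier
    points 0F = p₀
    points 1F = p₁
    points 2F = p₂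
    points 3F = 1#
    points 4F = p₄

    points≢0 : ∀ i → points i ≢ 0#
    points≢0 0F   = proj₁ (proj₂ (exists-N≡1 4≤B B≤q))
    points≢0 1F h = 0≢1+n (trans (sym N₁) (trans (cong N h) N-0))
    points≢0 2F   = U≢0 (U-↑ (d₁ * d₂) (proj₁ (proj₂ non-root)))
    points≢0 3F   = 1≢0
    points≢0 4F h = <⇒≱ (proj₁ N₄) (≤-reflexive (trans (cong N h) N-0))

    private
      -- The five values in increasing order, 0 < 1 < N p₄ < B < B + 1, prolonged to a strictly
      -- increasing sequence on ℕ, so that distinctness becomes injectivity instead of a check of
      -- all pairs.
      sorted : ℕ → ℕ
      sorted 0 = N p₁
      sorted 1 = N p₀
      sorted 2 = N p₄
      sorted 3 = B
      sorted (suc (suc (suc (suc j)))) = N p₂ + j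

      sorted-suc : ∀ j → sorted j < sorted (suc j)
      sorted-suc 0 = 0<1
      sorted-suc 1 = 1<N₄
      sorted-suc 2 = proj₂ N₄
      sorted-suc 3 = <-≤-trans B<N₂ (m≤m+n _ 0)
      sorted-suc (suc (suc (suc (suc j)))) = +-monoʳ-< (N p₂) (n<1+n j)

      sorted-< : ∀ {i j} → i < j → sorted i < sorted j
      sorted-< {i} i<j = go (≤⇒≤′ i<j)
        where
        go : ∀ {j} → suc i ≤′ j → sorted i < sorted j
        go ≤′-refl     = sorted-suc i
        go (≤′-step {j} h) = <-trans (go h) (sorted-suc j)

      sorted-injective : ∀ {i j} → sorted i ≡ sorted j → i ≡ j
      sorted-injective {i} {j} e with <-cmp i j
      ... | tri< i<j _ _ = ⊥-elim (<⇒≢ (sorted-< i<j) e)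
      ... | tri≈ _ i≡j _ = i≡j
      ... | tri> _ _ j<i = ⊥-elim (<⇒≢ (sorted-< j<i) (sym e))

      rank : Fin 5 → ℕ
      rank 0F = 1
      rank 1F = 0
      rank 2F = 4
      rank 3F = 3
      rank 4F = 2

      rank-injective : ∀ {i j} → rank i ≡ rank j → i ≡ j
      rank-injective {i} {j} e = trans (sym (unrank-rank i)) (trans (cong unrank e) (unrank-rank j))
        where
        unrank : ℕ → Fin 5
        unrank 0 = 1F
        unrank 1 = 0F
        unrank 2 = 4F
        unrank 3 = 3F
        unrank _ = 2F
        unrank-rank : ∀ i → unrank (rank i) ≡ i
        unrank-rank 0F = refl
        unrank-rank 1F = refl
        unrank-rank 2F = refl
        unrank-rank 3F = refl
        unrank-rank 4F = refl

      N-points : ∀ i → N (points i) ≡ sorted (rank i)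
      N-points 0F = refl
      N-points 1F = refl
      N-points 2F = sym (+-identityʳ (N p₂))
      N-points 3F = refl
      N-points 4F = refl

    points-distinct : ∀ i j → i ≢ j → ¬ (Weil (points i) ≈Cyc Weil (points j))
    points-distinct i j i≢j h = i≢j (rank-injective (sorted-injective
      (trans (sym (N-points i)) (trans (Weil-injective (points i) (points j) h) (N-points j)))))

    Weil-0 : Weil (points 0F) ≈Cyc embℤ (+ 0)
    Weil-0 = Weil-value p₀ (cong +_ (trans (cong (q *_) N₀) (*-identityʳ q)))

    Weil-1 : Weil (points 1F) ≈Cyc embℤ (- (+ q))
    Weil-1 = Weil-value p₁ (trans (cong +_ (trans (cong (q *_) N₁) (*-zeroʳ q))) (sym (ℤ.+-inverseˡ (+ q))))

    Weil-2 : ∃ λ α → 1 ≤ α × Weil (points 2F) ≈Cyc embℤ (+ (2 * α * q))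
    Weil-2 = α₀ , <⇒≤ 2≤α , Weil-value p₂ (cong +_ (trans (cong (q *_) N₂) (lemma q α₀)))
      where
      lemma : ∀ q α → q * suc (2 * α) ≡ 2 * α * q + q
      lemma = solve-∀

    Weil-3 : ∃ λ β → 1 ≤ β × Weil (points 3F) ≈Cyc embℤ (+ ((2 * β + 1) * q))
    Weil-3 = α₀ ∸ 1 , m<n⇒0<n∸m 2≤α , Weil-value 1# (cong +_ (trans (cong (q *_) B≡2α)
      (trans (cong (λ α → q * (2 * α)) (sym (m+[n∸m]≡n (<⇒≤ 2≤α)))) (lemma q (α₀ ∸ 1)))))
      where
      lemma : ∀ q β → q * (2 * suc β) ≡ (2 * β + 1) * q + q
      lemma = solve-∀

-- Bounds on d₁ and d₂ from the hypotheses on k, n and s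

theorem1p10 : (p n : ℕ) → Prime p → p % 2 ≡ 1 → 2 ≤ n →
    (L : FiniteField) → FiniteField.order L ≡ p ^ (2 * n) →
    (k : ℕ) → 2 ≤ k → 2 * k < p + 2 →
    (s : ℕ) → s ≡ 1 + k * (p ^ n ∸ 1) →
    gcd s (p ^ (2 * n) ∸ 1) ≡ 1 → IsNiho p n s →
    5 ≤ gcd k (p ^ n + 1) + gcd (k ∸ 1) (p ^ n + 1) →
    ∃ λ (a : Fin 5 → FiniteField.Carrier L) →
    (∀ i → a i ≢ FiniteField.0# L)
    × (∀ i j → i ≢ j → ¬ (W L p (2 * n) s (a i) ≈Cyc W L p (2 * n) s (a j)))
    × (W L p (2 * n) s (a (# 0)) ≈Cyc embℤ (+ 0))
    × (W L p (2 * n) s (a (# 1)) ≈Cyc embℤ (- (+ (p ^ n))))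
    × (∃ λ α → 1 ≤ α × (W L p (2 * n) s (a (# 2)) ≈Cyc embℤ (+ (2 * α * p ^ n))))
    × (∃ λ β → 1 ≤ β × (W L p (2 * n) s (a (# 3)) ≈Cyc embℤ (+ ((2 * β + 1) * p ^ n))))
theorem1p10 p n prime-p p%2≡1 2≤n L order≡ (suc k′) (s≤s 1≤k′) 2k<p+2 s refl gcd-s≡1 _ 5≤d =
  points , points≢0 , points-distinct , Weil-0 , Weil-1 , Weil-2 , Weil-3
  where
  0<n : 0 < n
  0<n = <⇒≤ 2≤n

  odd-p : Odd p
  odd-p = p / 2 , trans (m≡m%n+[m/n]*n p 2) (cong₂ _+_ p%2≡1 (*-comm (p / 2) 2))

  -- s + (2k - 1) = k (q + 1).
  coprime : gcd (suc (k′ + k′)) (suc (p ^ n)) ≡ 1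
  coprime = ∣1⇒≡1 (subst (e ∣_) gcd-s≡1 (gcd-greatest e∣s e∣order-1))
    where
    open QuadraticExtension L p n prime-p 0<n order≡ using (r; q≡1+r; order≡1+)
    e = gcd (suc (k′ + k′)) (suc (p ^ n))
    e∣order-1 : e ∣ p ^ (2 * n) ∸ 1
    e∣order-1 = subst (e ∣_) (trans (cong (_∸ 1) (sym order≡1+)) (cong (_∸ 1) order≡))
      (∣m⇒∣m*n r (gcd[m,n]∣n (suc (k′ + k′)) (suc (p ^ n))))
    e∣s : e ∣ suc (suc k′ * r)
    e∣s = ∣m+n∣m⇒∣n (subst (e ∣_) (trans (cong (suc k′ *_) (cong suc q≡1+r)) (lemma k′ r))
      (∣-trans (gcd[m,n]∣n (suc (k′ + k′)) (suc (p ^ n))) (n∣m*n (suc k′)))) (gcd[m,n]∣m (suc (k′ + k′)) (suc (p ^ n)))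
      where
      lemma : ∀ k r → suc k * suc (suc r) ≡ suc (k + k) + suc (suc k * r)
      lemma = solve-∀

  open NihoWeilSum L p n prime-p 0<n order≡ k′ coprime

  5≤d′ : 5 ≤ d₁ + d₂
  5≤d′ = subst (λ m → 5 ≤ gcd (suc k′) m + gcd k′ m) (+-comm (p ^ n) 1) 5≤d

  odd-d : Odd (d₁ + d₂)
  odd-d = gcd-sum-odd k′ (odd-^ n odd-p)

  d₁≤k : d₁ ≤ suc k′
  d₁≤k = ∣⇒≤ (gcd[m,n]∣m (suc k′) (suc (p ^ n)))

  d₂≤k′ : d₂ ≤ k′
  d₂≤k′ = ∣⇒≤ {{>-nonZero 1≤k′}} (gcd[m,n]∣m k′ (suc (p ^ n)))

  2k-1≤p : suc k′ + k′ ≤ p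
  2k-1≤p = +-cancelʳ-≤ 2 _ _ (subst (_≤ p + 2) (lemma k′) 2k<p+2)
    where
    lemma : ∀ k′ → suc (2 * suc k′) ≡ suc k′ + k′ + 2
    lemma = solve-∀

  d≤p : d₁ + d₂ ≤ p
  d≤p = ≤-trans (+-mono-≤ d₁≤k d₂≤k′) 2k-1≤p

  d*d≤q : d₁ * d₂ ≤ p ^ n
  d*d≤q = begin
    d₁ * d₂      ≤⟨ *-mono-≤ (m+n≤o⇒m≤o d₁ d≤p) (m+n≤o⇒n≤o d₁ d≤p) ⟩
    p * p        ≡⟨ cong (p *_) (sym (*-identityʳ p)) ⟩
    p ^ 2        ≤⟨ ^-monoʳ-≤ p 2≤n ⟩
    p ^ n        ∎
    where open ≤-Reasoning

  open FiveValues 5≤d′ odd-d d≤p d*d≤q
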